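{- For all positive integers $k,t$ with $k\ge t$ there exists $\ell_0$ such that for every $\ell\ge \ell_0$ and every profile $P=(k_1,\ldots,k_\ell)$ with $k_\ell=k$, every largest partially $t$-intersecting subfamily of $\mathcal{U}_P$ is of the form $\mathcal{C}^T_P$ for some $t$-element set $T\subset[n]$.
   Context: A profile is a non-decreasing sequence $P=(k_1,\ldots,k_\ell)$ of positive integers; $n=\sum_i k_i$. $\mathcal{U}_P$ is the family of partitions of $[n]$ into $\ell$ parts whose part sizes are $k_1,\ldots,k_\ell$. Two partitions partially $t$-intersect if some part of one and some part of the other share at least $t$ elements; a family is partially $t$-intersecting if any two members partially $t$-intersect. For a $t$-element $T\subset[n]$, $\mathcal{C}^T_P$ consists of all partitions in $\mathcal{U}_P$ having a part that fully contains $T$. -}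

module Defs where

open import Data.Nat using (ℕ; zero; suc; _≤_)
open import Data.Fin using (Fin; _≟_)
open import Data.Fin.Subset using (Subset; ∣_∣; _∩_; _⊆_)
open import Data.Vec using (Vec; []; _∷_; lookup; tabulate; sum)
open import Data.List using (List; length)
open import Data.List.Membership.Propositional using (_∈_)
open import Data.List.Relation.Unary.All using (All)
open import Data.List.Relation.Unary.Unique.Propositional using (Unique)
open import Data.Product using (Σ; ∃; ∃-syntax; _×_)
open import Data.Empty using (⊥)
open import Data.Unit using (⊤)
open import Relation.Binary.PropositionalEquality using (_≡_)
open import Relation.Nullary.Decidable using (⌊_⌋)

NonDecreasing : ∀ {ℓ} → Vec ℕ ℓ → Set
NonDecreasing [] = ⊤
NonDecreasing (x ∷ []) = ⊤
NonDecreasing (x ∷ y ∷ xs) = (x ≤ y) × NonDecreasing (y ∷ xs)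

AllPositive : ∀ {ℓ} → Vec ℕ ℓ → Set
AllPositive [] = ⊤
AllPositive (x ∷ xs) = (1 ≤ x) × AllPositive xs

IsProfile : ∀ {ℓ} → Vec ℕ ℓ → Set
IsProfile P = AllPositive P × NonDecreasing P

LastIs : ∀ {ℓ} → Vec ℕ ℓ → ℕ → Set
LastIs [] k = ⊥
LastIs (x ∷ []) k = x ≡ k
LastIs (x ∷ y ∷ xs) k = LastIs (y ∷ xs) k

-- A partition of [n] is represented canonically by its "same part" matrix:
-- row x is the part containing x (as a subset of Fin n).
Partition : ℕ → Set
Partition n = Vec (Subset n) n

induced : ∀ {n ℓ} → (Fin n → Fin ℓ) → Partition n
induced f = tabulate λ x → tabulate λ y → ⌊ f x ≟ f y ⌋

InU : ∀ {ℓ} (P : Vec ℕ ℓ) → Partition (sum P) → Set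
InU {ℓ} P R = ∃[ f ] ((∀ (i : Fin ℓ) → ∣ tabulate (λ j → ⌊ f j ≟ i ⌋) ∣ ≡ lookup P i)
                      × R ≡ induced f)

PInt : ∀ {n} → ℕ → Partition n → Partition n → Set
PInt t R S = ∃[ x ] ∃[ y ] (t ≤ ∣ lookup R x ∩ lookup S y ∣)

InC : ∀ {ℓ} (P : Vec ℕ ℓ) → Subset (sum P) → Partition (sum P) → Set
InC P T R = InU P R × ∃[ x ] (T ⊆ lookup R x)

PIFamily : ∀ {ℓ} (P : Vec ℕ ℓ) → ℕ → List (Partition (sum P)) → Set
PIFamily P t F = Unique F × All (InU P) F
               × (∀ A B → A ∈ F → B ∈ F → PInt t A B)

Largest : ∀ {ℓ} (P : Vec ℕ ℓ) → ℕ → List (Partition (sum P)) → Set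
Largest P t F = PIFamily P t F
              × (∀ G → PIFamily P t G → length G ≤ length F)

{-# OPTIONS --safe #-}
module Submission where

-- Spread approximation after Kupavskii and Zakharov. Identify a partition with the set E(B) of the t-sets inside its
-- parts. Any j distinct t-sets inside parts occupy at least of order j parts, so for t ≥ 2 the family of all partitions
-- is very spread. A family F is decomposed greedily into pieces that are spread above kernels X ⊆ E(B) of size at most
-- q = O(log n), up to a tiny rest; by the spread lemma two disjoint kernels would give two members of F without a common
-- t-set, so the kernels intersect. If no t-set lies in all kernels, then F without the rest is covered by q² pairs of
-- t-sets and is far smaller than a star. Otherwise F is almost contained in the star of some e. A member A of F outside
-- that star would then exclude from F all partitions of the star that have no t-set in common with A; by successive
-- transpositions these are an inverse polynomial fraction of the star, more than the rest can make up for.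

open import Defs
  using (Partition; induced; InU; PInt; InC; PIFamily; Largest; IsProfile; LastIs; NonDecreasing;
    AllPositive)
open import Data.Bool using (Bool; true; false; if_then_else_)
open import Data.Empty using (⊥-elim)
open import Data.Fin as Fin using (Fin; zero; suc; _≟_; _↑ˡ_; _↑ʳ_)
open import Data.Fin.Permutation.Components using (transpose)
open import Data.Fin.Properties as Finₚ using (any?; ↑ˡ-injective; ↑ʳ-injective)
open import Data.Fin.Subset as Subset using (Subset; Nonempty; ∣_∣; _∪_; _∩_; _─_; ⁅_⁆)
  renaming (_∈_ to _∈ˢ_; _∉_ to _∉ˢ_; _⊆_ to _⊆ˢ_; ⊥ to ∅ˢ)
open import Data.Fin.Subset.Properties as Subsetₚ
  using (_⊆?_; _∈?_; nonempty?; drop-∷-⊆; x∈p∪q⁻; x∈p∩q⁻; x∈p∩q⁺; p─q⊆p; x∈p∧x∉q⇒x∈p─q)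
open import Data.List
  using (List; []; _∷_; _++_; length; map; cartesianProductWith; filter; allFin; deduplicate)
open import Data.List.Membership.Propositional using (_∈_; _∉_; lose; find)
open import Data.List.Membership.Propositional.Properties as ∈ₚ
  using (∈-map⁻; ∈-map⁺; ∈-++⁻; ∈-++⁺ˡ; ∈-++⁺ʳ; ∈-∃++; ∈-filter⁺; ∈-filter⁻; ∈-allFin)
open import Data.List.Properties as Listₚ using (map-tabulate; length-map; length-tabulate)
open import Data.List.Relation.Unary.All as All using (All; []; _∷_)
open import Data.List.Relation.Unary.Any as Any using (Any; here; there)
open import Data.List.Relation.Unary.Any.Properties using (lookup-index)
open import Data.List.Relation.Unary.AllPairs using ([]; _∷_)
open import Data.List.Relation.Unary.Unique.Propositional using (Unique)
open import Data.List.Relation.Unary.Unique.DecPropositional.Properties using (deduplicate-!)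
open import Data.List.Relation.Unary.Unique.Propositional.Properties as Unique using (allFin⁺)
open import Data.Nat
  using (ℕ; zero; suc; _+_; _*_; _^_; _≤_; _<_; z≤n; s≤s; s<s⁻¹; s≤s⁻¹; _≤?_; _<?_; ⌊_/2⌋; _∸_;
    >-nonZero)
open import Data.Nat.Properties as ℕₚ using (module ≤-Reasoning)
open import Data.Nat.Tactic.RingSolver using (solve-∀)
open import Data.Product using (∃-syntax; _×_; _,_; proj₁; proj₂)
open import Data.Sum using (_⊎_; inj₁; inj₂)
open import Data.Vec as Vec using (Vec; []; _∷_; lookup; sum)
open import Data.Vec.Properties as Vecₚ
  using (lookup-map; lookup-zipWith; []=⇒lookup; lookup⇒[]=; lookup∘tabulate; tabulate-cong;
    tabulate∘lookup)
open import Function using (_∘_; case_of_)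
open import Function.Bundles using (_⇔_; mk⇔)
open import Relation.Binary.PropositionalEquality
open import Relation.Nullary using (Dec; yes; no; ¬_; does; contradiction)
open import Relation.Nullary.Decidable using (⌊_⌋; _×-dec_; ¬?; dec-true; dec-false)
open import Relation.Unary using (Decidable)

-- Two demands compete. The spread lemma needs spreadness polynomial in the number `R` of its
-- rounds, and as each round halves the pieces of `E B`, `R` is about log n. The rest of the
-- decomposition is a fraction of about r^(-q) of all partitions. It must be below an inverse
-- polynomial in n, because a largest family is only known to hold a 1/v fraction of all partitions,
-- and the part of a star without conflicts only an inverse polynomial fraction of the star. This
-- forces `q` to be of order `R`. Swaps pay for both: one swap gains a factor of order n, while
-- every demand is polynomial in log n. All partitions are assumed spread with r * r, not r. One
-- factor r finds the kernels as maxima of a potential, the other makes the rest small. The case t =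
-- 1 is separate because a t-set must force two points into one part for a swap to say anything;
-- there every star is the whole of 𝓤. Fractions are multiplied out throughout, so probabilities and
-- expectations appear as sums over lists, compared in ℕ.

private variable
  A B : Set
  κ ν : ℕ

-- Sums over lists and indicators

⟦_⟧ : {P : Set} → Dec P → ℕ
⟦ d ⟧ = if does d then 1 else 0

⟦⟧-≤ : {P : Set} (d : Dec P) {b : ℕ} → (P → 1 ≤ b) → ⟦ d ⟧ ≤ b
⟦⟧-≤ (yes p) f = f p
⟦⟧-≤ (no _)  f = z≤n

⟦⟧-*-≤ : {P : Set} (d : Dec P) {a b : ℕ} → (P → a ≤ b) → ⟦ d ⟧ * a ≤ b
⟦⟧-*-≤ (yes p) {a} f = subst (_≤ _) (sym (ℕₚ.+-identityʳ a)) (f p)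
⟦⟧-*-≤ (no _)  f = z≤n

⟦⟧-yes : {P : Set} (d : Dec P) → P → ⟦ d ⟧ ≡ 1
⟦⟧-yes (yes _) p = refl
⟦⟧-yes (no ¬p) p = contradiction p ¬p

⟦⟧-no : {P : Set} (d : Dec P) → ¬ P → ⟦ d ⟧ ≡ 0
⟦⟧-no (yes p) ¬p = contradiction p ¬p
⟦⟧-no (no _)  ¬p = refl

⟦⟧-1≤ : {P : Set} (d : Dec P) → P → 1 ≤ ⟦ d ⟧
⟦⟧-1≤ d p = ℕₚ.≤-reflexive (sym (⟦⟧-yes d p))

⟦⟧-≤1 : {P : Set} (d : Dec P) → ⟦ d ⟧ ≤ 1
⟦⟧-≤1 d = ⟦⟧-≤ d λ _ → ℕₚ.≤-refl

⟦⟧-mono : {P Q : Set} (d : Dec P) (e : Dec Q) → (P → Q) → ⟦ d ⟧ ≤ ⟦ e ⟧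
⟦⟧-mono d e f = ⟦⟧-≤ d λ p → ⟦⟧-1≤ e (f p)

⟦⟧-zero : {P : Set} (d : Dec P) → ⟦ d ⟧ ≡ 0 → ¬ P
⟦⟧-zero d eq p = case trans (sym eq) (⟦⟧-yes d p) of λ ()

⟦⟧-pos : {P : Set} (d : Dec P) → 1 ≤ ⟦ d ⟧ → P
⟦⟧-pos (yes p) _ = p

∑ : List A → (A → ℕ) → ℕ
∑ []       φ = 0
∑ (x ∷ xs) φ = φ x + ∑ xs φ

∑-mono : ∀ (xs : List A) {φ ψ : A → ℕ} → (∀ {x} → x ∈ xs → φ x ≤ ψ x) → ∑ xs φ ≤ ∑ xs ψ
∑-mono []       f = z≤n
∑-mono (x ∷ xs) f = ℕₚ.+-mono-≤ (f (here refl)) (∑-mono xs (f ∘ there))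

∑-cong : ∀ (xs : List A) {φ ψ : A → ℕ} → (∀ {x} → x ∈ xs → φ x ≡ ψ x) → ∑ xs φ ≡ ∑ xs ψ
∑-cong []       f = refl
∑-cong (x ∷ xs) f = cong₂ _+_ (f (here refl)) (∑-cong xs (f ∘ there))

∑-+ : ∀ (xs : List A) (φ ψ : A → ℕ) → ∑ xs (λ x → φ x + ψ x) ≡ ∑ xs φ + ∑ xs ψ
∑-+ []       φ ψ = refl
∑-+ (x ∷ xs) φ ψ rewrite ∑-+ xs φ ψ = lemma (φ x) (ψ x) (∑ xs φ) (∑ xs ψ)
  where
  lemma : ∀ a b c d → a + b + (c + d) ≡ a + c + (b + d)
  lemma = solve-∀

∑-*ʳ : ∀ (xs : List A) (φ : A → ℕ) a → ∑ xs (λ x → φ x * a) ≡ ∑ xs φ * a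
∑-*ʳ []       φ a = refl
∑-*ʳ (x ∷ xs) φ a = trans (cong (φ x * a +_) (∑-*ʳ xs φ a)) (sym (ℕₚ.*-distribʳ-+ a (φ x) (∑ xs φ)))

∑-*ˡ : ∀ (xs : List A) (φ : A → ℕ) a → ∑ xs (λ x → a * φ x) ≡ a * ∑ xs φ
∑-*ˡ xs φ a = trans (∑-cong xs λ {x} _ → ℕₚ.*-comm a (φ x)) (trans (∑-*ʳ xs φ a) (ℕₚ.*-comm _ a))

∑-const : ∀ (xs : List A) a → ∑ xs (λ _ → a) ≡ length xs * a
∑-const []       a = refl
∑-const (x ∷ xs) a = cong (a +_) (∑-const xs a)

∑-0 : ∀ (xs : List A) → ∑ xs (λ _ → 0) ≡ 0
∑-0 xs = trans (∑-const xs 0) (ℕₚ.*-zeroʳ (length xs))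

∑-1 : ∀ (xs : List A) → ∑ xs (λ _ → 1) ≡ length xs
∑-1 xs = trans (∑-const xs 1) (ℕₚ.*-identityʳ _)

∑-bound : ∀ (xs : List A) {φ : A → ℕ} {a} → (∀ {x} → x ∈ xs → φ x ≤ a) → ∑ xs φ ≤ length xs * a
∑-bound xs {a = a} f = ℕₚ.≤-trans (∑-mono xs f) (ℕₚ.≤-reflexive (∑-const xs a))

∑-swap : ∀ (xs : List A) (ys : List B) (φ : A → B → ℕ) →
         ∑ xs (λ x → ∑ ys (φ x)) ≡ ∑ ys (λ y → ∑ xs (λ x → φ x y))
∑-swap []       ys φ = sym (∑-0 ys)
∑-swap (x ∷ xs) ys φ =
  trans (cong (∑ ys (φ x) +_) (∑-swap xs ys φ)) (sym (∑-+ ys (φ x) (λ y → ∑ xs (λ x → φ x y))))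

∑-term : ∀ {xs : List A} {x} (φ : A → ℕ) → x ∈ xs → φ x ≤ ∑ xs φ
∑-term φ (here refl) = ℕₚ.m≤m+n _ _
∑-term φ (there x∈)  = ℕₚ.≤-trans (∑-term φ x∈) (ℕₚ.m≤n+m _ _)

∑-++ : ∀ (xs ys : List A) φ → ∑ (xs ++ ys) φ ≡ ∑ xs φ + ∑ ys φ
∑-++ []       ys φ = refl
∑-++ (x ∷ xs) ys φ = trans (cong (φ x +_) (∑-++ xs ys φ)) (sym (ℕₚ.+-assoc (φ x) _ _))

∑-map : ∀ (f : A → B) xs φ → ∑ (map f xs) φ ≡ ∑ xs (φ ∘ f)
∑-map f []       φ = refl
∑-map f (x ∷ xs) φ = cong (φ (f x) +_) (∑-map f xs φ)

∑-filter : ∀ {P : A → Set} (P? : Decidable P) xs φ → ∑ (filter P? xs) φ ≡ ∑ xs (λ x → ⟦ P? x ⟧ * φ x)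
∑-filter P? []       φ = refl
∑-filter P? (x ∷ xs) φ with P? x
... | yes _ = cong₂ _+_ (sym (ℕₚ.+-identityʳ _)) (∑-filter P? xs φ)
... | no  _ = ∑-filter P? xs φ

length-filter : ∀ {P : A → Set} (P? : Decidable P) xs → length (filter P? xs) ≡ ∑ xs (λ x → ⟦ P? x ⟧)
length-filter P? xs = trans (sym (∑-1 (filter P? xs)))
  (trans (∑-filter P? xs (λ _ → 1)) (∑-cong xs λ _ → ℕₚ.*-identityʳ _))

length-filter-split : ∀ {P : A → Set} (P? : Decidable P) (¬P? : Decidable (¬_ ∘ P)) xs →
  length (filter P? xs) + length (filter ¬P? xs) ≡ length xs
length-filter-split P? ¬P? [] = refl
length-filter-split P? ¬P? (x ∷ xs) with P? x | ¬P? x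
... | yes p | yes ¬p = contradiction p ¬p
... | yes p | no _   = cong suc (length-filter-split P? ¬P? xs)
... | no _  | yes _  = trans (ℕₚ.+-suc _ _) (cong suc (length-filter-split P? ¬P? xs))
... | no ¬p | no ¬¬p = contradiction ¬p ¬¬p

∑-exceeds : ∀ (xs : List A) φ a → length xs * a < ∑ xs φ → ∃[ x ] (x ∈ xs × a < φ x)
∑-exceeds (x ∷ xs) φ a lt with suc a ≤? φ x
... | yes a<φx = x , here refl , a<φx
... | no  a≮φx with ∑-exceeds xs φ a
    (ℕₚ.+-cancelˡ-< a _ _ (ℕₚ.<-≤-trans lt (ℕₚ.+-monoˡ-≤ _ (ℕₚ.≮⇒≥ a≮φx))))
... | y , y∈ , a<φy = y , there y∈ , a<φy

∑-vanishes : ∀ (xs : List A) φ → ∑ xs φ < length xs → ∃[ x ] (x ∈ xs × φ x ≡ 0)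
∑-vanishes (x ∷ xs) φ lt with φ x in eq
... | zero  = x , here refl , eq
... | suc m with ∑-vanishes xs φ (ℕₚ.≤-<-trans (ℕₚ.m≤n+m _ m) (s<s⁻¹ lt))
... | y , y∈ , eq′ = y , there y∈ , eq′

∑-⊆ : ∀ {xs ys : List A} φ → Unique xs → (∀ {x} → x ∈ xs → x ∈ ys) → ∑ xs φ ≤ ∑ ys φ
∑-⊆ {xs = []} φ u f = z≤n
∑-⊆ {xs = x ∷ xs} {ys} φ (x∉ ∷ u) f with ∈-∃++ (f (here refl))
... | ys₁ , ys₂ , refl = begin
    φ x + ∑ xs φ               ≤⟨ ℕₚ.+-monoʳ-≤ (φ x) (∑-⊆ φ u g) ⟩
    φ x + ∑ (ys₁ ++ ys₂) φ     ≡⟨ cong (φ x +_) (∑-++ ys₁ ys₂ φ) ⟩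
    φ x + (∑ ys₁ φ + ∑ ys₂ φ)  ≡⟨ lemma (φ x) (∑ ys₁ φ) (∑ ys₂ φ) ⟩
    ∑ ys₁ φ + (φ x + ∑ ys₂ φ)  ≡⟨ ∑-++ ys₁ (x ∷ ys₂) φ ⟨
    ∑ (ys₁ ++ x ∷ ys₂) φ       ∎
  where
  open ≤-Reasoning
  lemma : ∀ a b c → a + (b + c) ≡ b + (a + c)
  lemma = solve-∀
  g : ∀ {y} → y ∈ xs → y ∈ ys₁ ++ ys₂
  g y∈ with ∈-++⁻ ys₁ (f (there y∈))
  ... | inj₁ p            = ∈-++⁺ˡ p
  ... | inj₂ (here refl)  = contradiction refl (All.lookup x∉ y∈)
  ... | inj₂ (there p)    = ∈-++⁺ʳ ys₁ p

length-⊆ : ∀ {xs ys : List A} → Unique xs → (∀ {x} → x ∈ xs → x ∈ ys) → length xs ≤ length ys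
length-⊆ {xs = xs} {ys} u f = subst₂ _≤_ (∑-1 xs) (∑-1 ys) (∑-⊆ (λ _ → 1) u f)

-- The bound `le` is proved for every summand; applied to `φ ∘ τ` it gives the converse inequality.
-- This is what makes sums over all partitions invariant under a transposition of points.
∑-involution : ∀ {xs : List A} (τ : A → A) φ → Unique xs →
  (∀ {x} → x ∈ xs → τ x ∈ xs) → (∀ {x} → x ∈ xs → τ (τ x) ≡ x) →
  ∑ xs (φ ∘ τ) ≡ ∑ xs φ
∑-involution {xs = xs} τ φ u τ∈ ττ = ℕₚ.≤-antisym (le φ) (begin
  ∑ xs φ            ≡⟨ ∑-cong xs (λ x∈ → cong φ (ττ x∈)) ⟨
  ∑ xs (φ ∘ τ ∘ τ)  ≤⟨ le (φ ∘ τ) ⟩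
  ∑ xs (φ ∘ τ)      ∎)
  where
  open ≤-Reasoning
  uniq : ∀ {ys} → Unique ys → (∀ {x} → x ∈ ys → x ∈ xs) → Unique (map τ ys)
  uniq [] _ = []
  uniq (y∉ ∷ uys) ⊆xs = All.tabulate (λ z∈ eq → sep z∈ eq) ∷ uniq uys (⊆xs ∘ there)
    where
    sep : ∀ {z} → z ∈ map τ _ → τ _ ≡ z → _
    sep z∈ eq with ∈-map⁻ τ z∈
    ... | w , w∈ , refl = All.lookup y∉ w∈
      (trans (sym (ττ (⊆xs (here refl)))) (trans (cong τ eq) (ττ (⊆xs (there w∈)))))
  into : ∀ {x} → x ∈ map τ xs → x ∈ xs
  into x∈ with ∈-map⁻ τ x∈
  ... | y , y∈ , refl = τ∈ y∈
  le : ∀ ψ → ∑ xs (ψ ∘ τ) ≤ ∑ xs ψ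
  le ψ = begin
    ∑ xs (ψ ∘ τ)    ≡⟨ ∑-map τ xs ψ ⟨
    ∑ (map τ xs) ψ  ≤⟨ ∑-⊆ ψ (uniq u (λ x∈ → x∈)) into ⟩
    ∑ xs ψ          ∎

argmax : ∀ (φ : A → ℕ) (x₀ : A) xs → ∃[ x ] (∀ {y} → y ∈ xs → φ y ≤ φ x)
argmax φ x₀ []       = x₀ , λ ()
argmax φ x₀ (x ∷ xs) with argmax φ x₀ xs
... | y , max with ℕₚ.≤-total (φ x) (φ y)
... | inj₁ x≤y = y , λ { (here refl) → x≤y ; (there z∈) → max z∈ }
... | inj₂ y≤x = x , λ { (here refl) → ℕₚ.≤-refl ; (there z∈) → ℕₚ.≤-trans (max z∈) y≤x }

∑-allFin-suc : ∀ n (φ : Fin (suc n) → ℕ) → ∑ (allFin (suc n)) φ ≡ φ zero + ∑ (allFin n) (φ ∘ suc)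
∑-allFin-suc n φ = cong (φ zero +_)
  (trans (cong (λ xs → ∑ xs φ) (sym (map-tabulate (λ i → i) suc))) (∑-map suc (allFin n) φ))

length-allFin : ∀ n → length (allFin n) ≡ n
length-allFin n = length-tabulate {n = n} (λ i → i)

∣∣-∑ : ∀ {n} (p : Subset n) → ∣ p ∣ ≡ ∑ (allFin n) (λ i → ⟦ i ∈? p ⟧)
∣∣-∑ [] = refl
∣∣-∑ {suc n} (true  ∷ p) =
  trans (cong suc (trans (∣∣-∑ p) (∑-cong (allFin n) λ {i} _ → refl))) (sym (∑-allFin-suc n (λ i → ⟦ i ∈? (true ∷ p) ⟧)))
∣∣-∑ {suc n} (false ∷ p) =
  trans (trans (∣∣-∑ p) (∑-cong (allFin n) λ {i} _ → refl)) (sym (∑-allFin-suc n (λ i → ⟦ i ∈? (false ∷ p) ⟧)))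

-- Enumeration of vectors

vecs : List A → ∀ n → List (Vec A n)
vecs xs zero    = [] ∷ []
vecs xs (suc n) = cartesianProductWith _∷_ xs (vecs xs n)

∑-product : ∀ {C : Set} (f : A → B → C) xs ys φ → ∑ (cartesianProductWith f xs ys) φ ≡ ∑ xs (λ x → ∑ ys (λ y → φ (f x y)))
∑-product f []       ys φ = refl
∑-product f (x ∷ xs) ys φ =
  trans (∑-++ (map (f x) ys) _ φ) (cong₂ _+_ (∑-map (f x) ys φ) (∑-product f xs ys φ))

∑-vecs-suc : ∀ (xs : List A) n φ → ∑ (vecs xs (suc n)) φ ≡ ∑ xs (λ x → ∑ (vecs xs n) (λ v → φ (x ∷ v)))
∑-vecs-suc xs n φ = ∑-product _∷_ xs (vecs xs n) φ

length-vecs : ∀ (xs : List A) n → length (vecs xs n) ≡ length xs ^ n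
length-vecs xs zero    = refl
length-vecs xs (suc n) = begin
  length (vecs xs (suc n))                    ≡⟨ ∑-1 (vecs xs (suc n)) ⟨
  ∑ (vecs xs (suc n)) (λ _ → 1)               ≡⟨ ∑-vecs-suc xs n _ ⟩
  ∑ xs (λ _ → ∑ (vecs xs n) (λ _ → 1))        ≡⟨ ∑-const xs _ ⟩
  length xs * ∑ (vecs xs n) (λ _ → 1)         ≡⟨ cong (length xs *_) (trans (∑-1 (vecs xs n)) (length-vecs xs n)) ⟩
  length xs * length xs ^ n                   ∎
  where open ≡-Reasoning

∈-vecs : ∀ {xs : List A} → (∀ x → x ∈ xs) → ∀ {n} (v : Vec A n) → v ∈ vecs xs n
∈-vecs all []      = here refl
∈-vecs all (x ∷ v) = ∈ₚ.∈-cartesianProductWith⁺ _∷_ (all x) (∈-vecs all v)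

vecs-unique : ∀ {xs : List A} → Unique xs → ∀ n → Unique (vecs xs n)
vecs-unique u zero    = [] ∷ []
vecs-unique u (suc n) = Unique.cartesianProductWith⁺ _∷_ Vecₚ.∷-injective u (vecs-unique u n)

subsets : ∀ n → List (Subset n)
subsets = vecs (true ∷ false ∷ [])

∈-subsets : ∀ {n} (p : Subset n) → p ∈ subsets n
∈-subsets = ∈-vecs λ { true → here refl ; false → there (here refl) }

∑-subsets-suc : ∀ n φ → ∑ (subsets (suc n)) φ ≡ ∑ (subsets n) (λ v → φ (true ∷ v)) + ∑ (subsets n) (λ v → φ (false ∷ v))
∑-subsets-suc n φ = trans (∑-vecs-suc _ n φ) (cong (∑ (subsets n) (λ v → φ (true ∷ v)) +_) (ℕₚ.+-identityʳ _))

subsets-unique : ∀ n → Unique (subsets n)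
subsets-unique = vecs-unique (((λ ()) ∷ []) ∷ [] ∷ [])

∑-powerset : ∀ {n} (g : Subset n) → ∑ (subsets n) (λ h → ⟦ h ⊆? g ⟧) ≤ 2 ^ ∣ g ∣
∑-powerset [] = s≤s z≤n
∑-powerset {suc n} (true ∷ g) = begin
  ∑ (subsets (suc n)) (λ h → ⟦ h ⊆? (true ∷ g) ⟧)  ≡⟨ ∑-subsets-suc n _ ⟩
  _                                                ≤⟨ ℕₚ.+-mono-≤ (le true) (le false) ⟩
  2 ^ ∣ g ∣ + 2 ^ ∣ g ∣                            ≡⟨ cong (2 ^ ∣ g ∣ +_) (ℕₚ.+-identityʳ _) ⟨
  2 ^ suc ∣ g ∣                                    ∎
  where
  open ≤-Reasoning
  le : ∀ b → ∑ (subsets n) (λ h → ⟦ (b ∷ h) ⊆? (true ∷ g) ⟧) ≤ 2 ^ ∣ g ∣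
  le b = ℕₚ.≤-trans (∑-mono (subsets n) λ {h} _ → ⟦⟧-mono ((b ∷ h) ⊆? (true ∷ g)) (h ⊆? g) drop-∷-⊆) (∑-powerset g)
∑-powerset {suc n} (false ∷ g) = begin
  ∑ (subsets (suc n)) (λ h → ⟦ h ⊆? (false ∷ g) ⟧)  ≡⟨ ∑-subsets-suc n _ ⟩
  _                                                 ≤⟨ ℕₚ.+-mono-≤ le₁ le₂ ⟩
  0 + 2 ^ ∣ g ∣                                     ∎
  where
  open ≤-Reasoning
  le₁ : ∑ (subsets n) (λ h → ⟦ (true ∷ h) ⊆? (false ∷ g) ⟧) ≤ 0
  le₁ = ℕₚ.≤-trans (∑-mono (subsets n) λ {h} _ →
    ⟦⟧-≤ ((true ∷ h) ⊆? (false ∷ g)) λ s → case s Vec.here of λ ()) (ℕₚ.≤-reflexive (∑-0 (subsets n)))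
  le₂ : ∑ (subsets n) (λ h → ⟦ (false ∷ h) ⊆? (false ∷ g) ⟧) ≤ 2 ^ ∣ g ∣
  le₂ = ℕₚ.≤-trans (∑-mono (subsets n) λ {h} _ → ⟦⟧-mono ((false ∷ h) ⊆? (false ∷ g)) (h ⊆? g) drop-∷-⊆) (∑-powerset g)

∑-δ : ∀ {xs : List A} {a} (≟a : ∀ x → Dec (x ≡ a)) → Unique xs → ∑ xs (λ x → ⟦ ≟a x ⟧) ≤ 1
∑-δ {xs = []} ≟a u = z≤n
∑-δ {xs = x ∷ xs} {a} ≟a (x∉ ∷ u) with ≟a x
... | no _     = ∑-δ ≟a u
... | yes refl = s≤s (ℕₚ.≤-reflexive (trans (∑-cong xs (λ y∈ → ⟦⟧-no (≟a _) (All.lookup x∉ y∈ ∘ sym))) (∑-0 xs)))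

-- The spread lemma

-- A uniformly random colouring plays the part of the random set of the usual spread lemma. Its
-- classes are disjoint, so one colouring serves all rounds, and two families can be given separate
-- colours.
Colouring : ℕ → ℕ → Set
Colouring κ ν = Vec (Fin κ) ν

colourings : ∀ κ ν → List (Colouring κ ν)
colourings κ ν = vecs (allFin κ) ν

class : Fin κ → Colouring κ ν → Subset ν
class j c = Vec.map (λ a → ⌊ a ≟ j ⌋) c

∈-class⁺ : ∀ {j} (c : Colouring κ ν) {i} → lookup c i ≡ j → i ∈ˢ class j c
∈-class⁺ {j = j} c {i} eq with lookup c i ≟ j in d
... | yes _ = lookup⇒[]= i (class j c) (trans (lookup-map i _ c) (cong ⌊_⌋ d))
... | no ne = contradiction eq ne

∈-class⁻ : ∀ {j} (c : Colouring κ ν) {i} → i ∈ˢ class j c → lookup c i ≡ j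
∈-class⁻ {j = j} c {i} i∈ with lookup c i ≟ j in d
... | yes eq = eq
... | no _   = case trans (sym ([]=⇒lookup i∈)) (trans (lookup-map i _ c) (cong ⌊_⌋ d)) of λ ()

recolour : Subset ν → Fin κ → Colouring κ ν → Colouring κ ν
recolour f j c = Vec.zipWith (λ b a → if b then j else a) f c

recolour-∈ : ∀ (f : Subset ν) (j : Fin κ) c {i} → i ∈ˢ f → lookup (recolour f j c) i ≡ j
recolour-∈ f j c {i} i∈ =
  trans (lookup-zipWith _ i f c) (cong (λ b → if b then j else lookup c i) ([]=⇒lookup i∈))

recolour-∉ : ∀ (f : Subset ν) (j : Fin κ) c {i} → i ∉ˢ f → lookup (recolour f j c) i ≡ lookup c i
recolour-∉ f j c {i} i∉ with lookup f i in eq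
... | true  = contradiction (lookup⇒[]= i f eq) i∉
... | false = trans (lookup-zipWith _ i f c) (cong (λ b → if b then j else lookup c i) eq)

_≟ᶜ_ : (c d : Colouring κ ν) → Dec (c ≡ d)
_≟ᶜ_ = Vecₚ.≡-dec _≟_

-- Off `f` the preimage must agree with `c′`, so only its colours on `f` are free.
recolour-fibre : ∀ (f : Subset ν) (j : Fin κ) c′ →
  ∑ (colourings κ ν) (λ c → ⟦ recolour f j c ≟ᶜ c′ ⟧) ≤ κ ^ ∣ f ∣
recolour-fibre [] j [] = ℕₚ.≤-refl
recolour-fibre {ν = suc ν} {κ = κ} (true ∷ f) j (a′ ∷ c′) = begin
  ∑ (colourings κ (suc ν)) (λ c → ⟦ recolour (true ∷ f) j c ≟ᶜ (a′ ∷ c′) ⟧)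
    ≡⟨ ∑-vecs-suc (allFin κ) ν _ ⟩
  ∑ (allFin κ) (λ a → ∑ (colourings κ ν) (λ c → ⟦ (j ∷ recolour f j c) ≟ᶜ (a′ ∷ c′) ⟧))
    ≤⟨ ∑-mono (allFin κ) (λ _ → ∑-mono (colourings κ ν) λ {c} _ →
         ⟦⟧-mono ((j ∷ recolour f j c) ≟ᶜ (a′ ∷ c′)) (recolour f j c ≟ᶜ c′) Vecₚ.∷-injectiveʳ) ⟩
  ∑ (allFin κ) (λ a → ∑ (colourings κ ν) (λ c → ⟦ recolour f j c ≟ᶜ c′ ⟧))
    ≤⟨ ∑-bound (allFin κ) (λ _ → recolour-fibre f j c′) ⟩
  length (allFin κ) * κ ^ ∣ f ∣
    ≡⟨ cong (_* κ ^ ∣ f ∣) (length-allFin κ) ⟩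
  κ * κ ^ ∣ f ∣ ∎
  where open ≤-Reasoning
recolour-fibre {ν = suc ν} {κ = κ} (false ∷ f) j (a′ ∷ c′) = begin
  ∑ (colourings κ (suc ν)) (λ c → ⟦ recolour (false ∷ f) j c ≟ᶜ (a′ ∷ c′) ⟧)
    ≡⟨ ∑-vecs-suc (allFin κ) ν _ ⟩
  ∑ (allFin κ) (λ a → ∑ (colourings κ ν) (λ c → ⟦ (a ∷ recolour f j c) ≟ᶜ (a′ ∷ c′) ⟧))
    ≤⟨ ∑-mono (allFin κ) (λ {a} _ → ∑-mono (colourings κ ν) λ {c} _ →
         ⟦⟧-≤ ((a ∷ recolour f j c) ≟ᶜ (a′ ∷ c′)) λ eq →
           ℕₚ.*-mono-≤ (⟦⟧-1≤ (a ≟ a′) (Vecₚ.∷-injectiveˡ eq)) (⟦⟧-1≤ (recolour f j c ≟ᶜ c′) (Vecₚ.∷-injectiveʳ eq))) ⟩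
  ∑ (allFin κ) (λ a → ∑ (colourings κ ν) (λ c → ⟦ a ≟ a′ ⟧ * ⟦ recolour f j c ≟ᶜ c′ ⟧))
    ≤⟨ ∑-mono (allFin κ) (λ {a} _ → ℕₚ.≤-trans (ℕₚ.≤-reflexive (∑-*ˡ (colourings κ ν) _ ⟦ a ≟ a′ ⟧))
         (ℕₚ.*-monoʳ-≤ ⟦ a ≟ a′ ⟧ (recolour-fibre f j c′))) ⟩
  ∑ (allFin κ) (λ a → ⟦ a ≟ a′ ⟧ * κ ^ ∣ f ∣)
    ≡⟨ ∑-*ʳ (allFin κ) _ _ ⟩
  ∑ (allFin κ) (λ a → ⟦ a ≟ a′ ⟧) * κ ^ ∣ f ∣
    ≤⟨ ℕₚ.*-monoˡ-≤ _ (∑-δ (_≟ a′) (allFin⁺ κ)) ⟩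
  1 * κ ^ ∣ f ∣
    ≡⟨ ℕₚ.*-identityˡ _ ⟩
  κ ^ ∣ f ∣ ∎
  where open ≤-Reasoning

-- Once `W` is exposed, `f` may be replaced by the smaller set `g ─ W`. As this is a subset of `f`,
-- spreadness survives; as it stems from a listed `g`, it can still be traced back to a real member.
Candidate : Subset ν → ℕ → Subset ν → Subset ν → Set
Candidate W s f g = (g ─ W ⊆ˢ f) × ∣ g ─ W ∣ ≤ s

candidate? : ∀ (W : Subset ν) s f → Decidable (Candidate W s f)
candidate? W s f g = (g ─ W ⊆? f) ×-dec (∣ g ─ W ∣ ≤? s)

bad? : ∀ (W : Subset ν) s L f → Dec (¬ Any (Candidate W s f) L)
bad? W s L f = ¬? (Any.any? (candidate? W s f) L)

-- One fragment for each good `f`, repetitions kept. The new list can thus be compared with the old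
-- one entry by entry, and only bad `f` shorten it.
shrink : Subset ν → ℕ → List (Subset ν) → List (Subset ν) → List (Subset ν)
shrink W s L []       = []
shrink W s L (f ∷ fs) with Any.any? (candidate? W s f) L
... | yes p = (proj₁ (find p) ─ W) ∷ shrink W s L fs
... | no _  = shrink W s L fs

shrink-count : ∀ (W : Subset ν) s L fs S →
  ∑ (shrink W s L fs) (λ f → ⟦ S ⊆? f ⟧) ≤ ∑ fs (λ f → ⟦ S ⊆? f ⟧)
shrink-count W s L []       S = z≤n
shrink-count W s L (f ∷ fs) S with Any.any? (candidate? W s f) L
... | no _  = ℕₚ.≤-trans (shrink-count W s L fs S) (ℕₚ.m≤n+m _ _)
... | yes p = ℕₚ.+-mono-≤
  (⟦⟧-mono (S ⊆? _) (S ⊆? f) (λ S⊆ x∈ → proj₁ (proj₂ (proj₂ (find p))) (S⊆ x∈)))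
  (shrink-count W s L fs S)

shrink-∈ : ∀ (W : Subset ν) s L fs {f} → f ∈ shrink W s L fs → ∃[ g ] (g ∈ L × f ≡ g ─ W × ∣ f ∣ ≤ s)
shrink-∈ W s L (f ∷ fs) f∈ with Any.any? (candidate? W s f) L
... | no _ = shrink-∈ W s L fs f∈
shrink-∈ W s L (f ∷ fs) (here refl) | yes p with find p
... | g , g∈ , _ , le = g , g∈ , refl , le
shrink-∈ W s L (f ∷ fs) (there f∈) | yes p = shrink-∈ W s L fs f∈

shrink-length : ∀ (W : Subset ν) s L fs → length fs ≤ length (shrink W s L fs) + ∑ fs (λ f → ⟦ bad? W s L f ⟧)
shrink-length W s L []       = z≤n
shrink-length W s L (f ∷ fs) with Any.any? (candidate? W s f) L
... | yes _ = s≤s (shrink-length W s L fs)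
... | no _  = ℕₚ.≤-trans (s≤s (shrink-length W s L fs)) (ℕₚ.≤-reflexive (sym (ℕₚ.+-suc _ _)))

-- The choice depends on `Z` and the list alone, so the encoding can repeat it knowing only the
-- recoloured colouring. The default `∅ˢ` obeys any size bound.
pick : Subset ν → List (Subset ν) → Subset ν
pick Z []      = ∅ˢ
pick Z (g ∷ L) with g ⊆? Z
... | yes _ = g
... | no _  = pick Z L

pick-spec : ∀ (Z : Subset ν) {L f} → f ∈ L → f ⊆ˢ Z → pick Z L ∈ L × pick Z L ⊆ˢ Z
pick-spec Z {g ∷ L} f∈ f⊆ with g ⊆? Z
... | yes g⊆ = here refl , g⊆
pick-spec Z {g ∷ L} (here refl) f⊆ | no g⊈ = ⊥-elim (g⊈ f⊆)
pick-spec Z {g ∷ L} (there f∈) f⊆  | no g⊈ with pick-spec Z f∈ f⊆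
... | p∈ , p⊆ = there p∈ , p⊆

pick-size : ∀ (Z : Subset ν) {L s} → (∀ {f} → f ∈ L → ∣ f ∣ ≤ s) → ∣ pick Z L ∣ ≤ s
pick-size {ν} Z {[]}    b = ℕₚ.≤-trans (ℕₚ.≤-reflexive (Subsetₚ.∣⊥∣≡0 ν)) z≤n
pick-size Z {g ∷ L} b with g ⊆? Z
... | yes _ = b (here refl)
... | no _  = pick-size Z (b ∘ there)

x∈p─q⇒x∉q : ∀ (p q : Subset ν) {x} → x ∈ˢ p ─ q → x ∉ˢ q
x∈p─q⇒x∉q (_ ∷ p) (true ∷ q)  (Vec.there x∈) (Vec.there x∈q) = x∈p─q⇒x∉q p q x∈ x∈q
x∈p─q⇒x∉q (_ ∷ p) (false ∷ q) (Vec.there x∈) (Vec.there x∈q) = x∈p─q⇒x∉q p q x∈ x∈q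

-- The encoding argument of Alweiss, Lovett, Wu and Zhang: a bad pair (c , f) is recovered from
-- c′ = recolour f j c, from the large set h = g ─ class j c ⊆ f, where g depends on c′ only, from f ⊇ h,
-- and from the colours that c takes on f.
module Round {N v : ℕ} (j : Fin N) (s s′ M r : ℕ) (1≤r : 1 ≤ r) (𝓛 : Colouring N v → List (Subset v))
  (invariant : ∀ c {f} → f ∈ 𝓛 c → 𝓛 (recolour f j c) ≡ 𝓛 c)
  (size : ∀ c {f} → f ∈ 𝓛 c → ∣ f ∣ ≤ s)
  (spread : ∀ c S → ∑ (𝓛 c) (λ f → ⟦ S ⊆? f ⟧) * r ^ ∣ S ∣ ≤ M)
  where

  private
    cs : List (Colouring N v)
    cs = colourings N v

    g* : Colouring N v → Subset v
    g* c = pick (class j c) (𝓛 c)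

    -- The number of codes `h` available to `f` when the recoloured colouring is `c`.
    H : Colouring N v → Subset v → ℕ
    H c f = ∑ (subsets v) (λ h → ⟦ h ⊆? g* c ⟧ * (⟦ s′ <? ∣ h ∣ ⟧ * ⟦ h ⊆? f ⟧))

    bad : Colouring N v → Subset v → ℕ
    bad c f = ⟦ bad? (class j c) s′ (𝓛 c) f ⟧

    _≟ᴸ_ : (L L′ : List (Subset v)) → Dec (L ≡ L′)
    _≟ᴸ_ = Listₚ.≡-dec (Vecₚ.≡-dec Data.Bool._≟_)

    -- After recolouring, `f` itself lies in class `j`, so `pick` succeeds and returns some `g`.
    -- Points outside `f` kept their colour, hence `g ─ class j c` lies in `f`; were it of size at
    -- most `s′`, it would make `f` good.
    bad-encoded : ∀ c {f} → f ∈ 𝓛 c → bad c f ≤ H (recolour f j c) f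
    bad-encoded c {f} f∈ = ⟦⟧-≤ (bad? (class j c) s′ (𝓛 c) f) λ isBad →
      let h⊈s : ¬ (∣ h ∣ ≤ s′)
          h⊈s le = isBad (lose g∈ (h⊆f , le))
      in ℕₚ.≤-trans
        (ℕₚ.*-mono-≤ (⟦⟧-1≤ (h ⊆? g) (p─q⊆p g _))
          (ℕₚ.*-mono-≤ (⟦⟧-1≤ (s′ <? ∣ h ∣) (ℕₚ.≰⇒> h⊈s)) (⟦⟧-1≤ (h ⊆? f) h⊆f)))
        (∑-term (λ h → ⟦ h ⊆? g ⟧ * (⟦ s′ <? ∣ h ∣ ⟧ * ⟦ h ⊆? f ⟧)) (∈-subsets h))
      where
      c′ : Colouring N v
      c′ = recolour f j c
      g h : Subset v
      g = g* c′
      h = g ─ class j c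
      spec : g ∈ 𝓛 c′ × g ⊆ˢ class j c′
      spec = pick-spec (class j c′) (subst (f ∈_) (sym (invariant c f∈)) f∈)
        (λ i∈ → ∈-class⁺ c′ (recolour-∈ f j c i∈))
      g∈ : g ∈ 𝓛 c
      g∈ = subst (g ∈_) (invariant c f∈) (proj₁ spec)
      h⊆f : h ⊆ˢ f
      h⊆f {i} i∈ with i ∈? f
      ... | yes i∈f = i∈f
      ... | no  i∉f = contradiction
        (∈-class⁺ c (trans (sym (recolour-∉ f j c i∉f)) (∈-class⁻ c′ (proj₂ spec (p─q⊆p g _ i∈)))))
        (x∈p─q⇒x∉q g _ i∈)

    -- Summing over `h` first: `g* c` has at most `2 ^ s` subsets, and by spreadness each one with
    -- more than `s′` elements lies in at most a fraction `1 / r ^ suc s′` of `M` fragments.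
    H-sum : ∀ c → ∑ (𝓛 c) (H c) * r ^ suc s′ ≤ 2 ^ s * M
    H-sum c = begin
      ∑ (𝓛 c) (H c) * ρ
        ≡⟨ cong (_* ρ) (∑-swap (𝓛 c) (subsets v) _) ⟩
      ∑ (subsets v) (λ h → ∑ (𝓛 c) (λ f → ⟦ h ⊆? g* c ⟧ * (⟦ s′ <? ∣ h ∣ ⟧ * ⟦ h ⊆? f ⟧))) * ρ
        ≡⟨ ∑-*ʳ (subsets v) _ ρ ⟨
      ∑ (subsets v) (λ h → ∑ (𝓛 c) (λ f → ⟦ h ⊆? g* c ⟧ * (⟦ s′ <? ∣ h ∣ ⟧ * ⟦ h ⊆? f ⟧)) * ρ)
        ≤⟨ ∑-mono (subsets v) (λ {h} _ → term h) ⟩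
      ∑ (subsets v) (λ h → ⟦ h ⊆? g* c ⟧ * M)
        ≡⟨ ∑-*ʳ (subsets v) _ M ⟩
      ∑ (subsets v) (λ h → ⟦ h ⊆? g* c ⟧) * M
        ≤⟨ ℕₚ.*-monoˡ-≤ M (∑-powerset (g* c)) ⟩
      2 ^ ∣ g* c ∣ * M
        ≤⟨ ℕₚ.*-monoˡ-≤ M (ℕₚ.^-monoʳ-≤ 2 (pick-size (class j c) (size c))) ⟩
      2 ^ s * M ∎
      where
      open ≤-Reasoning
      ρ : ℕ
      ρ = r ^ suc s′
      term : ∀ h → ∑ (𝓛 c) (λ f → ⟦ h ⊆? g* c ⟧ * (⟦ s′ <? ∣ h ∣ ⟧ * ⟦ h ⊆? f ⟧)) * ρ ≤ ⟦ h ⊆? g* c ⟧ * M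
      term h = begin
        ∑ (𝓛 c) (λ f → a * (b * ⟦ h ⊆? f ⟧)) * ρ
          ≡⟨ cong (_* ρ) (∑-*ˡ (𝓛 c) _ a) ⟩
        a * ∑ (𝓛 c) (λ f → b * ⟦ h ⊆? f ⟧) * ρ
          ≡⟨ cong (λ z → a * z * ρ) (∑-*ˡ (𝓛 c) _ b) ⟩
        a * (b * n) * ρ
          ≡⟨ assoc a b n ρ ⟩
        a * (b * (n * ρ))
          ≤⟨ ℕₚ.*-monoʳ-≤ a (⟦⟧-*-≤ (s′ <? ∣ h ∣) λ lt → ℕₚ.≤-trans
               (ℕₚ.*-monoʳ-≤ n (ℕₚ.^-monoʳ-≤ r {{>-nonZero 1≤r}} lt)) (spread c h)) ⟩
        a * M ∎
        where
        a b n : ℕ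
        a = ⟦ h ⊆? g* c ⟧
        b = ⟦ s′ <? ∣ h ∣ ⟧
        n = ∑ (𝓛 c) (λ f → ⟦ h ⊆? f ⟧)
        assoc : ∀ a b n ρ → a * (b * n) * ρ ≡ a * (b * (n * ρ))
        assoc = solve-∀

    -- A nonzero term on the left means that `c′` is a recolouring of `c` along a fragment, and then
    -- `invariant` identifies the two lists. So either the lists agree or the left side is 0. This
    -- permits summing over `c′` first.
    transfer : ∀ c c′ →
      ∑ (𝓛 c) (λ f → ⟦ recolour f j c ≟ᶜ c′ ⟧ * H c′ f) ≤ ∑ (𝓛 c′) (λ f → ⟦ recolour f j c ≟ᶜ c′ ⟧ * H c′ f)
    transfer c c′ with 𝓛 c ≟ᴸ 𝓛 c′
    ... | yes eq = ℕₚ.≤-reflexive (cong (λ L → ∑ L (λ f → ⟦ recolour f j c ≟ᶜ c′ ⟧ * H c′ f)) eq)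
    ... | no neq = ℕₚ.≤-trans (∑-mono (𝓛 c) {ψ = λ _ → 0} λ {f} f∈ → ⟦⟧-*-≤ (recolour f j c ≟ᶜ c′)
      λ { refl → contradiction (sym (invariant c f∈)) neq }) (ℕₚ.≤-trans (ℕₚ.≤-reflexive (∑-0 (𝓛 c))) z≤n)

    1≤N : 1 ≤ N
    1≤N = ℕₚ.≤-trans (s≤s z≤n) (Finₚ.toℕ<n j)

  -- Each bad pair `(c , f)` is charged to `(recolour f j c , f)`. At most `N ^ s` pairs share a
  -- target, and `H-sum` bounds the codes.
  bad-sum : ∑ cs (λ c → ∑ (𝓛 c) (bad c)) * r ^ suc s′ ≤ N ^ v * (N ^ s * (2 ^ s * M))
  bad-sum = begin
    ∑ cs (λ c → ∑ (𝓛 c) (bad c)) * ρ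
      ≤⟨ ℕₚ.*-monoˡ-≤ ρ (∑-mono cs λ {c} _ → ∑-mono (𝓛 c) λ {f} f∈ → ℕₚ.≤-trans (bad-encoded c f∈)
           (ℕₚ.≤-trans (ℕₚ.≤-reflexive (sym (trans (cong (_* H (recolour f j c) f)
             (⟦⟧-yes (recolour f j c ≟ᶜ recolour f j c) refl)) (ℕₚ.*-identityˡ _))))
             (∑-term (λ c′ → ⟦ recolour f j c ≟ᶜ c′ ⟧ * H c′ f) (∈-vecs ∈-allFin (recolour f j c))))) ⟩
    ∑ cs (λ c → ∑ (𝓛 c) (λ f → ∑ cs (λ c′ → δ c c′ f))) * ρ
      ≡⟨ cong (_* ρ) (∑-cong cs λ {c} _ → ∑-swap (𝓛 c) cs _) ⟩
    ∑ cs (λ c → ∑ cs (λ c′ → ∑ (𝓛 c) (λ f → δ c c′ f))) * ρ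
      ≤⟨ ℕₚ.*-monoˡ-≤ ρ (∑-mono cs λ {c} _ → ∑-mono cs λ {c′} _ → transfer c c′) ⟩
    ∑ cs (λ c → ∑ cs (λ c′ → ∑ (𝓛 c′) (λ f → δ c c′ f))) * ρ
      ≡⟨ cong (_* ρ) (trans (∑-swap cs cs _) (∑-cong cs λ {c′} _ → ∑-swap cs (𝓛 c′) _)) ⟩
    ∑ cs (λ c′ → ∑ (𝓛 c′) (λ f → ∑ cs (λ c → δ c c′ f))) * ρ
      ≤⟨ ℕₚ.*-monoˡ-≤ ρ (∑-mono cs λ {c′} _ → ∑-mono (𝓛 c′) λ {f} f∈ → fibre c′ f∈) ⟩
    ∑ cs (λ c′ → ∑ (𝓛 c′) (λ f → N ^ s * H c′ f)) * ρ
      ≡⟨ ∑-*ʳ cs _ ρ ⟨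
    ∑ cs (λ c′ → ∑ (𝓛 c′) (λ f → N ^ s * H c′ f) * ρ)
      ≤⟨ ∑-bound cs (λ {c′} _ → ℕₚ.≤-trans (ℕₚ.≤-reflexive (trans (cong (_* ρ) (∑-*ˡ (𝓛 c′) _ (N ^ s)))
           (ℕₚ.*-assoc (N ^ s) _ ρ))) (ℕₚ.*-monoʳ-≤ (N ^ s) (H-sum c′))) ⟩
    length cs * (N ^ s * (2 ^ s * M))
      ≡⟨ cong (_* (N ^ s * (2 ^ s * M))) (trans (length-vecs (allFin N) v) (cong (_^ v) (length-allFin N))) ⟩
    N ^ v * (N ^ s * (2 ^ s * M)) ∎
    where
    open ≤-Reasoning
    ρ : ℕ
    ρ = r ^ suc s′
    δ : Colouring N v → Colouring N v → Subset v → ℕ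
    δ c c′ f = ⟦ recolour f j c ≟ᶜ c′ ⟧ * H c′ f
    fibre : ∀ c′ {f} → f ∈ 𝓛 c′ → ∑ cs (λ c → δ c c′ f) ≤ N ^ s * H c′ f
    fibre c′ {f} f∈ = ℕₚ.≤-trans (ℕₚ.≤-reflexive (∑-*ʳ cs _ (H c′ f)))
      (ℕₚ.*-monoˡ-≤ (H c′ f) (ℕₚ.≤-trans (recolour-fibre f j c′)
        (ℕₚ.^-monoʳ-≤ N {{>-nonZero 1≤N}} (size c′ f∈))))

^-distribʳ-* : ∀ a b s → (a * b) ^ s ≡ a ^ s * b ^ s
^-distribʳ-* a b zero    = refl
^-distribʳ-* a b (suc s) = trans (cong (a * b *_) (^-distribʳ-* a b s)) (ℕₚ.[m*n]*[o*p]≡[m*o]*[n*p] a b (a ^ s) (b ^ s))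

module Fragments {N v : ℕ} (G : List (Subset v)) (m r : ℕ)
  (N²≤r : (2 * N) * (2 * N) ≤ r)
  (size : ∀ {f} → f ∈ G → ∣ f ∣ ≤ m)
  (spread : ∀ S → ∑ G (λ f → ⟦ S ⊆? f ⟧) * r ^ ∣ S ∣ ≤ length G)
  where

  -- Starting from `m`, every round halves the permitted size, so `R` rounds with `m < 2 ^ R` leave
  -- only empty fragments.
  bound : List (Fin N) → ℕ
  bound []       = m
  bound (j ∷ js) = ⌊ bound js /2⌋

  -- Colours are processed from the right end of the list.
  frags : List (Fin N) → Colouring N v → List (Subset v)
  frags []       c = G
  frags (j ∷ js) c = shrink (class j c) (bound (j ∷ js)) (frags js c) (frags js c)

  frags-cong : ∀ js {c c′} → (∀ {j} → j ∈ js → class j c ≡ class j c′) → frags js c ≡ frags js c′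
  frags-cong []       eq = refl
  frags-cong (j ∷ js) eq =
    cong₂ (λ W L → shrink W _ L L) (eq (here refl)) (frags-cong js (eq ∘ there))

  frags-fresh : ∀ js c {f i} → f ∈ frags js c → i ∈ˢ f → lookup c i ∉ js
  frags-fresh (j ∷ js) c f∈ i∈ c∈ with shrink-∈ _ _ (frags js c) (frags js c) f∈
  frags-fresh (j ∷ js) c f∈ i∈ (here eq)  | g , g∈ , refl , _ = x∈p─q⇒x∉q g _ i∈ (∈-class⁺ c eq)
  frags-fresh (j ∷ js) c f∈ i∈ (there c∈) | g , g∈ , refl , _ = frags-fresh js c g∈ (p─q⊆p g _ i∈) c∈

  -- This gives empty fragments their meaning: the member of `G` behind an empty fragment is
  -- contained in the union of the processed classes.
  frags-cover : ∀ js c {f} → f ∈ frags js c →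
    ∃[ B ] (B ∈ G × (∀ {i} → i ∈ˢ B → i ∈ˢ f ⊎ lookup c i ∈ js))
  frags-cover []       c {f} f∈ = f , f∈ , inj₁
  frags-cover (j ∷ js) c f∈ with shrink-∈ _ _ (frags js c) (frags js c) f∈
  ... | g , g∈ , refl , _ with frags-cover js c g∈
  ... | B , B∈ , cover = B , B∈ , λ {i} i∈ → aux (cover i∈)
    where
    aux : ∀ {i} → i ∈ˢ g ⊎ lookup c i ∈ js → i ∈ˢ g ─ class j c ⊎ lookup c i ∈ j ∷ js
    aux (inj₂ c∈) = inj₂ (there c∈)
    aux {i} (inj₁ i∈g) with i ∈? class j c
    ... | yes i∈ = inj₂ (here (∈-class⁻ c i∈))
    ... | no  i∉ = inj₁ (x∈p∧x∉q⇒x∈p─q i∈g i∉)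

  frags-size : ∀ js c {f} → f ∈ frags js c → ∣ f ∣ ≤ bound js
  frags-size []       c f∈ = size f∈
  frags-size (j ∷ js) c f∈ = proj₂ (proj₂ (proj₂ (shrink-∈ _ _ (frags js c) (frags js c) f∈)))

  -- The comparison is with the original `G`, so each round may use the spread hypothesis with the
  -- fixed right side `length G` even though earlier rounds have lost fragments.
  frags-count : ∀ js c S → ∑ (frags js c) (λ f → ⟦ S ⊆? f ⟧) ≤ ∑ G (λ f → ⟦ S ⊆? f ⟧)
  frags-count []       c S = ℕₚ.≤-refl
  frags-count (j ∷ js) c S = ℕₚ.≤-trans (shrink-count _ _ (frags js c) (frags js c) S) (frags-count js c S)

  frags-length : ∀ js c → length (frags js c) ≤ length G
  frags-length js c = begin
    length (frags js c)                       ≡⟨ count∅ (frags js c) ⟨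
    ∑ (frags js c) (λ f → ⟦ ∅ˢ ⊆? f ⟧)        ≤⟨ frags-count js c ∅ˢ ⟩
    ∑ G (λ f → ⟦ ∅ˢ ⊆? f ⟧)                   ≡⟨ count∅ G ⟩
    length G                                  ∎
    where
    open ≤-Reasoning
    count∅ : ∀ L → ∑ L (λ f → ⟦ ∅ˢ ⊆? f ⟧) ≡ length L
    count∅ L = trans (∑-cong L λ {f} _ → ⟦⟧-yes (∅ˢ ⊆? f) Subsetₚ.⊥⊆) (∑-1 L)

  -- By `frags-fresh` a fragment has no point of a processed colour. Giving it the new colour `j`
  -- therefore changes none of the classes on which `frags js` depends.
  frags-recolour : ∀ {j js} → j ∉ js → ∀ c {f} → f ∈ frags js c → frags js (recolour f j c) ≡ frags js c
  frags-recolour {j} {js} j∉ c {f} f∈ = frags-cong js λ {j′} j′∈ →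
    Subsetₚ.⊆-antisym (to j′∈) (from j′∈)
    where
    to : ∀ {j′} → j′ ∈ js → class j′ (recolour f j c) ⊆ˢ class j′ c
    to j′∈ {i} i∈ with i ∈? f
    ... | yes i∈f = contradiction
      (subst (_∈ js) (trans (sym (∈-class⁻ (recolour f j c) i∈)) (recolour-∈ f j c i∈f)) j′∈) j∉
    ... | no  i∉f = ∈-class⁺ c (trans (sym (recolour-∉ f j c i∉f)) (∈-class⁻ (recolour f j c) i∈))
    from : ∀ {j′} → j′ ∈ js → class j′ c ⊆ˢ class j′ (recolour f j c)
    from j′∈ {i} i∈ with i ∈? f
    ... | yes i∈f = contradiction (subst (_∈ js) (sym (∈-class⁻ c i∈)) j′∈) (frags-fresh js c f∈ i∈f)
    ... | no  i∉f = ∈-class⁺ (recolour f j c) (trans (recolour-∉ f j c i∉f) (∈-class⁻ c i∈))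

  private
    cs : List (Colouring N v)
    cs = colourings N v

    s<2⌊s/2⌋+2 : ∀ s → suc s ≤ 2 * suc ⌊ s /2⌋
    s<2⌊s/2⌋+2 zero          = s≤s z≤n
    s<2⌊s/2⌋+2 (suc zero)    = ℕₚ.≤-refl
    s<2⌊s/2⌋+2 (suc (suc s)) = begin
      2 + suc s              ≤⟨ ℕₚ.+-monoʳ-≤ 2 (s<2⌊s/2⌋+2 s) ⟩
      2 + 2 * suc ⌊ s /2⌋    ≡⟨ ℕₚ.*-suc 2 (suc ⌊ s /2⌋) ⟨
      2 * suc (suc ⌊ s /2⌋)  ∎
      where open ≤-Reasoning


  -- Halving is what the exponents allow: `suc s ≤ 2 * suc s′`, so `r ^ suc s′` is at least
  -- `(2 * N) ^ suc s`. This absorbs the encoding cost `(2 * N) ^ s` and leaves a factor `2 * N`.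
  bad-sum-bound : ∀ {j js} → j ∉ js →
    ∑ cs (λ c → ∑ (frags js c) (λ f → ⟦ bad? (class j c) (bound (j ∷ js)) (frags js c) f ⟧)) * (2 * N)
      ≤ N ^ v * length G
  bad-sum-bound {j} {js} j∉ = ℕₚ.*-cancelʳ-≤ _ _ (n₂ ^ s) {{>-nonZero 1≤n₂^s}} (begin
    b * n₂ * n₂ ^ s                          ≡⟨ ℕₚ.*-assoc b n₂ (n₂ ^ s) ⟩
    b * n₂ ^ suc s                           ≤⟨ ℕₚ.*-monoʳ-≤ b (ℕₚ.^-monoʳ-≤ n₂ {{>-nonZero 1≤n₂}} (s<2⌊s/2⌋+2 s)) ⟩
    b * n₂ ^ (2 * suc s′)                    ≡⟨ cong (b *_) (ℕₚ.^-*-assoc n₂ 2 (suc s′)) ⟨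
    b * (n₂ ^ 2) ^ suc s′                    ≤⟨ ℕₚ.*-monoʳ-≤ b (ℕₚ.^-monoˡ-≤ (suc s′) n₂²≤r) ⟩
    b * r ^ suc s′                           ≤⟨ R.bad-sum ⟩
    N ^ v * (N ^ s * (2 ^ s * length G))     ≡⟨ cong (N ^ v *_) (ℕₚ.*-assoc (N ^ s) (2 ^ s) (length G)) ⟨
    N ^ v * (N ^ s * 2 ^ s * length G)       ≡⟨ cong (λ z → N ^ v * (z * length G)) (trans (ℕₚ.*-comm (N ^ s) (2 ^ s)) (sym (^-distribʳ-* 2 N s))) ⟩
    N ^ v * (n₂ ^ s * length G)              ≡⟨ lemma (N ^ v) (n₂ ^ s) (length G) ⟩
    N ^ v * length G * n₂ ^ s                ∎)
    where
    open ≤-Reasoning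
    n₂ s s′ b : ℕ
    n₂ = 2 * N
    s  = bound js
    s′ = ⌊ s /2⌋
    b  = ∑ cs (λ c → ∑ (frags js c) (λ f → ⟦ bad? (class j c) s′ (frags js c) f ⟧))
    1≤n₂ : 1 ≤ n₂
    1≤n₂ = ℕₚ.≤-trans (ℕₚ.≤-trans (s≤s z≤n) (Finₚ.toℕ<n j)) (ℕₚ.m≤m+n N _)
    1≤n₂^s : 1 ≤ n₂ ^ s
    1≤n₂^s = ℕₚ.m^n>0 n₂ {{>-nonZero 1≤n₂}} s
    n₂²≤r : n₂ ^ 2 ≤ r
    n₂²≤r = subst (_≤ r) (cong (n₂ *_) (sym (ℕₚ.*-identityʳ n₂))) N²≤r
    1≤r : 1 ≤ r
    1≤r = ℕₚ.≤-trans (ℕₚ.*-mono-≤ 1≤n₂ 1≤n₂) N²≤r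
    module R = Round j s s′ (length G) r 1≤r (frags js) (frags-recolour j∉) (frags-size js)
      (λ c S → ℕₚ.≤-trans (ℕₚ.*-monoˡ-≤ _ (frags-count js c S)) (spread S))
    lemma : ∀ a b c → a * (b * c) ≡ a * c * b
    lemma = solve-∀

  -- Every round loses at most a fraction 1/(2N) of the `N ^ v * length G` pairs of a colouring and
  -- a member.
  frags-sum : ∀ js → Unique js →
    N ^ v * length G * (2 * N) ≤ ∑ cs (λ c → length (frags js c)) * (2 * N) + length js * (N ^ v * length G)
  frags-sum [] _ = ℕₚ.≤-trans (ℕₚ.*-monoˡ-≤ (2 * N) (ℕₚ.≤-reflexive (sym (trans (∑-const cs (length G))
    (cong (_* length G) (trans (length-vecs (allFin N) v) (cong (_^ v) (length-allFin N)))))))) (ℕₚ.m≤m+n _ _)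
  frags-sum (j ∷ js) (j∉ ∷ u) = begin
    K * (2 * N)
      ≤⟨ frags-sum js u ⟩
    ∑ cs (λ c → length (frags js c)) * (2 * N) + length js * K
      ≤⟨ ℕₚ.+-monoˡ-≤ _ (ℕₚ.*-monoˡ-≤ (2 * N) (∑-mono cs λ {c} _ →
           shrink-length (class j c) (bound (j ∷ js)) (frags js c) (frags js c))) ⟩
    ∑ cs (λ c → length (frags (j ∷ js) c) + b c) * (2 * N) + length js * K
      ≡⟨ cong (λ z → z * (2 * N) + length js * K) (∑-+ cs _ b) ⟩
    (a + ∑ cs b) * (2 * N) + length js * K
      ≡⟨ cong (_+ length js * K) (ℕₚ.*-distribʳ-+ (2 * N) a (∑ cs b)) ⟩
    a * (2 * N) + ∑ cs b * (2 * N) + length js * K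
      ≤⟨ ℕₚ.+-monoˡ-≤ _ (ℕₚ.+-monoʳ-≤ (a * (2 * N)) (bad-sum-bound λ j∈ → All.lookup j∉ j∈ refl)) ⟩
    a * (2 * N) + K + length js * K
      ≡⟨ ℕₚ.+-assoc (a * (2 * N)) K _ ⟩
    a * (2 * N) + (K + length js * K) ∎
    where
    open ≤-Reasoning
    K a : ℕ
    K = N ^ v * length G
    a = ∑ cs (λ c → length (frags (j ∷ js) c))
    b : Colouring N v → ℕ
    b c = ∑ (frags js c) (λ f → ⟦ bad? (class j c) (bound (j ∷ js)) (frags js c) f ⟧)

  covered? : ∀ js c → Dec (1 ≤ length (frags js c))
  covered? js c = 1 ≤? length (frags js c)

  -- With N = 2R colours and R rounds the total loss is at most R/(4R), a quarter. A colouring holds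
  -- at most `length G` fragments, so three quarters of the colourings keep at least one.
  covered-count : ∀ js → Unique js → N ≡ length js + length js → 1 ≤ length js → 1 ≤ length G →
    3 * N ^ v ≤ 4 * ∑ cs (λ c → ⟦ covered? js c ⟧)
  covered-count js u eq 1≤R 1≤G = ℕₚ.+-cancelʳ-≤ (N ^ v) _ _ (ℕₚ.*-cancelʳ-≤ _ _ (R * M)
    {{>-nonZero (ℕₚ.*-mono-≤ 1≤R 1≤G)}} (begin
    (3 * N ^ v + N ^ v) * (R * M)    ≡⟨ l₁ (N ^ v) R M ⟩
    N ^ v * M * (2 * (R + R))        ≡⟨ cong (λ z → N ^ v * M * (2 * z)) eq ⟨
    N ^ v * M * (2 * N)              ≤⟨ frags-sum js u ⟩
    ∑ cs (λ c → length (frags js c)) * (2 * N) + R * (N ^ v * M)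
      ≤⟨ ℕₚ.+-monoˡ-≤ _ (ℕₚ.*-monoˡ-≤ (2 * N) (∑-mono cs λ {c} _ → le c)) ⟩
    ∑ cs (λ c → ⟦ covered? js c ⟧ * M) * (2 * N) + R * (N ^ v * M)
      ≡⟨ cong₂ (λ y z → y * (2 * z) + R * (N ^ v * M)) (∑-*ʳ cs _ M) eq ⟩
    e * M * (2 * (R + R)) + R * (N ^ v * M)
      ≡⟨ l₂ e M R (N ^ v) ⟩
    (4 * e + N ^ v) * (R * M)        ∎))
    where
    open ≤-Reasoning
    R M e : ℕ
    R = length js
    M = length G
    e = ∑ cs (λ c → ⟦ covered? js c ⟧)
    l₁ : ∀ x R M → (3 * x + x) * (R * M) ≡ x * M * (2 * (R + R))
    l₁ = solve-∀
    l₂ : ∀ e M R x → e * M * (2 * (R + R)) + R * (x * M) ≡ (4 * e + x) * (R * M)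
    l₂ = solve-∀
    le : ∀ c → length (frags js c) ≤ ⟦ covered? js c ⟧ * M
    le c with length (frags js c) in eq′
    ... | zero  = z≤n
    ... | suc l = subst (_≤ 1 * M) eq′ (ℕₚ.≤-trans (frags-length js c) (ℕₚ.≤-reflexive (sym (ℕₚ.*-identityˡ M))))

  bound-small : ∀ js → m < 2 ^ length js → bound js ≡ 0
  bound-small js lt = ℕₚ.n<1⇒n≡0 (ℕₚ.*-cancelʳ-< (2 ^ length js) _ _
    (ℕₚ.≤-<-trans (le js) (ℕₚ.<-≤-trans lt (ℕₚ.≤-reflexive (sym (ℕₚ.*-identityˡ _))))))
    where
    double : ∀ s → ⌊ s /2⌋ * 2 ≤ s
    double zero          = z≤n
    double (suc zero)    = z≤n
    double (suc (suc s)) = s≤s (s≤s (double s))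
    le : ∀ js → bound js * 2 ^ length js ≤ m
    le []       = ℕₚ.≤-reflexive (ℕₚ.*-identityʳ m)
    le (j ∷ js) = ℕₚ.≤-trans (ℕₚ.≤-reflexive (sym (ℕₚ.*-assoc ⌊ bound js /2⌋ 2 (2 ^ length js))))
      (ℕₚ.≤-trans (ℕₚ.*-monoˡ-≤ (2 ^ length js) (double (bound js))) (le js))

  covered⇒member : ∀ js c → m < 2 ^ length js → 1 ≤ length (frags js c) →
    ∃[ B ] (B ∈ G × (∀ {i} → i ∈ˢ B → lookup c i ∈ js))
  covered⇒member js c lt 1≤ with frags js c in eq
  ... | f ∷ L with frags-cover js c (subst (f ∈_) (sym eq) (here refl))
  ... | B , B∈ , cover = B , B∈ , λ {i} i∈ → aux (cover i∈)
    where
    ∣f∣≤0 : ∣ f ∣ ≤ 0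
    ∣f∣≤0 = subst (∣ f ∣ ≤_) (bound-small js lt) (frags-size js c (subst (f ∈_) (sym eq) (here refl)))
    aux : ∀ {i} → i ∈ˢ f ⊎ lookup c i ∈ js → lookup c i ∈ js
    aux (inj₂ c∈) = c∈
    aux {i} (inj₁ i∈) = case ℕₚ.≤-trans (ℕₚ.≤-trans (ℕₚ.≤-reflexive (sym (Subsetₚ.∣⁅x⁆∣≡1 i)))
      (Subsetₚ.p⊆q⇒∣p∣≤∣q∣ {p = ⁅ i ⁆} λ x∈ → subst (_∈ˢ f) (sym (Subsetₚ.x∈⁅y⁆⇒x≡y i x∈)) i∈)) ∣f∣≤0 of λ ()

⟦⟧-both : {P Q : Set} (d : Dec P) (e : Dec Q) → 1 < ⟦ d ⟧ + ⟦ e ⟧ → P × Q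
⟦⟧-both (yes p) (yes q) _ = p , q
⟦⟧-both (yes _) (no _) (s≤s ())
⟦⟧-both (no _) (yes _) (s≤s ())

IsSpread : ∀ {v} → ℕ → List (Subset v) → Set
IsSpread r G = ∀ S → ∑ G (λ f → ⟦ S ⊆? f ⟧) * r ^ ∣ S ∣ ≤ length G

-- Of 2R colours, `left` serves `G₁` and `right` serves `G₂`. Each half succeeds for three quarters
-- of the colourings, so some colouring is good for both, and the two members found lie in disjoint
-- unions of classes. The `4 * R` is `2 * N` for N = 2R.
spread⇒disjoint : ∀ {v} (m R r : ℕ) → 1 ≤ R → m < 2 ^ R → (4 * R) * (4 * R) ≤ r →
  ∀ (G₁ G₂ : List (Subset v)) →
  (∀ {f} → f ∈ G₁ → ∣ f ∣ ≤ m) → (∀ {f} → f ∈ G₂ → ∣ f ∣ ≤ m) →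
  IsSpread r G₁ → IsSpread r G₂ → 1 ≤ length G₁ → 1 ≤ length G₂ →
  ∃[ A ] ∃[ B ] (A ∈ G₁ × B ∈ G₂ × (∀ {i} → i ∈ˢ A → i ∉ˢ B))
spread⇒disjoint {v} m R r 1≤R m<2^R R²≤r G₁ G₂ size₁ size₂ spread₁ spread₂ 1≤G₁ 1≤G₂ = result
  where
  open ≤-Reasoning
  K : ℕ
  K = R + R
  N²≤r : (2 * K) * (2 * K) ≤ r
  N²≤r = subst (λ z → z * z ≤ r) (lemma R) R²≤r
    where
    lemma : ∀ R → 4 * R ≡ 2 * (R + R)
    lemma = solve-∀
  left right : List (Fin K)
  left  = map (_↑ˡ R) (allFin R)
  right = map (R ↑ʳ_) (allFin R)
  module F₁ = Fragments {K} G₁ m r N²≤r size₁ spread₁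
  module F₂ = Fragments {K} G₂ m r N²≤r size₂ spread₂
  length-left : length left ≡ R
  length-left = trans (length-map _ (allFin R)) (length-allFin R)
  length-right : length right ≡ R
  length-right = trans (length-map _ (allFin R)) (length-allFin R)
  disjoint : ∀ {x} → x ∈ left → x ∉ right
  disjoint x∈ x∈′ with ∈-map⁻ _ x∈ | ∈-map⁻ _ x∈′
  ... | i , _ , refl | j , _ , eq =
    case trans (sym (Finₚ.splitAt-↑ˡ R i R)) (trans (cong (Fin.splitAt R) eq) (Finₚ.splitAt-↑ʳ R R j)) of λ ()
  cs : List (Colouring K v)
  cs = colourings K v
  e : Colouring K v → ℕ
  e c = ⟦ F₁.covered? left c ⟧ + ⟦ F₂.covered? right c ⟧
  1≤K^v : 1 ≤ K ^ v
  1≤K^v = ℕₚ.m^n>0 K {{>-nonZero (ℕₚ.≤-trans 1≤R (ℕₚ.m≤m+n R R))}} v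
  total : length cs * 1 < ∑ cs e
  total = ℕₚ.*-cancelˡ-< 4 _ _ (begin-strict
    4 * (length cs * 1)  ≡⟨ cong (4 *_) (trans (ℕₚ.*-identityʳ _) (trans (length-vecs (allFin K) v) (cong (_^ v) (length-allFin K)))) ⟩
    4 * K ^ v            <⟨ ℕₚ.*-monoˡ-< (K ^ v) {{>-nonZero 1≤K^v}} {4} {6} (s≤s (s≤s (s≤s (s≤s (s≤s z≤n))))) ⟩
    6 * K ^ v            ≡⟨ ℕₚ.*-distribʳ-+ (K ^ v) 3 3 ⟩
    3 * K ^ v + 3 * K ^ v
      ≤⟨ ℕₚ.+-mono-≤
           (F₁.covered-count left (Unique.map⁺ (↑ˡ-injective R _ _) (allFin⁺ R)) (sym (cong₂ _+_ length-left length-left))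
             (subst (1 ≤_) (sym length-left) 1≤R) 1≤G₁)
           (F₂.covered-count right (Unique.map⁺ (↑ʳ-injective R _ _) (allFin⁺ R)) (sym (cong₂ _+_ length-right length-right))
             (subst (1 ≤_) (sym length-right) 1≤R) 1≤G₂) ⟩
    4 * ∑ cs (λ c → ⟦ F₁.covered? left c ⟧) + 4 * ∑ cs (λ c → ⟦ F₂.covered? right c ⟧)
      ≡⟨ ℕₚ.*-distribˡ-+ 4 (∑ cs (λ c → ⟦ F₁.covered? left c ⟧)) _ ⟨
    4 * (∑ cs (λ c → ⟦ F₁.covered? left c ⟧) + ∑ cs (λ c → ⟦ F₂.covered? right c ⟧))
      ≡⟨ cong (4 *_) (∑-+ cs _ _) ⟨
    4 * ∑ cs e           ∎)
  result : ∃[ A ] ∃[ B ] (A ∈ G₁ × B ∈ G₂ × (∀ {i} → i ∈ˢ A → i ∉ˢ B))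
  result =
    let c , _ , 1<e      = ∑-exceeds cs e 1 total
        p , q            = ⟦⟧-both (F₁.covered? left c) (F₂.covered? right c) 1<e
        A , A∈ , A⊆left  = F₁.covered⇒member left c (subst (λ z → m < 2 ^ z) (sym length-left) m<2^R) p
        B , B∈ , B⊆right = F₂.covered⇒member right c (subst (λ z → m < 2 ^ z) (sym length-right) m<2^R) q
    in A , B , A∈ , B∈ , λ i∈A i∈B → disjoint (A⊆left i∈A) (B⊆right i∈B)

-- Spread approximation

∑-swap-*ˡ : ∀ (xs : List A) (ys : List B) (a : B → ℕ) (φ : B → A → ℕ) →
  ∑ xs (λ x → ∑ ys (λ y → a y * φ y x)) ≡ ∑ ys (λ y → a y * ∑ xs (φ y))
∑-swap-*ˡ xs ys a φ = trans (∑-swap xs ys _) (∑-cong ys λ {y} _ → ∑-*ˡ xs (φ y) (a y))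

module Links {O : Set} {v : ℕ} (E : O → Subset v) where

  deg : Subset v → List O → ℕ
  deg S G = ∑ G (λ A → ⟦ S ⊆? E A ⟧)

  -- For a family above `X` this is spreadness of the link, the sets `E A ─ X`, without forming
  -- them: only sets `S` disjoint from `X` are tested.
  SpreadAbove : ℕ → Subset v → List O → Set
  SpreadAbove r X G = ∀ S → (∀ {i} → i ∈ˢ S → i ∉ˢ X) → deg S G * r ^ ∣ S ∣ ≤ length G

  avoid? : ∀ Y A → Dec (¬ Nonempty (E A ∩ Y))
  avoid? Y A = ¬? (nonempty? (E A ∩ Y))

  avoiding : Subset v → List O → List O
  avoiding Y = filter (avoid? Y)

  -- A union bound: every point of `Y` lies in at most a fraction 1/r of `G`, and `Y` has at most
  -- r/2 points. The restriction is needed because disjoint links say nothing about `E A` meeting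
  -- the other kernel.
  avoiding-half : ∀ {q r X Y} G → 1 ≤ r → 2 * q ≤ r → ∣ Y ∣ ≤ q → (∀ {i} → i ∈ˢ Y → i ∉ˢ X) →
    SpreadAbove r X G → length G ≤ 2 * length (avoiding Y G)
  avoiding-half {q} {r} {X} {Y} G 1≤r 2q≤r ∣Y∣≤q disj spread = ℕₚ.+-cancelˡ-≤ (length G) _ _ (begin
    length G + length G             ≡⟨ cong (length G +_) (ℕₚ.+-identityʳ (length G)) ⟨
    2 * length G                    ≡⟨ cong (2 *_) (length-filter-split (λ A → nonempty? (E A ∩ Y)) (avoid? Y) G) ⟨
    2 * (hit + length (avoiding Y G)) ≡⟨ ℕₚ.*-distribˡ-+ 2 hit _ ⟩
    2 * hit + 2 * length (avoiding Y G) ≤⟨ ℕₚ.+-monoˡ-≤ _ 2hit≤ ⟩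
    length G + 2 * length (avoiding Y G) ∎)
    where
    open ≤-Reasoning
    hit : ℕ
    hit = length (filter (λ A → nonempty? (E A ∩ Y)) G)
    point : ∀ {y} → y ∈ˢ Y → ∑ G (λ A → ⟦ y ∈? E A ⟧) * r ≤ length G
    point {y} y∈ = begin
      ∑ G (λ A → ⟦ y ∈? E A ⟧) * r  ≤⟨ ℕₚ.*-monoˡ-≤ r (∑-mono G λ {A} _ → ⟦⟧-mono (y ∈? E A) (⁅ y ⁆ ⊆? E A)
                                          λ y∈E x∈ → subst (_∈ˢ E A) (sym (Subsetₚ.x∈⁅y⁆⇒x≡y y x∈)) y∈E) ⟩
      deg ⁅ y ⁆ G * r               ≡⟨ cong (deg ⁅ y ⁆ G *_) (trans (cong (r ^_) (Subsetₚ.∣⁅x⁆∣≡1 y)) (ℕₚ.*-identityʳ r)) ⟨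
      deg ⁅ y ⁆ G * r ^ ∣ ⁅ y ⁆ ∣   ≤⟨ spread ⁅ y ⁆ (λ x∈ → subst (_∉ˢ X) (sym (Subsetₚ.x∈⁅y⁆⇒x≡y y x∈)) (disj y∈)) ⟩
      length G                      ∎
    hit≤ : hit * r ≤ ∣ Y ∣ * length G
    hit≤ = begin
      hit * r
        ≡⟨ cong (_* r) (length-filter (λ A → nonempty? (E A ∩ Y)) G) ⟩
      ∑ G (λ A → ⟦ nonempty? (E A ∩ Y) ⟧) * r
        ≤⟨ ℕₚ.*-monoˡ-≤ r (∑-mono G λ {A} _ → ⟦⟧-≤ (nonempty? (E A ∩ Y)) λ { (y , y∈) →
             ℕₚ.≤-trans (ℕₚ.*-mono-≤ (⟦⟧-1≤ (y ∈? Y) (proj₂ (x∈p∩q⁻ (E A) Y y∈))) (⟦⟧-1≤ (y ∈? E A) (proj₁ (x∈p∩q⁻ (E A) Y y∈))))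
               (∑-term (λ y → ⟦ y ∈? Y ⟧ * ⟦ y ∈? E A ⟧) (∈-allFin y)) }) ⟩
      ∑ G (λ A → ∑ (allFin v) (λ y → ⟦ y ∈? Y ⟧ * ⟦ y ∈? E A ⟧)) * r
        ≡⟨ cong (_* r) (∑-swap-*ˡ G (allFin v) (λ y → ⟦ y ∈? Y ⟧) (λ y A → ⟦ y ∈? E A ⟧)) ⟩
      ∑ (allFin v) (λ y → ⟦ y ∈? Y ⟧ * ∑ G (λ A → ⟦ y ∈? E A ⟧)) * r
        ≡⟨ ∑-*ʳ (allFin v) _ r ⟨
      ∑ (allFin v) (λ y → ⟦ y ∈? Y ⟧ * ∑ G (λ A → ⟦ y ∈? E A ⟧) * r)
        ≤⟨ ∑-mono (allFin v) (λ {y} _ → ℕₚ.≤-trans (ℕₚ.≤-reflexive (ℕₚ.*-assoc ⟦ y ∈? Y ⟧ _ r))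
             (⟦⟧-*-≤ (y ∈? Y) λ y∈ → ℕₚ.≤-trans (point y∈) (ℕₚ.≤-reflexive
               (sym (trans (cong (_* length G) (⟦⟧-yes (y ∈? Y) y∈)) (ℕₚ.*-identityˡ _)))))) ⟩
      ∑ (allFin v) (λ y → ⟦ y ∈? Y ⟧ * length G)
        ≡⟨ trans (∑-*ʳ (allFin v) _ (length G)) (cong (_* length G) (sym (∣∣-∑ Y))) ⟩
      ∣ Y ∣ * length G ∎
    2hit≤ : 2 * hit ≤ length G
    2hit≤ = ℕₚ.*-cancelʳ-≤ _ _ r {{>-nonZero 1≤r}} (begin
      2 * hit * r              ≡⟨ ℕₚ.*-assoc 2 hit r ⟩
      2 * (hit * r)            ≤⟨ ℕₚ.*-monoʳ-≤ 2 hit≤ ⟩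
      2 * (∣ Y ∣ * length G)   ≤⟨ ℕₚ.*-monoʳ-≤ 2 (ℕₚ.*-monoˡ-≤ (length G) ∣Y∣≤q) ⟩
      2 * (q * length G)       ≡⟨ ℕₚ.*-assoc 2 q (length G) ⟨
      2 * q * length G         ≤⟨ ℕₚ.*-monoˡ-≤ (length G) 2q≤r ⟩
      r * length G             ≡⟨ ℕₚ.*-comm r (length G) ⟩
      length G * r             ∎)

  link : Subset v → List O → List (Subset v)
  link X = map (λ A → E A ─ X)

  -- Dropping half of the family costs a factor 2, paid by one of the factors 2 in
  -- `(2 * ρ) ^ ∣ S ∣`. The empty `S` has no such factor but is trivial, and an `S` meeting `X` has
  -- degree 0 in the link.
  link-spread : ∀ {ρ X} {P : O → Set} (P? : Decidable P) G → SpreadAbove (2 * ρ) X G →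
    length G ≤ 2 * length (filter P? G) → IsSpread ρ (link X (filter P? G))
  link-spread {ρ} {X} P? G spread half S = begin
    ∑ (link X G′) (λ f → ⟦ S ⊆? f ⟧) * ρ ^ ∣ S ∣  ≡⟨ cong (_* ρ ^ ∣ S ∣) (∑-map _ G′ _) ⟩
    d * ρ ^ ∣ S ∣                                 ≤⟨ bound ∣ S ∣ refl ⟩
    length G′                                     ≡⟨ length-map _ G′ ⟨
    length (link X G′)                            ∎
    where
    open ≤-Reasoning
    G′ : List O
    G′ = filter P? G
    d : ℕ
    d = ∑ G′ (λ A → ⟦ S ⊆? (E A ─ X) ⟧)
    d≤ : d ≤ deg S G
    d≤ = begin
      d                             ≤⟨ ∑-mono G′ (λ {A} _ → ⟦⟧-mono (S ⊆? (E A ─ X)) (S ⊆? E A) λ S⊆ x∈ → p─q⊆p (E A) X (S⊆ x∈)) ⟩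
      deg S G′                      ≡⟨ ∑-filter P? G _ ⟩
      ∑ G (λ A → ⟦ P? A ⟧ * ⟦ S ⊆? E A ⟧) ≤⟨ ∑-mono G (λ {A} _ → ⟦⟧-*-≤ (P? A) λ _ → ℕₚ.≤-refl) ⟩
      deg S G                       ∎
    bound : ∀ s → ∣ S ∣ ≡ s → d * ρ ^ s ≤ length G′
    bound zero _ = ℕₚ.≤-trans (ℕₚ.≤-reflexive (ℕₚ.*-identityʳ d))
      (ℕₚ.≤-trans (∑-bound G′ λ {A} _ → ⟦⟧-≤1 (S ⊆? (E A ─ X))) (ℕₚ.≤-reflexive (ℕₚ.*-identityʳ _)))
    bound (suc s) eq with nonempty? (S ∩ X)
    ... | yes (x , x∈) = ℕₚ.≤-trans (ℕₚ.*-monoˡ-≤ (ρ ^ suc s) {d} {0} (ℕₚ.≤-trans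
      (∑-mono G′ {ψ = λ _ → 0} λ {A} _ → ⟦⟧-≤ (S ⊆? (E A ─ X)) λ S⊆ →
        ⊥-elim (x∈p─q⇒x∉q (E A) X (S⊆ (proj₁ (x∈p∩q⁻ S X x∈))) (proj₂ (x∈p∩q⁻ S X x∈))))
      (ℕₚ.≤-reflexive (∑-0 G′)))) z≤n
    ... | no empty = ℕₚ.*-cancelˡ-≤ 2 (begin
      2 * (d * ρ ^ suc s)             ≡⟨ l d (ρ ^ suc s) ⟩
      d * (2 * 1 * ρ ^ suc s)         ≤⟨ ℕₚ.*-mono-≤ d≤ (ℕₚ.*-monoˡ-≤ (ρ ^ suc s) (ℕₚ.*-monoʳ-≤ 2 (ℕₚ.m^n>0 2 s))) ⟩
      deg S G * (2 ^ suc s * ρ ^ suc s) ≡⟨ cong (deg S G *_) (^-distribʳ-* 2 ρ (suc s)) ⟨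
      deg S G * (2 * ρ) ^ suc s       ≡⟨ cong (λ z → deg S G * (2 * ρ) ^ z) eq ⟨
      deg S G * (2 * ρ) ^ ∣ S ∣       ≤⟨ spread S (λ {i} i∈S i∈X → empty (i , x∈p∩q⁺ (i∈S , i∈X))) ⟩
      length G                        ≤⟨ half ⟩
      2 * length G′                   ∎)
      where
      l : ∀ a b → 2 * (a * b) ≡ a * (2 * 1 * b)
      l = solve-∀

  -- A common point of `E A` and `E B` is not in `X`, as `B` avoids `X`, nor in `Y`, as `A` avoids
  -- `Y`. So it would lie in both links, which are disjoint.
  links-disjoint : ∀ {m R q ρ X Y G₁ G₂} → 1 ≤ R → m < 2 ^ R → (4 * R) * (4 * R) ≤ ρ → 2 * q ≤ 2 * ρ →
    (∀ {A} → A ∈ G₁ → ∣ E A ∣ ≤ m × X ⊆ˢ E A) → (∀ {A} → A ∈ G₂ → ∣ E A ∣ ≤ m × Y ⊆ˢ E A) →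
    ∣ X ∣ ≤ q → ∣ Y ∣ ≤ q → (∀ {i} → i ∈ˢ X → i ∉ˢ Y) →
    SpreadAbove (2 * ρ) X G₁ → SpreadAbove (2 * ρ) Y G₂ → 1 ≤ length G₁ → 1 ≤ length G₂ →
    ∃[ A ] ∃[ B ] (A ∈ G₁ × B ∈ G₂ × (∀ {i} → i ∈ˢ E A → i ∉ˢ E B))
  links-disjoint {m} {R} {q} {ρ} {X} {Y} {G₁} {G₂} 1≤R m<2^R R²≤ρ 2q≤r above₁ above₂ ∣X∣≤q ∣Y∣≤q disj sp₁ sp₂ 1≤G₁ 1≤G₂ =
    let f , g , f∈ , g∈ , f∩g = spread⇒disjoint m R ρ 1≤R m<2^R R²≤ρ (link X G₁′) (link Y G₂′)
          (small {Y} {X} {G₁} (λ A∈ → proj₁ (above₁ A∈))) (small {X} {Y} {G₂} (λ A∈ → proj₁ (above₂ A∈)))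
          (link-spread (avoid? Y) G₁ sp₁ half₁) (link-spread (avoid? X) G₂ sp₂ half₂)
          (nonempty-link {Y} {X} {G₁} half₁ 1≤G₁) (nonempty-link {X} {Y} {G₂} half₂ 1≤G₂)
        A , A∈′ , f≡ = ∈-map⁻ _ f∈
        B , B∈′ , g≡ = ∈-map⁻ _ g∈
        A∈ , A∩Y = ∈-filter⁻ (avoid? Y) {xs = G₁} A∈′
        B∈ , B∩X = ∈-filter⁻ (avoid? X) {xs = G₂} B∈′
    in A , B , A∈ , B∈ , λ {i} i∈A i∈B → f∩g
         (subst (i ∈ˢ_) (sym f≡) (x∈p∧x∉q⇒x∈p─q i∈A λ i∈X → B∩X (i , x∈p∩q⁺ (i∈B , i∈X))))
         (subst (i ∈ˢ_) (sym g≡) (x∈p∧x∉q⇒x∈p─q i∈B λ i∈Y → A∩Y (i , x∈p∩q⁺ (i∈A , i∈Y))))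
    where
    G₁′ G₂′ : List O
    G₁′ = avoiding Y G₁
    G₂′ = avoiding X G₂
    1≤r : 1 ≤ 2 * ρ
    1≤r = ℕₚ.≤-trans (ℕₚ.*-mono-≤ (ℕₚ.≤-trans 1≤R (ℕₚ.m≤n*m R 4)) (ℕₚ.≤-trans 1≤R (ℕₚ.m≤n*m R 4)))
      (ℕₚ.≤-trans R²≤ρ (ℕₚ.m≤n*m ρ 2))
    half₁ : length G₁ ≤ 2 * length G₁′
    half₁ = avoiding-half G₁ 1≤r 2q≤r ∣Y∣≤q (λ i∈Y i∈X → disj i∈X i∈Y) sp₁
    half₂ : length G₂ ≤ 2 * length G₂′
    half₂ = avoiding-half G₂ 1≤r 2q≤r ∣X∣≤q disj sp₂
    small : ∀ {Z W G} → (∀ {A} → A ∈ G → ∣ E A ∣ ≤ m) → ∀ {f} → f ∈ link W (avoiding Z G) → ∣ f ∣ ≤ m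
    small {Z} {W} {G} b f∈ with ∈-map⁻ _ f∈
    ... | A , A∈ , refl = ℕₚ.≤-trans (Subsetₚ.∣p─q∣≤∣p∣ (E A) W) (b (proj₁ (∈-filter⁻ (avoid? Z) {xs = G} A∈)))
    nonempty-link : ∀ {Z W G} → length G ≤ 2 * length (avoiding Z G) → 1 ≤ length G → 1 ≤ length (link W (avoiding Z G))
    nonempty-link {Z} {W} {G} half 1≤ with avoiding Z G
    ... | _ ∷ _ = s≤s z≤n
    ... | []    = ℕₚ.≤-trans 1≤ half

∣p∪q∣≡∣p∣+∣q∣ : ∀ {v} (p q : Subset v) → (∀ {i} → i ∈ˢ q → i ∉ˢ p) → ∣ p ∪ q ∣ ≡ ∣ p ∣ + ∣ q ∣
∣p∪q∣≡∣p∣+∣q∣ [] [] disj = refl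
∣p∪q∣≡∣p∣+∣q∣ (true ∷ p)  (true ∷ q)  disj = ⊥-elim (disj Vec.here Vec.here)
∣p∪q∣≡∣p∣+∣q∣ (true ∷ p)  (false ∷ q) disj = cong suc (∣p∪q∣≡∣p∣+∣q∣ p q λ i∈ i∈′ → disj (Vec.there i∈) (Vec.there i∈′))
∣p∪q∣≡∣p∣+∣q∣ (false ∷ p) (true ∷ q)  disj = trans (cong suc (∣p∪q∣≡∣p∣+∣q∣ p q λ i∈ i∈′ → disj (Vec.there i∈) (Vec.there i∈′))) (sym (ℕₚ.+-suc ∣ p ∣ ∣ q ∣))
∣p∪q∣≡∣p∣+∣q∣ (false ∷ p) (false ∷ q) disj = ∣p∪q∣≡∣p∣+∣q∣ p q λ i∈ i∈′ → disj (Vec.there i∈) (Vec.there i∈′)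

module Approximation {O : Set} {v : ℕ} (E : O → Subset v) (_≟ᴼ_ : (A B : O) → Dec (A ≡ B)) (𝓤 : List O)
  (m R q ρ : ℕ) (1≤R : 1 ≤ R) (m<2^R : m < 2 ^ R) (R²≤ρ : (4 * R) * (4 * R) ≤ ρ) (2q≤r : 2 * q ≤ 2 * ρ)
  (size : ∀ {A} → A ∈ 𝓤 → ∣ E A ∣ ≤ m)
  (spread : ∀ X → Links.deg E X 𝓤 * (2 * ρ * (2 * ρ)) ^ ∣ X ∣ ≤ length 𝓤)
  (4v≤r^q : 4 * v ≤ (2 * ρ) ^ q)
  where

  open Links E

  r : ℕ
  r = 2 * ρ

  private
    1≤r : 1 ≤ r
    1≤r = ℕₚ.≤-trans (ℕₚ.*-mono-≤ (ℕₚ.≤-trans 1≤R (ℕₚ.m≤n*m R 4)) (ℕₚ.≤-trans 1≤R (ℕₚ.m≤n*m R 4)))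
      (ℕₚ.≤-trans R²≤ρ (ℕₚ.m≤n*m ρ 2))

  above : Subset v → List O → List O
  above X = filter (λ A → X ⊆? E A)

  length-above : ∀ X F → length (above X F) ≡ deg X F
  length-above X F = length-filter (λ A → X ⊆? E A) F

  potential : List O → Subset v → ℕ
  potential F X = deg X F * r ^ ∣ X ∣

  -- At a maximum of the potential, passing from X to X ∪ S cannot gain, which is spreadness of the link of X.
  maximal⇒spread : ∀ F X → (∀ Y → potential F Y ≤ potential F X) → SpreadAbove r X (above X F)
  maximal⇒spread F X max S disj = ℕₚ.*-cancelʳ-≤ _ _ (r ^ ∣ X ∣) {{>-nonZero (ℕₚ.m^n>0 r {{>-nonZero 1≤r}} ∣ X ∣)}} (begin
    deg S (above X F) * r ^ ∣ S ∣ * r ^ ∣ X ∣     ≡⟨ ℕₚ.*-assoc (deg S (above X F)) _ _ ⟩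
    deg S (above X F) * (r ^ ∣ S ∣ * r ^ ∣ X ∣)   ≡⟨ cong (deg S (above X F) *_) (trans (ℕₚ.*-comm (r ^ ∣ S ∣) _)
                                                      (trans (sym (ℕₚ.^-distribˡ-+-* r ∣ X ∣ ∣ S ∣)) (cong (r ^_) (sym (∣p∪q∣≡∣p∣+∣q∣ X S disj))))) ⟩
    deg S (above X F) * r ^ ∣ X ∪ S ∣             ≤⟨ ℕₚ.*-monoˡ-≤ _ deg≤ ⟩
    potential F (X ∪ S)                           ≤⟨ max (X ∪ S) ⟩
    deg X F * r ^ ∣ X ∣                           ≡⟨ cong (_* r ^ ∣ X ∣) (length-above X F) ⟨
    length (above X F) * r ^ ∣ X ∣                ∎)
    where
    open ≤-Reasoning
    deg≤ : deg S (above X F) ≤ deg (X ∪ S) F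
    deg≤ = begin
      deg S (above X F)                        ≡⟨ ∑-filter (λ A → X ⊆? E A) F _ ⟩
      ∑ F (λ A → ⟦ X ⊆? E A ⟧ * ⟦ S ⊆? E A ⟧)  ≤⟨ ∑-mono F (λ {A} _ → ⟦⟧-*-≤ (X ⊆? E A) λ X⊆ → ⟦⟧-mono (S ⊆? E A) ((X ∪ S) ⊆? E A)
                                                    λ S⊆ x∈ → case x∈p∪q⁻ X S x∈ of λ { (inj₁ x∈X) → X⊆ x∈X ; (inj₂ x∈S) → S⊆ x∈S }) ⟩
      deg (X ∪ S) F                            ∎

  -- The witness `G` is only some of the members above `X`: those still present when `X` was
  -- extracted.
  Kernel : List O → Subset v → Set
  Kernel F X = ∣ X ∣ ≤ q × ∃[ G ] ((∀ {A} → A ∈ G → A ∈ F × X ⊆ˢ E A) × 1 ≤ length G × SpreadAbove r X G)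

  kernels-intersect : ∀ {F X Y} → (∀ {A} → A ∈ F → A ∈ 𝓤) →
    (∀ {A B} → A ∈ F → B ∈ F → Nonempty (E A ∩ E B)) → Kernel F X → Kernel F Y → Nonempty (X ∩ Y)
  kernels-intersect {F} {X} {Y} F⊆ int (∣X∣≤q , G₁ , G₁⊆ , 1≤G₁ , sp₁) (∣Y∣≤q , G₂ , G₂⊆ , 1≤G₂ , sp₂)
    with nonempty? (X ∩ Y)
  ... | yes ne = ne
  ... | no empty =
    let A , B , A∈ , B∈ , A∩B = links-disjoint 1≤R m<2^R R²≤ρ 2q≤r
          (λ A∈ → size (F⊆ (proj₁ (G₁⊆ A∈))) , proj₂ (G₁⊆ A∈)) (λ B∈ → size (F⊆ (proj₁ (G₂⊆ B∈))) , proj₂ (G₂⊆ B∈))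
          ∣X∣≤q ∣Y∣≤q (λ {i} i∈X i∈Y → empty (i , x∈p∩q⁺ (i∈X , i∈Y))) sp₁ sp₂ 1≤G₁ 1≤G₂
        i , i∈ = int (proj₁ (G₁⊆ A∈)) (proj₁ (G₂⊆ B∈))
    in ⊥-elim (A∩B (proj₁ (x∈p∩q⁻ (E A) (E B) i∈)) (proj₂ (x∈p∩q⁻ (E A) (E B) i∈)))

  -- Two families occur because `F` shrinks during the recursion, while kernels found at different
  -- stages must be compared as kernels of one family `F₀`.
  record Decomposition (F₀ F : List O) : Set where
    field
      kernels   : List (Subset v)
      isKernel  : ∀ {X} → X ∈ kernels → Kernel F₀ X
      rest      : List O
      unique    : Unique rest
      covers    : ∀ {A} → A ∈ F → A ∈ rest ⊎ (∃[ X ] (X ∈ kernels × X ⊆ˢ E A))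
      rest-size : length rest * r ^ q ≤ length 𝓤

  -- Let `X` maximise the potential. Comparison with `∅ˢ` gives `length F ≤ deg X F * r ^ ∣ X ∣`. If
  -- `X` has at least `q` elements, spreadness with `r * r` makes `deg X F * r ^ ∣ X ∣ * r ^ ∣ X ∣`
  -- at most `length 𝓤`, so all of `F` may become the rest. Otherwise `X` is a kernel, and the
  -- members not above it are decomposed further.
  decompose : ∀ {F₀} n F → length F ≤ n → Unique F → (∀ {A} → A ∈ F → A ∈ F₀) → (∀ {A} → A ∈ F₀ → A ∈ 𝓤) →
    Decomposition F₀ F
  decompose n [] _ _ _ _ = record
    { kernels = [] ; isKernel = λ () ; rest = [] ; unique = [] ; covers = λ () ; rest-size = z≤n }
  decompose {F₀} (suc n) F@(_ ∷ F′) len u F⊆F₀ F₀⊆ with argmax (potential F) ∅ˢ (subsets v)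
  ... | X , max with q ≤? ∣ X ∣
  ... | yes q≤ = record
    { kernels = [] ; isKernel = λ () ; rest = F ; unique = u ; covers = inj₁ ; rest-size = begin
      length F * r ^ q                       ≤⟨ ℕₚ.*-monoʳ-≤ (length F) (ℕₚ.^-monoʳ-≤ r {{>-nonZero 1≤r}} q≤) ⟩
      length F * r ^ ∣ X ∣                   ≤⟨ ℕₚ.*-monoˡ-≤ (r ^ ∣ X ∣) big ⟩
      deg X F * r ^ ∣ X ∣ * r ^ ∣ X ∣        ≡⟨ ℕₚ.*-assoc (deg X F) _ _ ⟩
      deg X F * (r ^ ∣ X ∣ * r ^ ∣ X ∣)      ≡⟨ cong (deg X F *_) (^-distribʳ-* r r ∣ X ∣) ⟨
      deg X F * (r * r) ^ ∣ X ∣              ≤⟨ ℕₚ.*-monoˡ-≤ _ (∑-⊆ _ u (F₀⊆ ∘ F⊆F₀)) ⟩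
      deg X 𝓤 * (r * r) ^ ∣ X ∣              ≤⟨ spread X ⟩
      length 𝓤                               ∎ }
    where
    open ≤-Reasoning
    big : length F ≤ potential F X
    big = begin
      length F                   ≡⟨ ∑-1 F ⟨
      ∑ F (λ _ → 1)              ≤⟨ ∑-mono F (λ {A} _ → ⟦⟧-1≤ (∅ˢ ⊆? E A) Subsetₚ.⊥⊆) ⟩
      deg ∅ˢ F                   ≡⟨ ℕₚ.*-identityʳ _ ⟨
      deg ∅ˢ F * r ^ 0           ≡⟨ cong (λ z → deg ∅ˢ F * r ^ z) (Subsetₚ.∣⊥∣≡0 v) ⟨
      potential F ∅ˢ             ≤⟨ max (∈-subsets ∅ˢ) ⟩
      potential F X              ∎
  ... | no q≰ = record
    { kernels   = X ∷ D.kernels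
    ; isKernel  = λ { (here refl) → X-kernel ; (there Y∈) → D.isKernel Y∈ }
    ; rest      = D.rest
    ; unique    = D.unique
    ; covers    = cov
    ; rest-size = D.rest-size
    }
    where
    open ≤-Reasoning
    ⊈? : ∀ A → Dec (¬ (X ⊆ˢ E A))
    ⊈? A = ¬? (X ⊆? E A)
    below : List O
    below = filter ⊈? F
    -- The potential of `∅ˢ` is already positive, so the maximal `X` has a member above it. Hence
    -- the remaining list is strictly shorter.
    1≤deg : 1 ≤ deg X F
    1≤deg = ℕₚ.n≢0⇒n>0 λ eq → case (begin
      1                          ≤⟨ s≤s z≤n ⟩
      length F                   ≡⟨ ∑-1 F ⟨
      ∑ F (λ _ → 1)              ≤⟨ ∑-mono F (λ {A} _ → ⟦⟧-1≤ (∅ˢ ⊆? E A) Subsetₚ.⊥⊆) ⟩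
      deg ∅ˢ F                   ≡⟨ ℕₚ.*-identityʳ _ ⟨
      deg ∅ˢ F * r ^ 0           ≡⟨ cong (λ z → deg ∅ˢ F * r ^ z) (Subsetₚ.∣⊥∣≡0 v) ⟨
      potential F ∅ˢ             ≤⟨ max (∈-subsets ∅ˢ) ⟩
      potential F X              ≡⟨ cong (_* r ^ ∣ X ∣) eq ⟩
      0                          ∎) of λ ()
    1≤above : 1 ≤ length (above X F)
    1≤above = subst (1 ≤_) (sym (length-above X F)) 1≤deg
    X-kernel : Kernel F₀ X
    X-kernel = ℕₚ.<⇒≤ (ℕₚ.≰⇒> q≰) , above X F
      , (λ A∈ → let A∈F , X⊆ = ∈-filter⁻ (λ A → X ⊆? E A) {xs = F} A∈ in F⊆F₀ A∈F , X⊆)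
      , 1≤above , maximal⇒spread F X (λ Y → max (∈-subsets Y))
    shorter : length below ≤ n
    shorter = ℕₚ.+-cancelˡ-≤ 1 _ _ (begin
      1 + length below                    ≤⟨ ℕₚ.+-monoˡ-≤ (length below) 1≤above ⟩
      length (above X F) + length below   ≡⟨ length-filter-split (λ A → X ⊆? E A) ⊈? F ⟩
      length F                            ≤⟨ len ⟩
      suc n                               ∎)
    module D = Decomposition (decompose {F₀} n below shorter (Unique.filter⁺ ⊈? u)
      (λ A∈ → F⊆F₀ (proj₁ (∈-filter⁻ ⊈? {xs = F} A∈))) F₀⊆)
    cov : ∀ {A} → A ∈ F → A ∈ D.rest ⊎ (∃[ Y ] (Y ∈ X ∷ D.kernels × Y ⊆ˢ E A))
    cov {A} A∈ with X ⊆? E A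
    ... | yes X⊆ = inj₂ (X , here refl , X⊆)
    ... | no X⊈ with D.covers (∈-filter⁺ ⊈? A∈ X⊈)
    ... | inj₁ A∈rest        = inj₁ A∈rest
    ... | inj₂ (Y , Y∈ , Y⊆) = inj₂ (Y , there Y∈ , Y⊆)

  pairDegree : Fin v → Fin v → ℕ
  pairDegree e e′ = ∑ 𝓤 (λ A → ⟦ e ∈? E A ⟧ * ⟦ e′ ∈? E A ⟧)

  missing : Fin v → List O → List O
  missing e = filter (λ A → ¬? (e ∈? E A))

  -- The default `X₀` is taken only when `e` lies in every kernel, a case excluded for those `e`
  -- that are counted.
  avoidingKernel : List (Subset v) → Subset v → Fin v → Subset v
  avoidingKernel 𝒮 X₀ e with Any.any? (λ X → ¬? (e ∈? X)) 𝒮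
  ... | yes p = proj₁ (find p)
  ... | no _  = X₀

  avoidingKernel-∈ : ∀ 𝒮 {X₀} e → X₀ ∈ 𝒮 → avoidingKernel 𝒮 X₀ e ∈ 𝒮
  avoidingKernel-∈ 𝒮 e X₀∈ with Any.any? (λ X → ¬? (e ∈? X)) 𝒮
  ... | yes p = proj₁ (proj₂ (find p))
  ... | no _  = X₀∈

  avoidingKernel-∉ : ∀ 𝒮 {X₀} e → ¬ All (e ∈ˢ_) 𝒮 → e ∉ˢ avoidingKernel 𝒮 X₀ e
  avoidingKernel-∉ 𝒮 e ¬all with Any.any? (λ X → ¬? (e ∈? X)) 𝒮
  ... | yes p = proj₂ (proj₂ (find p))
  ... | no ¬p = ⊥-elim (¬all (All.tabulate λ {X} X∈ → case e ∈? X of λ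
    { (yes e∈) → e∈ ; (no e∉) → ⊥-elim (¬p (lose X∈ e∉)) }))

  -- If a point `e` lies in all kernels, members missing `e` contain no kernel and belong to the
  -- rest. If no such `e` exists, the rest is at most a quarter of `F`, by `4 * v ≤ r ^ q` and
  -- density, and so are the members covered by the at most q * q pairs. Together they cannot cover
  -- a nonempty `F`.
  approximate-star : ∀ F → Unique F → (∀ {A} → A ∈ F → A ∈ 𝓤) →
    (∀ {A B} → A ∈ F → B ∈ F → Nonempty (E A ∩ E B)) →
    length 𝓤 ≤ v * length F →
    (∀ e e′ → e ≢ e′ → pairDegree e e′ * (4 * (q * q)) ≤ length F) →
    1 ≤ length F → ∃[ e ] (length (missing e F) * r ^ q ≤ length 𝓤)
  approximate-star F u F⊆ int dense pairs 1≤F = result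
    where
    open ≤-Reasoning
    open Decomposition (decompose {F} (length F) F ℕₚ.≤-refl u (λ A∈ → A∈) F⊆)

    1≤v : 1 ≤ v
    1≤v = ℕₚ.n≢0⇒n>0 λ v≡0 → case ℕₚ.≤-trans (ℕₚ.≤-trans 1≤F (length-⊆ u F⊆))
      (subst (λ z → length 𝓤 ≤ z * length F) v≡0 dense) of λ ()

    4rest≤ : 4 * length rest ≤ length F
    4rest≤ = ℕₚ.*-cancelʳ-≤ _ _ v {{>-nonZero 1≤v}} (begin
      4 * length rest * v      ≡⟨ l (length rest) v ⟩
      length rest * (4 * v)    ≤⟨ ℕₚ.*-monoʳ-≤ (length rest) 4v≤r^q ⟩
      length rest * r ^ q      ≤⟨ rest-size ⟩
      length 𝓤                 ≤⟨ dense ⟩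
      v * length F             ≡⟨ ℕₚ.*-comm v (length F) ⟩
      length F * v             ∎)
      where
      l : ∀ a v → 4 * a * v ≡ a * (4 * v)
      l = solve-∀

    inRest? : ∀ A → Dec (A ∈ rest)
    inRest? A = Any.any? (A ≟ᴼ_) rest

    rest-∑ : ∑ F (λ A → ⟦ inRest? A ⟧) ≤ length rest
    rest-∑ = begin
      ∑ F (λ A → ⟦ inRest? A ⟧)    ≡⟨ length-filter inRest? F ⟨
      length (filter inRest? F)    ≤⟨ length-⊆ (Unique.filter⁺ inRest? u) (λ A∈ → proj₂ (∈-filter⁻ inRest? {xs = F} A∈)) ⟩
      length rest                  ∎

    star : ∀ e → All (e ∈ˢ_) kernels → length (missing e F) * r ^ q ≤ length 𝓤
    star e all = ℕₚ.≤-trans (ℕₚ.*-monoˡ-≤ (r ^ q) (length-⊆ (Unique.filter⁺ _ u) λ A∈ →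
      let A∈F , e∉ = ∈-filter⁻ (λ A → ¬? (e ∈? E A)) {xs = F} A∈ in
      case covers A∈F of λ
        { (inj₁ A∈rest) → A∈rest
        ; (inj₂ (X , X∈ , X⊆)) → ⊥-elim (e∉ (X⊆ (All.lookup all X∈))) })) rest-size

    intersecting : ∀ {X Y} → X ∈ kernels → Y ∈ kernels → Nonempty (X ∩ Y)
    intersecting X∈ Y∈ = kernels-intersect F⊆ int (isKernel X∈) (isKernel Y∈)

    -- Every member of F outside rest meets X₁ in some e and a kernel missing e in some e′ ≠ e.
    scattered : ∀ {X₁} → X₁ ∈ kernels → (∀ e → e ∈ˢ X₁ → ¬ All (e ∈ˢ_) kernels) → 1 ≤ q → length F ≤ 0
    scattered {X₁} X₁∈ ¬star 1≤q = ℕₚ.+-cancelʳ-≤ (length F + length F) _ _ (begin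
      length F + (length F + length F)    ≤⟨ ℕₚ.m≤n+m _ (length F) ⟩
      length F + (length F + (length F + length F)) ≡⟨ cong (λ z → length F + (length F + (length F + z))) (ℕₚ.+-identityʳ _) ⟨
      4 * length F                        ≤⟨ ℕₚ.*-monoʳ-≤ 4 F≤ ⟩
      4 * (length rest + ∑ F T)           ≡⟨ ℕₚ.*-distribˡ-+ 4 (length rest) _ ⟩
      4 * length rest + 4 * ∑ F T         ≤⟨ ℕₚ.+-mono-≤ 4rest≤ 4T≤ ⟩
      length F + length F                 ∎)
      where
      sel : Fin v → Subset v
      sel = avoidingKernel kernels X₁
      es : List (Fin v)
      es = allFin v
      T : O → ℕ
      T A = ∑ es (λ e → ⟦ e ∈? X₁ ⟧ * ∑ es (λ e′ → ⟦ e′ ∈? sel e ⟧ * (⟦ e ∈? E A ⟧ * ⟦ e′ ∈? E A ⟧)))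
      hit : ∀ {A} → A ∈ F → 1 ≤ ⟦ inRest? A ⟧ + T A
      hit {A} A∈ with covers A∈
      ... | inj₁ A∈rest = ℕₚ.≤-trans (⟦⟧-1≤ (inRest? A) A∈rest) (ℕₚ.m≤m+n _ _)
      ... | inj₂ (X , X∈ , X⊆) =
        let e  , e∈  = intersecting X∈ X₁∈
            e∈X , e∈X₁ = x∈p∩q⁻ X X₁ e∈
            e′ , e′∈ = intersecting X∈ (avoidingKernel-∈ kernels e X₁∈)
            e′∈X , e′∈sel = x∈p∩q⁻ X (sel e) e′∈
        in ℕₚ.≤-trans (ℕₚ.≤-trans
            (ℕₚ.*-mono-≤ (⟦⟧-1≤ (e ∈? X₁) e∈X₁) (ℕₚ.≤-trans
              (ℕₚ.*-mono-≤ (⟦⟧-1≤ (e′ ∈? sel e) e′∈sel) (ℕₚ.*-mono-≤ (⟦⟧-1≤ (e ∈? E A) (X⊆ e∈X)) (⟦⟧-1≤ (e′ ∈? E A) (X⊆ e′∈X))))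
              (∑-term (λ e′ → ⟦ e′ ∈? sel e ⟧ * (⟦ e ∈? E A ⟧ * ⟦ e′ ∈? E A ⟧)) (∈-allFin e′))))
            (∑-term (λ e → ⟦ e ∈? X₁ ⟧ * ∑ es (λ e′ → ⟦ e′ ∈? sel e ⟧ * (⟦ e ∈? E A ⟧ * ⟦ e′ ∈? E A ⟧))) (∈-allFin e)))
          (ℕₚ.m≤n+m _ ⟦ inRest? A ⟧)
      F≤ : length F ≤ length rest + ∑ F T
      F≤ = begin
        length F                                  ≡⟨ ∑-1 F ⟨
        ∑ F (λ _ → 1)                             ≤⟨ ∑-mono F hit ⟩
        ∑ F (λ A → ⟦ inRest? A ⟧ + T A)           ≡⟨ ∑-+ F _ T ⟩
        ∑ F (λ A → ⟦ inRest? A ⟧) + ∑ F T         ≤⟨ ℕₚ.+-monoˡ-≤ (∑ F T) rest-∑ ⟩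
        length rest + ∑ F T                       ∎
      K : ℕ
      K = 4 * (q * q)
      inner : ∀ e → e ∈ˢ X₁ → ∑ es (λ e′ → ⟦ e′ ∈? sel e ⟧ * pairDegree e e′) * K ≤ q * length F
      inner e e∈ = begin
        ∑ es (λ e′ → ⟦ e′ ∈? sel e ⟧ * pairDegree e e′) * K
          ≡⟨ ∑-*ʳ es _ K ⟨
        ∑ es (λ e′ → ⟦ e′ ∈? sel e ⟧ * pairDegree e e′ * K)
          ≤⟨ ∑-mono es (λ {e′} _ → ℕₚ.≤-trans (ℕₚ.≤-reflexive (ℕₚ.*-assoc ⟦ e′ ∈? sel e ⟧ _ K))
               (⟦⟧-*-≤ (e′ ∈? sel e) λ e′∈ → ℕₚ.≤-trans
                 (pairs e e′ λ { refl → avoidingKernel-∉ kernels e (¬star e e∈) e′∈ })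
                 (ℕₚ.≤-reflexive (sym (trans (cong (_* length F) (⟦⟧-yes (e′ ∈? sel e) e′∈)) (ℕₚ.*-identityˡ _)))))) ⟩
        ∑ es (λ e′ → ⟦ e′ ∈? sel e ⟧ * length F)
          ≡⟨ trans (∑-*ʳ es _ (length F)) (cong (_* length F) (sym (∣∣-∑ (sel e)))) ⟩
        ∣ sel e ∣ * length F
          ≤⟨ ℕₚ.*-monoˡ-≤ (length F) (proj₁ (isKernel (avoidingKernel-∈ kernels e X₁∈))) ⟩
        q * length F ∎
      T-sum : ∑ 𝓤 T ≡ ∑ es (λ e → ⟦ e ∈? X₁ ⟧ * ∑ es (λ e′ → ⟦ e′ ∈? sel e ⟧ * pairDegree e e′))
      T-sum = trans (∑-swap-*ˡ 𝓤 es (λ e → ⟦ e ∈? X₁ ⟧) (λ e A → ∑ es (λ e′ → ⟦ e′ ∈? sel e ⟧ * (⟦ e ∈? E A ⟧ * ⟦ e′ ∈? E A ⟧))))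
        (∑-cong es λ {e} _ → cong (⟦ e ∈? X₁ ⟧ *_)
          (∑-swap-*ˡ 𝓤 es (λ e′ → ⟦ e′ ∈? sel e ⟧) (λ e′ A → ⟦ e ∈? E A ⟧ * ⟦ e′ ∈? E A ⟧)))
      4T≤ : 4 * ∑ F T ≤ length F
      4T≤ = ℕₚ.*-cancelʳ-≤ _ _ (q * q) {{>-nonZero (ℕₚ.*-mono-≤ 1≤q 1≤q)}} (begin
        4 * ∑ F T * (q * q)     ≡⟨ l (∑ F T) (q * q) ⟩
        ∑ F T * K               ≤⟨ ℕₚ.*-monoˡ-≤ K (∑-⊆ T u F⊆) ⟩
        ∑ 𝓤 T * K               ≡⟨ cong (_* K) T-sum ⟩
        ∑ es (λ e → ⟦ e ∈? X₁ ⟧ * ∑ es (λ e′ → ⟦ e′ ∈? sel e ⟧ * pairDegree e e′)) * K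
          ≡⟨ ∑-*ʳ es _ K ⟨
        ∑ es (λ e → ⟦ e ∈? X₁ ⟧ * ∑ es (λ e′ → ⟦ e′ ∈? sel e ⟧ * pairDegree e e′) * K)
          ≤⟨ ∑-mono es (λ {e} _ → ℕₚ.≤-trans (ℕₚ.≤-reflexive (ℕₚ.*-assoc ⟦ e ∈? X₁ ⟧ _ K))
               (⟦⟧-*-≤ (e ∈? X₁) λ e∈ → ℕₚ.≤-trans (inner e e∈)
                 (ℕₚ.≤-reflexive (sym (trans (cong (_* (q * length F)) (⟦⟧-yes (e ∈? X₁) e∈)) (ℕₚ.*-identityˡ _)))))) ⟩
        ∑ es (λ e → ⟦ e ∈? X₁ ⟧ * (q * length F))
          ≡⟨ trans (∑-*ʳ es _ _) (cong (_* (q * length F)) (sym (∣∣-∑ X₁))) ⟩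
        ∣ X₁ ∣ * (q * length F)
          ≤⟨ ℕₚ.*-monoˡ-≤ _ (proj₁ (isKernel X₁∈)) ⟩
        q * (q * length F)      ≡⟨ trans (sym (ℕₚ.*-assoc q q _)) (ℕₚ.*-comm (q * q) _) ⟩
        length F * (q * q)      ∎)
        where
        l : ∀ a b → 4 * a * b ≡ a * (4 * b)
        l = solve-∀

    nonempty⇒1≤q : ∀ {X} → X ∈ kernels → 1 ≤ q
    nonempty⇒1≤q {X} X∈ with intersecting X∈ X∈
    ... | i , i∈ = ℕₚ.≤-trans (ℕₚ.≤-trans (ℕₚ.≤-reflexive (sym (Subsetₚ.∣⁅x⁆∣≡1 i)))
      (Subsetₚ.p⊆q⇒∣p∣≤∣q∣ {p = ⁅ i ⁆} λ x∈ → subst (_∈ˢ X) (sym (Subsetₚ.x∈⁅y⁆⇒x≡y i x∈)) (proj₁ (x∈p∩q⁻ X X i∈))))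
      (proj₁ (isKernel X∈))

    covered-by-rest : kernels ≡ [] → length F ≤ length rest
    covered-by-rest eq = length-⊆ u λ A∈ → case covers A∈ of λ
      { (inj₁ A∈rest) → A∈rest ; (inj₂ (X , X∈ , _)) → case subst (X ∈_) eq X∈ of λ () }

    someKernel : ∀ ks → kernels ≡ ks → ∃[ X ] (X ∈ kernels)
    someKernel (X ∷ _) eq = X , subst (X ∈_) (sym eq) (here refl)
    -- Without kernels the rest would contain `F`, although it is at most a quarter of it.
    someKernel [] eq = case ℕₚ.≤-trans 1≤F (ℕₚ.+-cancelʳ-≤ (length rest) _ _ (begin
      length F + length rest  ≤⟨ ℕₚ.+-monoˡ-≤ (length rest) (covered-by-rest eq) ⟩
      length rest + length rest ≤⟨ ℕₚ.+-monoʳ-≤ (length rest) (ℕₚ.m≤m+n _ _) ⟩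
      length rest + (length rest + (length rest + (length rest + 0))) ≤⟨ 4rest≤ ⟩
      length F                ≤⟨ covered-by-rest eq ⟩
      length rest             ∎)) of λ ()

    result : ∃[ e ] (length (missing e F) * r ^ q ≤ length 𝓤)
    result with someKernel kernels refl
    ... | X₁ , X₁∈ with any? (λ e → (e ∈? X₁) ×-dec All.all? (e ∈?_) kernels)
    ... | yes (e , _ , all) = e , star e all
    ... | no none = case ℕₚ.≤-trans 1≤F (scattered X₁∈ (λ e e∈ all → none (e , e∈ , all)) (nonempty⇒1≤q X₁∈)) of λ ()

-- Partitions and transpositions

⟦⟧-cong : {P Q : Set} (d : Dec P) (e : Dec Q) → (P → Q) → (Q → P) → ⟦ d ⟧ ≡ ⟦ e ⟧
⟦⟧-cong d e f g = ℕₚ.≤-antisym (⟦⟧-mono d e f) (⟦⟧-mono e d g)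

module _ {n : ℕ} {Q : Fin n → Set} (d : ∀ i → Dec (Q i)) where

  ∈-tabulate⁺ : ∀ {i} → Q i → i ∈ˢ Vec.tabulate (λ j → ⌊ d j ⌋)
  ∈-tabulate⁺ {i} q with d i in eq
  ... | yes _ = lookup⇒[]= i _ (trans (lookup∘tabulate _ i) (cong ⌊_⌋ eq))
  ... | no ¬q = ⊥-elim (¬q q)

  ∈-tabulate⁻ : ∀ {i} → i ∈ˢ Vec.tabulate (λ j → ⌊ d j ⌋) → Q i
  ∈-tabulate⁻ {i} i∈ with d i in eq
  ... | yes q = q
  ... | no _  = case trans (sym ([]=⇒lookup i∈)) (trans (lookup∘tabulate _ i) (cong ⌊_⌋ eq)) of λ ()

  ∣tabulate∣ : ∣ Vec.tabulate (λ j → ⌊ d j ⌋) ∣ ≡ ∑ (allFin n) (λ i → ⟦ d i ⟧)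
  ∣tabulate∣ = trans (∣∣-∑ (Vec.tabulate (λ j → ⌊ d j ⌋)))
    (∑-cong (allFin n) λ {i} _ → ⟦⟧-cong (i ∈? Vec.tabulate (λ j → ⌊ d j ⌋)) (d i) ∈-tabulate⁻ ∈-tabulate⁺)

transpose-left : ∀ {n} (i j : Fin n) → transpose i j i ≡ j
transpose-left i j rewrite dec-true (i ≟ i) refl = refl

transpose-right : ∀ {n} (i j : Fin n) → transpose i j j ≡ i
transpose-right i j with j ≟ i
... | yes refl = refl
... | no _ rewrite dec-true (j ≟ j) refl = refl

transpose-fixed : ∀ {n} (i j : Fin n) {x} → x ≢ i → x ≢ j → transpose i j x ≡ x
transpose-fixed i j {x} x≢i x≢j rewrite dec-false (x ≟ i) x≢i | dec-false (x ≟ j) x≢j = refl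

transpose-involutive : ∀ {n} (i j x : Fin n) → transpose i j (transpose i j x) ≡ x
transpose-involutive i j x = go (x ≟ i) (x ≟ j)
  where
  go : Dec (x ≡ i) → Dec (x ≡ j) → transpose i j (transpose i j x) ≡ x
  go (yes refl) _          = trans (cong (transpose i j) (transpose-left i j)) (transpose-right i j)
  go (no _)     (yes refl) = trans (cong (transpose i j) (transpose-right i j)) (transpose-left i j)
  go (no x≢i)   (no x≢j)   = trans (cong (transpose i j) (transpose-fixed i j x≢i x≢j)) (transpose-fixed i j x≢i x≢j)

_≟ᴾ_ : ∀ {n} (A B : Partition n) → Dec (A ≡ B)
_≟ᴾ_ = Vecₚ.≡-dec (Vecₚ.≡-dec Data.Bool._≟_)

-- For an involution `τ` this relabels the points: the matrix induced by `f` becomes the one induced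
-- by `f ∘ τ`.
act : ∀ {n} → (Fin n → Fin n) → Partition n → Partition n
act τ B = Vec.tabulate λ x → Vec.tabulate λ y → lookup (lookup B (τ x)) (τ y)

lookup-act : ∀ {n} (τ : Fin n → Fin n) B x y → lookup (lookup (act τ B) x) y ≡ lookup (lookup B (τ x)) (τ y)
lookup-act τ B x y = trans (cong (λ row → lookup row y) (lookup∘tabulate _ x)) (lookup∘tabulate _ y)

module _ {n : ℕ} (τ : Fin n → Fin n) (B : Partition n) {x y : Fin n} where

  act⁺ : τ y ∈ˢ lookup B (τ x) → y ∈ˢ lookup (act τ B) x
  act⁺ y∈ = lookup⇒[]= y _ (trans (lookup-act τ B x y) ([]=⇒lookup y∈))

  act⁻ : y ∈ˢ lookup (act τ B) x → τ y ∈ˢ lookup B (τ x)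
  act⁻ y∈ = lookup⇒[]= (τ y) _ (trans (sym (lookup-act τ B x y)) ([]=⇒lookup y∈))

act-involutive : ∀ {n} {τ : Fin n → Fin n} → (∀ x → τ (τ x) ≡ x) → ∀ B → act τ (act τ B) ≡ B
act-involutive {n} {τ} ττ B = trans
  (tabulate-cong λ x → trans
    (tabulate-cong λ y → trans (lookup-act τ B (τ x) (τ y)) (cong₂ (λ a b → lookup (lookup B a) b) (ττ x) (ττ y)))
    (tabulate∘lookup (lookup B x)))
  (tabulate∘lookup B)

module _ {n ℓ : ℕ} (f : Fin n → Fin ℓ) where

  private
    row : ∀ x → lookup (induced f) x ≡ Vec.tabulate (λ y → ⌊ f x ≟ f y ⌋)
    row x = lookup∘tabulate _ x

  induced⁺ : ∀ {x y} → f x ≡ f y → y ∈ˢ lookup (induced f) x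
  induced⁺ {x} eq = subst (_ ∈ˢ_) (sym (row x)) (∈-tabulate⁺ (λ y → f x ≟ f y) eq)

  induced⁻ : ∀ {x y} → y ∈ˢ lookup (induced f) x → f x ≡ f y
  induced⁻ {x} y∈ = ∈-tabulate⁻ (λ y → f x ≟ f y) (subst (_ ∈ˢ_) (row x) y∈)

  ∣induced-row∣ : ∀ x → ∣ lookup (induced f) x ∣ ≡ ∣ Vec.tabulate (λ y → ⌊ f y ≟ f x ⌋) ∣
  ∣induced-row∣ x = trans (cong ∣_∣ (row x)) (trans (∣tabulate∣ (λ y → f x ≟ f y))
    (trans (∑-cong (allFin n) λ {y} _ → ⟦⟧-cong (f x ≟ f y) (f y ≟ f x) sym sym)
      (sym (∣tabulate∣ (λ y → f y ≟ f x)))))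

∑-lookup : ∀ (xs : List A) φ → ∑ (allFin (length xs)) (λ i → φ (Data.List.lookup xs i)) ≡ ∑ xs φ
∑-lookup []       φ = refl
∑-lookup (x ∷ xs) φ = trans (∑-allFin-suc (length xs) (λ i → φ (Data.List.lookup (x ∷ xs) i))) (cong (φ x +_) (∑-lookup xs φ))

lookup-injective : ∀ {xs : List A} → Unique xs → ∀ i j → Data.List.lookup xs i ≡ Data.List.lookup xs j → i ≡ j
lookup-injective (_ ∷ _)  zero    zero    eq = refl
lookup-injective (x∉ ∷ _) zero    (suc j) eq = ⊥-elim (All.lookup x∉ (∈ₚ.∈-lookup j) eq)
lookup-injective (x∉ ∷ _) (suc i) zero    eq = ⊥-elim (All.lookup x∉ (∈ₚ.∈-lookup i) (sym eq))
lookup-injective (_ ∷ u)  (suc i) (suc j) eq = cong suc (lookup-injective u i j eq)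

module Profile {ℓ : ℕ} (P : Vec ℕ ℓ) where

  n : ℕ
  n = sum P

  ∼-refl : ∀ {B} → InU P B → ∀ x → x ∈ˢ lookup B x
  ∼-refl (f , _ , refl) x = induced⁺ f refl

  ∼-sym : ∀ {B} → InU P B → ∀ {x y} → y ∈ˢ lookup B x → x ∈ˢ lookup B y
  ∼-sym (f , _ , refl) y∈ = induced⁺ f (sym (induced⁻ f y∈))

  ∼-trans : ∀ {B} → InU P B → ∀ {x y z} → y ∈ˢ lookup B x → z ∈ˢ lookup B y → z ∈ˢ lookup B x
  ∼-trans (f , _ , refl) y∈ z∈ = induced⁺ f (trans (induced⁻ f y∈) (induced⁻ f z∈))

  row-size : ∀ {B} → InU P B → ∀ {k} → (∀ i → lookup P i ≤ k) → ∀ x → ∣ lookup B x ∣ ≤ k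
  row-size (f , sizes , refl) P≤k x =
    ℕₚ.≤-trans (ℕₚ.≤-reflexive (trans (∣induced-row∣ f x) (sizes (f x)))) (P≤k (f x))

  large-row : ∀ {B} → InU P B → ∀ i → 1 ≤ lookup P i → ∃[ x ] (∣ lookup B x ∣ ≡ lookup P i)
  large-row (f , sizes , refl) i 1≤ with nonempty? (Vec.tabulate (λ j → ⌊ f j ≟ i ⌋))
  ... | yes (x , x∈) = x , trans (∣induced-row∣ f x)
    (trans (cong (λ z → ∣ Vec.tabulate (λ y → ⌊ f y ≟ z ⌋) ∣) (∈-tabulate⁻ (λ j → f j ≟ i) x∈)) (sizes i))
  ... | no empty = case subst (1 ≤_) (trans (sym (sizes i)) (trans (cong ∣_∣ (Subsetₚ.Empty-unique empty)) (Subsetₚ.∣⊥∣≡0 n))) 1≤ of λ ()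

  act-InU : ∀ {B} → InU P B → ∀ {τ} → (∀ x → τ (τ x) ≡ x) → InU P (act τ B)
  act-InU (f , sizes , refl) {τ} ττ = f ∘ τ , sizes′ , tabulate-cong λ x → tabulate-cong λ y →
    trans (cong (λ row → lookup row (τ y)) (lookup∘tabulate _ (τ x))) (lookup∘tabulate _ (τ y))
    where
    sizes′ : ∀ i → ∣ Vec.tabulate (λ j → ⌊ f (τ j) ≟ i ⌋) ∣ ≡ lookup P i
    sizes′ i = trans (∣tabulate∣ (λ j → f (τ j) ≟ i)) (trans
      (∑-involution {xs = allFin n} τ (λ j → ⟦ f j ≟ i ⟧) (allFin⁺ n) (λ _ → ∈-allFin _) (λ {x} _ → ττ x))
      (trans (sym (∣tabulate∣ (λ j → f j ≟ i))) (sizes i)))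

  private
    Labelling : Set
    Labelling = Vec (Fin ℓ) n

    fits? : ∀ (w : Labelling) → Dec (∀ i → ∣ Vec.tabulate (λ j → ⌊ lookup w j ≟ i ⌋) ∣ ≡ lookup P i)
    fits? w = Finₚ.all? λ i → _ ℕₚ.≟ _

  -- Parts of equal size may exchange labels, so several labellings induce one matrix. Removing
  -- repetitions makes the length the true number of partitions.
  partitions : List (Partition n)
  partitions = deduplicate _≟ᴾ_ (map (induced ∘ lookup) (filter fits? (vecs (allFin ℓ) n)))

  partitions-unique : Unique partitions
  partitions-unique = deduplicate-! _≟ᴾ_ _

  ∈-partitions⁻ : ∀ {B} → B ∈ partitions → InU P B
  ∈-partitions⁻ B∈ with ∈-map⁻ _ (∈ₚ.∈-deduplicate⁻ _≟ᴾ_ _ B∈)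
  ... | w , w∈ , refl = lookup w , proj₂ (∈-filter⁻ fits? {xs = vecs (allFin ℓ) n} w∈) , refl

  ∈-partitions⁺ : ∀ {B} → InU P B → B ∈ partitions
  ∈-partitions⁺ (f , sizes , refl) = ∈ₚ.∈-deduplicate⁺ _≟ᴾ_ (subst (_∈ _) same
    (∈-map⁺ (induced ∘ lookup) (∈-filter⁺ fits? (∈-vecs ∈-allFin (Vec.tabulate f)) fits)))
    where
    f≗ : ∀ j → lookup (Vec.tabulate f) j ≡ f j
    f≗ = lookup∘tabulate f
    same : induced (lookup (Vec.tabulate f)) ≡ induced f
    same = tabulate-cong λ x → tabulate-cong λ y → cong₂ (λ a b → ⌊ a ≟ b ⌋) (f≗ x) (f≗ y)
    fits : ∀ i → ∣ Vec.tabulate (λ j → ⌊ lookup (Vec.tabulate f) j ≟ i ⌋) ∣ ≡ lookup P i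
    fits i = trans (cong ∣_∣ (tabulate-cong λ j → cong (λ a → ⌊ a ≟ i ⌋) (f≗ j))) (sizes i)

  ∑-act : ∀ {τ} → (∀ x → τ (τ x) ≡ x) → ∀ φ → ∑ partitions (φ ∘ act τ) ≡ ∑ partitions φ
  ∑-act {τ} ττ φ = ∑-involution (act τ) φ partitions-unique
    (λ B∈ → ∈-partitions⁺ (act-InU (∈-partitions⁻ B∈) ττ)) (λ {B} _ → act-involutive ττ B)

-- Counting partitions by swapping points

elements : ∀ {n} → Subset n → List (Fin n)
elements p = filter (_∈? p) (allFin _)

∈-elements : ∀ {n} {p : Subset n} {x} → x ∈ˢ p → x ∈ elements p
∈-elements {p = p} {x} x∈ = ∈-filter⁺ (_∈? p) (∈-allFin x) x∈

length-elements : ∀ {n} (p : Subset n) → length (elements p) ≡ ∣ p ∣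
length-elements p = trans (length-filter (_∈? p) (allFin _)) (sym (∣∣-∑ p))

∃-other : ∀ {n} (p : Subset n) → 2 ≤ ∣ p ∣ → ∀ y → ∃[ z ] (z ∈ˢ p × z ≢ y)
∃-other p 2≤ y with any? (λ z → (z ∈? p) ×-dec ¬? (z ≟ y))
... | yes r = r
... | no none = case ℕₚ.≤-trans 2≤ (ℕₚ.≤-trans (Subsetₚ.p⊆q⇒∣p∣≤∣q∣ {q = ⁅ y ⁆} p⊆) (ℕₚ.≤-reflexive (Subsetₚ.∣⁅x⁆∣≡1 y))) of λ { (s≤s ()) }
  where
  p⊆ : p ⊆ˢ ⁅ y ⁆
  p⊆ {z} z∈ with z ≟ y
  ... | yes refl = Subsetₚ.x∈⁅x⁆ y
  ... | no z≢y   = ⊥-elim (none (z , z∈ , z≢y))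

∃-difference : ∀ {n} (p q : Subset n) → ∣ p ∣ ≡ ∣ q ∣ → p ≢ q → ∃[ y ] (y ∈ˢ q × y ∉ˢ p)
∃-difference p q eq p≢q with any? (λ y → (y ∈? q) ×-dec ¬? (y ∈? p)) | any? (λ y → (y ∈? p) ×-dec ¬? (y ∈? q))
... | yes r | _ = r
... | no none | yes (x , x∈ , x∉) = ⊥-elim (ℕₚ.<-irrefl (sym eq) (Subsetₚ.p⊂q⇒∣p∣<∣q∣ (q⊆p , x , x∈ , x∉)))
  where
  q⊆p : q ⊆ˢ p
  q⊆p {y} y∈ with y ∈? p
  ... | yes y∈p = y∈p
  ... | no y∉p  = ⊥-elim (none (y , y∈ , y∉p))
... | no none | no none′ = ⊥-elim (p≢q (Subsetₚ.⊆-antisym p⊆q q⊆p))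
  where
  q⊆p : q ⊆ˢ p
  q⊆p {y} y∈ with y ∈? p
  ... | yes y∈p = y∈p
  ... | no y∉p  = ⊥-elim (none (y , y∈ , y∉p))
  p⊆q : p ⊆ˢ q
  p⊆q {y} y∈ with y ∈? q
  ... | yes y∈q = y∈q
  ... | no y∉q  = ⊥-elim (none′ (y , y∈ , y∉q))

_∈ᴸ?_ : ∀ {n} (y : Fin n) S → Dec (y ∈ S)
y ∈ᴸ? S = Any.any? (y ≟_) S

count-outside : ∀ {n} (S : List (Fin n)) {a} → a + length S ≤ n → a ≤ ∑ (allFin n) (λ y → ⟦ ¬? (y ∈ᴸ? S) ⟧)
count-outside {n} S {a} le = ℕₚ.+-cancelʳ-≤ (length S) _ _ (begin
  a + length S                              ≤⟨ le ⟩
  n                                         ≡⟨ length-allFin n ⟨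
  length (allFin n)                         ≡⟨ length-filter-split (_∈ᴸ? S) (λ y → ¬? (y ∈ᴸ? S)) (allFin n) ⟨
  length (filter (_∈ᴸ? S) (allFin n)) + out ≤⟨ ℕₚ.+-monoˡ-≤ out (length-⊆ (Unique.filter⁺ (_∈ᴸ? S) (allFin⁺ n))
                                                 λ y∈ → proj₂ (∈-filter⁻ (_∈ᴸ? S) {xs = allFin n} y∈)) ⟩
  length S + out                            ≡⟨ ℕₚ.+-comm (length S) out ⟩
  out + length S                            ≡⟨ cong (_+ length S) (length-filter (λ y → ¬? (y ∈ᴸ? S)) (allFin n)) ⟩
  ∑ (allFin n) (λ y → ⟦ ¬? (y ∈ᴸ? S) ⟧) + length S ∎)
  where
  open ≤-Reasoning
  out : ℕ
  out = length (filter (λ y → ¬? (y ∈ᴸ? S)) (allFin n))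

module Counting {ℓ : ℕ} (P : Vec ℕ ℓ) (k t : ℕ) (P≤k : ∀ i → lookup P i ≤ k) (1≤k : 1 ≤ k) (2≤t : 2 ≤ t) where

  open Profile P public

  -- The swap y ↔ y′ turns "y shares its part with z" into "y′ shares its part with z", and z has fewer than k
  -- partners while y′ ranges over at least a points.
  swap-count : ∀ {Φ : Partition n → Set} (Φ? : Decidable Φ) {y z} S {a} → z ∈ S → y ≢ z → a + length S ≤ n →
    (∀ {B y′} → B ∈ partitions → y′ ∉ S → Φ B → Φ (act (transpose y y′) B)) →
    ∑ partitions (λ B → ⟦ Φ? B ⟧ * ⟦ z ∈? lookup B y ⟧) * a ≤ ∑ partitions (λ B → ⟦ Φ? B ⟧) * k
  swap-count {Φ} Φ? {y} {z} S {a} z∈S y≢z le invariant = begin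
    b * a                                                   ≤⟨ ℕₚ.*-monoʳ-≤ b (count-outside S le) ⟩
    b * ∑ ys (λ y′ → ⟦ ¬? (y′ ∈ᴸ? S) ⟧)                     ≡⟨ trans (ℕₚ.*-comm b _) (sym (∑-*ʳ ys _ b)) ⟩
    ∑ ys (λ y′ → ⟦ ¬? (y′ ∈ᴸ? S) ⟧ * b)                     ≤⟨ ∑-mono ys (λ {y′} _ → ⟦⟧-*-≤ (¬? (y′ ∈ᴸ? S)) moved) ⟩
    ∑ ys (λ y′ → ∑ 𝓤 (λ B → ⟦ Φ? B ⟧ * ⟦ z ∈? lookup B y′ ⟧)) ≡⟨ ∑-swap 𝓤 ys _ ⟨
    ∑ 𝓤 (λ B → ∑ ys (λ y′ → ⟦ Φ? B ⟧ * ⟦ z ∈? lookup B y′ ⟧)) ≤⟨ ∑-mono 𝓤 (λ {B} B∈ → partners B∈) ⟩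
    ∑ 𝓤 (λ B → ⟦ Φ? B ⟧ * k)                                ≡⟨ ∑-*ʳ 𝓤 _ k ⟩
    ∑ 𝓤 (λ B → ⟦ Φ? B ⟧) * k                                ∎
    where
    open ≤-Reasoning
    𝓤 : List (Partition n)
    𝓤 = partitions
    ys : List (Fin n)
    ys = allFin n
    b : ℕ
    b = ∑ 𝓤 (λ B → ⟦ Φ? B ⟧ * ⟦ z ∈? lookup B y ⟧)
    moved : ∀ {y′} → y′ ∉ S → b ≤ ∑ 𝓤 (λ B → ⟦ Φ? B ⟧ * ⟦ z ∈? lookup B y′ ⟧)
    moved {y′} y′∉ = begin
      b
        ≤⟨ ∑-mono 𝓤 (λ {B} B∈ → ⟦⟧-*-≤ (Φ? B) λ φ → ⟦⟧-≤ (z ∈? lookup B y) λ z∈ →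
             ℕₚ.*-mono-≤ (⟦⟧-1≤ (Φ? (act τ B)) (invariant B∈ y′∉ φ)) (⟦⟧-1≤ (z ∈? lookup (act τ B) y′)
               (act⁺ τ B (subst₂ (λ a b → b ∈ˢ lookup B a) (sym (transpose-right y y′)) (sym τz) z∈)))) ⟩
      ∑ 𝓤 (λ B → ⟦ Φ? (act τ B) ⟧ * ⟦ z ∈? lookup (act τ B) y′ ⟧)
        ≡⟨ ∑-act (transpose-involutive y y′) (λ B → ⟦ Φ? B ⟧ * ⟦ z ∈? lookup B y′ ⟧) ⟩
      ∑ 𝓤 (λ B → ⟦ Φ? B ⟧ * ⟦ z ∈? lookup B y′ ⟧) ∎
      where
      τ : Fin n → Fin n
      τ = transpose y y′
      τz : τ z ≡ z
      τz = transpose-fixed y y′ (y≢z ∘ sym) λ { refl → y′∉ z∈S }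
    partners : ∀ {B} → B ∈ 𝓤 → ∑ ys (λ y′ → ⟦ Φ? B ⟧ * ⟦ z ∈? lookup B y′ ⟧) ≤ ⟦ Φ? B ⟧ * k
    partners {B} B∈ = begin
      ∑ ys (λ y′ → ⟦ Φ? B ⟧ * ⟦ z ∈? lookup B y′ ⟧)  ≡⟨ ∑-*ˡ ys _ ⟦ Φ? B ⟧ ⟩
      ⟦ Φ? B ⟧ * ∑ ys (λ y′ → ⟦ z ∈? lookup B y′ ⟧)  ≤⟨ ℕₚ.*-monoʳ-≤ ⟦ Φ? B ⟧ (begin
        ∑ ys (λ y′ → ⟦ z ∈? lookup B y′ ⟧)           ≤⟨ ∑-mono ys (λ {y′} _ → ⟦⟧-mono (z ∈? lookup B y′) (y′ ∈? lookup B z) (∼-sym (∈-partitions⁻ B∈))) ⟩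
        ∑ ys (λ y′ → ⟦ y′ ∈? lookup B z ⟧)           ≡⟨ ∣∣-∑ (lookup B z) ⟨
        ∣ lookup B z ∣                               ≤⟨ row-size (∈-partitions⁻ B∈) P≤k z ⟩
        k                                            ∎) ⟩
      ⟦ Φ? B ⟧ * k                                   ∎

  tSets : List (Subset n)
  tSets = filter (λ p → ∣ p ∣ ℕₚ.≟ t) (subsets n)

  v : ℕ
  v = length tSets

  T : Fin v → Subset n
  T = Data.List.lookup tSets

  ∣T∣ : ∀ e → ∣ T e ∣ ≡ t
  ∣T∣ e = proj₂ (∈-filter⁻ (λ p → ∣ p ∣ ℕₚ.≟ t) {xs = subsets n} (∈ₚ.∈-lookup e))

  T-surjective : ∀ p → ∣ p ∣ ≡ t → ∃[ e ] (T e ≡ p)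
  T-surjective p eq = Any.index p∈ , sym (lookup-index p∈)
    where
    p∈ : p ∈ tSets
    p∈ = ∈-filter⁺ (λ p → ∣ p ∣ ℕₚ.≟ t) (∈-subsets p) eq

  T-injective : ∀ {e e′} → T e ≡ T e′ → e ≡ e′
  T-injective = lookup-injective (Unique.filter⁺ _ (subsets-unique n)) _ _

  contains? : ∀ (B : Partition n) e → Dec (∃[ x ] (T e ⊆ˢ lookup B x))
  contains? B e = any? λ x → T e ⊆? lookup B x

  E : Partition n → Subset v
  E B = Vec.tabulate λ e → ⌊ contains? B e ⌋

  E⁺ : ∀ B {e} → ∃[ x ] (T e ⊆ˢ lookup B x) → e ∈ˢ E B
  E⁺ B = ∈-tabulate⁺ (contains? B)

  E⁻ : ∀ B {e} → e ∈ˢ E B → ∃[ x ] (T e ⊆ˢ lookup B x)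
  E⁻ B = ∈-tabulate⁻ (contains? B)

  E-together : ∀ {B} → B ∈ partitions → ∀ {e y z} → e ∈ˢ E B → y ∈ˢ T e → z ∈ˢ T e → z ∈ˢ lookup B y
  E-together {B} B∈ e∈ y∈ z∈ with E⁻ B e∈
  ... | x , T⊆ = ∼-trans (∈-partitions⁻ B∈) (∼-sym (∈-partitions⁻ B∈) (T⊆ y∈)) (T⊆ z∈)

  E-transpose : ∀ {B e y y′} → y ∉ˢ T e → y′ ∉ˢ T e → e ∈ˢ E B → e ∈ˢ E (act (transpose y y′) B)
  E-transpose {B} {e} {y} {y′} y∉ y′∉ e∈ with E⁻ B e∈
  ... | x , T⊆ = E⁺ (act τ B) (τ x , λ {w} w∈ → act⁺ τ B (subst₂ (λ a b → b ∈ˢ lookup B a)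
      (sym (transpose-involutive y y′ x))
      (sym (transpose-fixed y y′ (λ { refl → y∉ w∈ }) (λ { refl → y′∉ w∈ }))) (T⊆ w∈)))
    where
    τ : Fin n → Fin n
    τ = transpose y y′

  private
    𝓤 : List (Partition n)
    𝓤 = partitions

  star : Fin v → ℕ
  star e = ∑ 𝓤 (λ B → ⟦ e ∈? E B ⟧)

  -- Take `y` in `T e′` outside `T e`, and another point `z` of `T e′`. Containing `T e′` forces `y`
  -- and `z` together, and swapping `y` with a point outside `T e` and different from `z` does not
  -- disturb `T e`. These t + 1 forbidden points are the `suc t`.
  pair≤star : ∀ {a} e e′ → e ≢ e′ → a + suc t ≤ n →
    ∑ 𝓤 (λ B → ⟦ e ∈? E B ⟧ * ⟦ e′ ∈? E B ⟧) * a ≤ star e * k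
  pair≤star {a} e e′ e≢ le =
    let y , y∈ , y∉ = ∃-difference (T e) (T e′) (trans (∣T∣ e) (sym (∣T∣ e′))) (e≢ ∘ T-injective)
        z , z∈ , z≢y = ∃-other (T e′) (subst (2 ≤_) (sym (∣T∣ e′)) 2≤t) y
        S = z ∷ elements (T e)
    in ℕₚ.≤-trans
      (ℕₚ.*-monoˡ-≤ a (∑-mono 𝓤 λ {B} B∈ → ℕₚ.*-monoʳ-≤ ⟦ e ∈? E B ⟧
        (⟦⟧-mono (e′ ∈? E B) (z ∈? lookup B y) λ e′∈ → E-together B∈ e′∈ y∈ z∈)))
      (swap-count (λ B → e ∈? E B) {y} {z} S (here refl) (z≢y ∘ sym)
        (subst (λ s → a + suc s ≤ n) (sym (trans (length-elements (T e)) (∣T∣ e))) le)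
        (λ {B} B∈ y′∉ e∈ → E-transpose {B} y∉ (λ y′∈ → y′∉ (there (∈-elements y′∈))) e∈))

  -- Each t-set of `X` lies in the row of `B` at one of the points in `S`, and a row has at most
  -- `2 ^ k` subsets.
  covered-size : ∀ {B} → B ∈ partitions → ∀ X S → X ⊆ˢ E B → (∀ {e} → e ∈ˢ X → ∃[ x ] (x ∈ S × x ∈ˢ T e)) →
    ∣ X ∣ ≤ length S * 2 ^ k
  covered-size {B} B∈ X S X⊆ meets = begin
    ∣ X ∣                                                  ≡⟨ ∣∣-∑ X ⟩
    ∑ (allFin v) (λ e → ⟦ e ∈? X ⟧)                        ≤⟨ ∑-mono (allFin v) (λ {e} _ → ⟦⟧-≤ (e ∈? X) λ e∈ → hit e∈) ⟩
    ∑ (allFin v) (λ e → ∑ S (λ x → ⟦ T e ⊆? lookup B x ⟧)) ≡⟨ ∑-swap (allFin v) S _ ⟩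
    ∑ S (λ x → ∑ (allFin v) (λ e → ⟦ T e ⊆? lookup B x ⟧)) ≤⟨ ∑-bound S (λ {x} _ → inRow x) ⟩
    length S * 2 ^ k                                       ∎
    where
    open ≤-Reasoning
    hit : ∀ {e} → e ∈ˢ X → 1 ≤ ∑ S (λ x → ⟦ T e ⊆? lookup B x ⟧)
    hit {e} e∈ = let x , x∈S , x∈T = meets e∈ in
      ℕₚ.≤-trans (⟦⟧-1≤ (T e ⊆? lookup B x) (E-together B∈ (X⊆ e∈) x∈T)) (∑-term (λ x → ⟦ T e ⊆? lookup B x ⟧) x∈S)
    inRow : ∀ x → ∑ (allFin v) (λ e → ⟦ T e ⊆? lookup B x ⟧) ≤ 2 ^ k
    inRow x = begin
      ∑ (allFin v) (λ e → ⟦ T e ⊆? lookup B x ⟧) ≡⟨ ∑-lookup tSets (λ p → ⟦ p ⊆? lookup B x ⟧) ⟩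
      ∑ tSets (λ p → ⟦ p ⊆? lookup B x ⟧)        ≡⟨ ∑-filter (λ p → ∣ p ∣ ℕₚ.≟ t) (subsets n) _ ⟩
      ∑ (subsets n) (λ p → ⟦ ∣ p ∣ ℕₚ.≟ t ⟧ * ⟦ p ⊆? lookup B x ⟧) ≤⟨ ∑-mono (subsets n) (λ {p} _ → ⟦⟧-*-≤ (∣ p ∣ ℕₚ.≟ t) λ _ → ℕₚ.≤-refl) ⟩
      ∑ (subsets n) (λ p → ⟦ p ⊆? lookup B x ⟧)  ≤⟨ ∑-powerset (lookup B x) ⟩
      2 ^ ∣ lookup B x ∣                         ≤⟨ ℕₚ.^-monoʳ-≤ 2 (row-size (∈-partitions⁻ B∈) P≤k x) ⟩
      2 ^ k                                      ∎

  T-nonempty : ∀ e → ∃[ x ] (x ∈ˢ T e)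
  T-nonempty e with nonempty? (T e)
  ... | yes ne = ne
  ... | no empty = case subst (2 ≤_) (trans (sym (∣T∣ e)) (trans (cong ∣_∣ (Subsetₚ.Empty-unique empty)) (Subsetₚ.∣⊥∣≡0 n))) 2≤t of λ ()

  E-size : ∀ {B} → B ∈ partitions → ∀ X → X ⊆ˢ E B → ∣ X ∣ ≤ n * 2 ^ k
  E-size B∈ X X⊆ = ℕₚ.≤-trans
    (covered-size B∈ X (allFin n) X⊆ λ {e} _ → let x , x∈ = T-nonempty e in x , ∈-allFin x , x∈)
    (ℕₚ.≤-reflexive (cong (_* 2 ^ k) (length-allFin n)))

  -- A list of conditions "y and z share a part". As each y is new, it can still be swapped with almost any point, so
  -- every condition divides the number of partitions by at least Q.

  Conditions : Set
  Conditions = List (Fin n × Fin n)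

  points : Conditions → List (Fin n)
  points []             = []
  points ((y , z) ∷ cs) = y ∷ z ∷ points cs

  length-points : ∀ cs → length (points cs) ≡ 2 * length cs
  length-points []       = refl
  length-points (_ ∷ cs) = trans (cong (λ m → suc (suc m)) (length-points cs)) (sym (ℕₚ.*-suc 2 (length cs)))

  Satisfies : Conditions → Partition n → Set
  Satisfies cs B = All (λ (y , z) → z ∈ˢ lookup B y) cs

  satisfies? : ∀ cs → Decidable (Satisfies cs)
  satisfies? cs B = All.all? (λ (y , z) → z ∈? lookup B y) cs

  -- Only `y` must be new, since swaps move `y` and keep `z` in place; `z` may repeat. The bound
  -- `4 * length cs ≤ n` keeps the points in use, two per condition, within half of all points.
  data Fresh : Conditions → Set where
    []  : Fresh []
    _∷_ : ∀ {y z cs} → y ∉ points cs × y ≢ z × 4 * length cs ≤ n → Fresh cs → Fresh ((y , z) ∷ cs)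

  satisfies-transpose : ∀ {cs B y y′} → y ∉ points cs → y′ ∉ points cs →
    Satisfies cs B → Satisfies cs (act (transpose y y′) B)
  satisfies-transpose {[]} y∉ y′∉ [] = []
  satisfies-transpose {(a , b) ∷ cs} {B} {y} {y′} y∉ y′∉ (b∈ ∷ sat) =
    act⁺ (transpose y y′) B (subst₂ (λ a b → b ∈ˢ lookup B a)
      (sym (transpose-fixed y y′ (λ { refl → y∉ (here refl) }) (λ { refl → y′∉ (here refl) })))
      (sym (transpose-fixed y y′ (λ { refl → y∉ (there (here refl)) }) (λ { refl → y′∉ (there (here refl)) }))) b∈)
    ∷ satisfies-transpose {cs} {B} (y∉ ∘ there ∘ there) (y′∉ ∘ there ∘ there) sat

  module _ (Q : ℕ) (Q-small : 2 * (k * Q) + 2 ≤ n) where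

    -- `swap-count` with `a = k * Q` gives the factor `Q` for each condition. The required room
    -- splits evenly: `Q-small` covers `k * Q + 1` points by half of n, and freshness covers the
    -- points in use by the other half.
    chain-count : ∀ {cs} → Fresh cs → ∑ 𝓤 (λ B → ⟦ satisfies? cs B ⟧) * Q ^ length cs ≤ length 𝓤
    chain-count [] = ℕₚ.≤-trans (ℕₚ.≤-reflexive (ℕₚ.*-identityʳ _))
      (ℕₚ.≤-trans (∑-bound 𝓤 λ {B} _ → ⟦⟧-≤1 (satisfies? [] B)) (ℕₚ.≤-reflexive (ℕₚ.*-identityʳ _)))
    chain-count {(y , z) ∷ cs} ((y∉ , y≢z , 4j≤n) ∷ fresh) = begin
      N′ * (Q * Q ^ j)        ≡⟨ ℕₚ.*-assoc N′ Q _ ⟨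
      N′ * Q * Q ^ j          ≤⟨ ℕₚ.*-monoˡ-≤ (Q ^ j) step ⟩
      N * Q ^ j               ≤⟨ chain-count fresh ⟩
      length 𝓤                ∎
      where
      open ≤-Reasoning
      j N N′ : ℕ
      j  = length cs
      N  = ∑ 𝓤 (λ B → ⟦ satisfies? cs B ⟧)
      N′ = ∑ 𝓤 (λ B → ⟦ satisfies? ((y , z) ∷ cs) B ⟧)
      room : k * Q + length (z ∷ points cs) ≤ n
      room = ℕₚ.*-cancelˡ-≤ 2 (begin
        2 * (k * Q + suc (length (points cs)))   ≡⟨ cong (λ z → 2 * (k * Q + suc z)) (length-points cs) ⟩
        2 * (k * Q + suc (2 * j))                ≡⟨ l (k * Q) j ⟩
        2 * (k * Q) + 2 + 4 * j                  ≤⟨ ℕₚ.+-mono-≤ Q-small 4j≤n ⟩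
        n + n                                    ≡⟨ cong (n +_) (ℕₚ.+-identityʳ n) ⟨
        2 * n                                    ∎)
        where
        l : ∀ a j → 2 * (a + suc (2 * j)) ≡ 2 * a + 2 + 4 * j
        l = solve-∀
      split : ∀ {B} → Satisfies ((y , z) ∷ cs) B → 1 ≤ ⟦ satisfies? cs B ⟧ * ⟦ z ∈? lookup B y ⟧
      split {B} (z∈ ∷ sat) = ℕₚ.*-mono-≤ (⟦⟧-1≤ (satisfies? cs B) sat) (⟦⟧-1≤ (z ∈? lookup B y) z∈)
      step : N′ * Q ≤ N
      step = ℕₚ.*-cancelʳ-≤ _ _ k {{>-nonZero 1≤k}} (begin
        N′ * Q * k            ≡⟨ trans (ℕₚ.*-assoc N′ Q k) (cong (N′ *_) (ℕₚ.*-comm Q k)) ⟩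
        N′ * (k * Q)          ≤⟨ ℕₚ.*-monoˡ-≤ (k * Q) (∑-mono 𝓤 λ {B} _ → ⟦⟧-≤ (satisfies? ((y , z) ∷ cs) B) (split {B})) ⟩
        ∑ 𝓤 (λ B → ⟦ satisfies? cs B ⟧ * ⟦ z ∈? lookup B y ⟧) * (k * Q)
                              ≤⟨ swap-count (satisfies? cs) (z ∷ points cs) (here refl) y≢z room
                                   (λ {B} _ y′∉ → satisfies-transpose {cs} {B} y∉ (y′∉ ∘ there)) ⟩
        N * k                 ∎)

    -- Greedy choice: a t-set of `X` that misses all points so far supplies the next condition. If
    -- none is left, `covered-size` bounds `X` by the points in use. If instead the chain has
    -- outgrown n/4, the trivial bound `n * 2 ^ k` is already good enough.
    build-chain : ∀ {B} → B ∈ partitions → ∀ X → X ⊆ˢ E B → ∀ fuel cs → n < 4 * (length cs + fuel) → Fresh cs →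
      (∀ {A} → A ∈ 𝓤 → X ⊆ˢ E A → Satisfies cs A) →
      ∃[ ds ] (Fresh ds × (∀ {A} → A ∈ 𝓤 → X ⊆ˢ E A → Satisfies ds A) × ∣ X ∣ ≤ length ds * (4 * 2 ^ k))
    build-chain {B} B∈ X X⊆ fuel cs lt fresh implied with 4 * length cs ≤? n
    ... | no n< = cs , fresh , implied , (begin
      ∣ X ∣                    ≤⟨ E-size B∈ X X⊆ ⟩
      n * 2 ^ k                ≤⟨ ℕₚ.*-monoˡ-≤ (2 ^ k) (ℕₚ.<⇒≤ (ℕₚ.≰⇒> n<)) ⟩
      4 * length cs * 2 ^ k    ≡⟨ l (length cs) (2 ^ k) ⟩
      length cs * (4 * 2 ^ k)  ∎)
      where
      open ≤-Reasoning
      l : ∀ a b → 4 * a * b ≡ a * (4 * b)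
      l = solve-∀
    ... | yes ≤n with any? (λ e → (e ∈? X) ×-dec ¬? (any? λ x → (x ∈ᴸ? points cs) ×-dec (x ∈? T e)))
    ... | no none = cs , fresh , implied , (begin
      ∣ X ∣                        ≤⟨ covered-size B∈ X (points cs) X⊆ meets ⟩
      length (points cs) * 2 ^ k   ≡⟨ cong (_* 2 ^ k) (length-points cs) ⟩
      2 * length cs * 2 ^ k        ≤⟨ ℕₚ.*-monoˡ-≤ (2 ^ k) (ℕₚ.*-monoˡ-≤ (length cs) {2} {4} (s≤s (s≤s z≤n))) ⟩
      4 * length cs * 2 ^ k        ≡⟨ l (length cs) (2 ^ k) ⟩
      length cs * (4 * 2 ^ k)      ∎)
      where
      open ≤-Reasoning
      l : ∀ a b → 4 * a * b ≡ a * (4 * b)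
      l = solve-∀
      meets : ∀ {e} → e ∈ˢ X → ∃[ x ] (x ∈ points cs × x ∈ˢ T e)
      meets {e} e∈ with any? (λ x → (x ∈ᴸ? points cs) ×-dec (x ∈? T e))
      ... | yes r = r
      ... | no ¬r = ⊥-elim (none (e , e∈ , ¬r))
    -- The invariant `n < 4 * (length cs + fuel)` means that fuel runs out only on chains longer
    -- than n/4, which have been dealt with.
    build-chain {B} B∈ X X⊆ zero cs lt fresh implied | yes ≤n | yes _ =
      ⊥-elim (ℕₚ.<⇒≱ lt (subst (λ z → 4 * z ≤ n) (sym (ℕₚ.+-identityʳ (length cs))) ≤n))
    build-chain {B} B∈ X X⊆ (suc fuel) cs lt fresh implied | yes ≤n | yes (e , e∈ , new) =
      let y , y∈ = T-nonempty e
          z , z∈ , z≢y = ∃-other (T e) (subst (2 ≤_) (sym (∣T∣ e)) 2≤t) y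
      in build-chain B∈ X X⊆ fuel ((y , z) ∷ cs)
           (subst (λ z → n < 4 * z) (ℕₚ.+-suc (length cs) fuel) lt)
           (((λ y∈cs → new (y , y∈cs , y∈)) , z≢y ∘ sym , ≤n) ∷ fresh)
           (λ A∈ X⊆A → E-together A∈ (X⊆A e∈) y∈ z∈ ∷ implied A∈ X⊆A)

  -- A chain for `X` has at least `∣ X ∣ / (4 * 2 ^ k)` conditions, so `Q = b ^ (4 * 2 ^ k)` per
  -- condition yields `b` per element of `X`. A partition above `X` is needed to bound `∣ X ∣`;
  -- without one the degree is 0.
  partitions-spread : ∀ b → 1 ≤ b → 2 * (k * b ^ (4 * 2 ^ k)) + 2 ≤ n →
    ∀ X → Links.deg E X 𝓤 * b ^ ∣ X ∣ ≤ length 𝓤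
  partitions-spread b 1≤b small X with 1 ≤? Links.deg E X 𝓤
  ... | no ¬pos = ℕₚ.≤-trans (ℕₚ.*-monoˡ-≤ _ (ℕₚ.≤-reflexive (ℕₚ.n<1⇒n≡0 (ℕₚ.≰⇒> ¬pos)))) z≤n
  ... | yes pos =
    let B , B∈ , 1≤ = ∑-exceeds 𝓤 (λ A → ⟦ X ⊆? E A ⟧) 0 (subst (_< Links.deg E X 𝓤) (sym (ℕₚ.*-zeroʳ (length 𝓤))) pos)
        cs , fresh , implied , ∣X∣≤ = build-chain Q small B∈ X (⟦⟧-pos (X ⊆? E B) 1≤) (suc n) [] n<4+4n [] (λ _ _ → [])
    in begin
      Links.deg E X 𝓤 * b ^ ∣ X ∣
        ≤⟨ ℕₚ.*-mono-≤ (∑-mono 𝓤 λ {A} A∈ → ⟦⟧-mono (X ⊆? E A) (satisfies? cs A) (implied A∈))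
             (ℕₚ.^-monoʳ-≤ b {{>-nonZero 1≤b}} ∣X∣≤) ⟩
      ∑ 𝓤 (λ A → ⟦ satisfies? cs A ⟧) * b ^ (length cs * (4 * 2 ^ k))
        ≡⟨ cong (∑ 𝓤 (λ A → ⟦ satisfies? cs A ⟧) *_) (trans (cong (b ^_) (ℕₚ.*-comm (length cs) _)) (sym (ℕₚ.^-*-assoc b (4 * 2 ^ k) (length cs)))) ⟩
      ∑ 𝓤 (λ A → ⟦ satisfies? cs A ⟧) * Q ^ length cs
        ≤⟨ chain-count Q small fresh ⟩
      length 𝓤 ∎
    where
    open ≤-Reasoning
    Q : ℕ
    Q = b ^ (4 * 2 ^ k)
    n<4+4n : n < 4 * (0 + suc n)
    n<4+4n = ℕₚ.m≤n*m (suc n) 4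

∑-strict : ∀ (xs : List A) {φ ψ : A → ℕ} {x₀} → (∀ {x} → x ∈ xs → φ x ≤ ψ x) → x₀ ∈ xs → φ x₀ < ψ x₀ → ∑ xs φ < ∑ xs ψ
∑-strict (x ∷ xs) le (here refl) lt = ℕₚ.+-mono-<-≤ lt (∑-mono xs (le ∘ there))
∑-strict (x ∷ xs) le (there x∈)  lt = ℕₚ.+-mono-≤-< (le (here refl)) (∑-strict xs (le ∘ there) x∈ lt)

-- Removing conflicts with a fixed partition by transpositions

module Switching {ℓ : ℕ} (P : Vec ℕ ℓ) (k t : ℕ) (P≤k : ∀ i → lookup P i ≤ k) (1≤k : 1 ≤ k) (2≤t : 2 ≤ t) where

  open Counting P k t P≤k 1≤k 2≤t public

  module _ {A : Partition n} (A∈ : A ∈ partitions) (e : Fin v) where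

    private
      𝓤 : List (Partition n)
      𝓤 = partitions
      pts : List (Fin n)
      pts = allFin n
      A∈U : InU P A
      A∈U = ∈-partitions⁻ A∈

    -- Points of T e are exempt: their parts in B must not be changed, and a common t-set other than T e has a point
    -- outside T e.
    Conflict : Partition n → Fin n → Set
    Conflict B y = y ∉ˢ T e × ∃[ x ] (x ≢ y × x ∈ˢ lookup B y × x ∈ˢ lookup A y)

    conflict? : ∀ B y → Dec (Conflict B y)
    conflict? B y = ¬? (y ∈? T e) ×-dec any? λ x → ¬? (x ≟ y) ×-dec ((x ∈? lookup B y) ×-dec (x ∈? lookup A y))

    conflicts : Partition n → ℕ
    conflicts B = ∑ pts (λ y → ⟦ conflict? B y ⟧)

    common⇒conflict : e ∉ˢ E A → ∀ {B} → B ∈ 𝓤 → Nonempty (E A ∩ E B) → 1 ≤ conflicts B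
    common⇒conflict e∉ {B} B∈ (e′ , e′∈) =
      let e′∈A , e′∈B = x∈p∩q⁻ (E A) (E B) e′∈
          y , y∈ , y∉ = ∃-difference (T e) (T e′) (trans (∣T∣ e) (sym (∣T∣ e′)))
                          λ eq → e∉ (subst (_∈ˢ E A) (sym (T-injective {e} {e′} eq)) e′∈A)
          x , x∈ , x≢y = ∃-other (T e′) (subst (2 ≤_) (sym (∣T∣ e′)) 2≤t) y
      in ℕₚ.≤-trans (⟦⟧-1≤ (conflict? B y) (y∉ , x , x≢y , E-together B∈ e′∈B y∈ x∈ , E-together A∈ e′∈A y∈ x∈))
           (∑-term (λ y → ⟦ conflict? B y ⟧) (∈-allFin y))

    -- At most `n * k` pairs `y`, `x` share a part of `A`. For each with `y` outside `T e`, a swap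
    -- shows that at most a fraction k/a of the star joins them, and `n ≤ 2 * a` turns n * k * k / a
    -- into `2 * (k * k)`.
    conflict-average : ∀ {a} → a + suc t ≤ n → n ≤ 2 * a →
      ∑ 𝓤 (λ B → ⟦ e ∈? E B ⟧ * conflicts B) ≤ 2 * (k * k) * star e
    conflict-average {a} le n≤2a = ℕₚ.*-cancelʳ-≤ _ _ n {{>-nonZero (ℕₚ.≤-trans (s≤s z≤n) (ℕₚ.≤-trans (ℕₚ.m≤n+m (suc t) a) le))}} (begin
      m * n                          ≤⟨ ℕₚ.*-monoʳ-≤ m n≤2a ⟩
      m * (2 * a)                    ≡⟨ l₁ m a ⟩
      2 * (m * a)                    ≤⟨ ℕₚ.*-monoʳ-≤ 2 (ℕₚ.*-monoˡ-≤ a expand) ⟩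
      2 * (∑ pts (λ y → ∑ pts (λ x → ∑ 𝓤 (λ B → w y x * φ y x B))) * a)
                                     ≡⟨ cong (2 *_) (trans (sym (∑-*ʳ pts _ a)) (∑-cong pts λ {y} _ → sym (∑-*ʳ pts _ a))) ⟩
      2 * ∑ pts (λ y → ∑ pts (λ x → ∑ 𝓤 (λ B → w y x * φ y x B) * a))
                                     ≤⟨ ℕₚ.*-monoʳ-≤ 2 (∑-mono pts λ {y} _ → ∑-mono pts λ {x} _ → pair y x) ⟩
      2 * ∑ pts (λ y → ∑ pts (λ x → ⟦ x ∈? lookup A y ⟧ * (star e * k)))
                                     ≤⟨ ℕₚ.*-monoʳ-≤ 2 (∑-bound pts λ {y} _ → ℕₚ.≤-trans
                                          (ℕₚ.≤-reflexive (trans (∑-*ʳ pts _ (star e * k)) (cong (_* (star e * k)) (sym (∣∣-∑ (lookup A y))))))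
                                          (ℕₚ.*-monoˡ-≤ (star e * k) (row-size A∈U P≤k y))) ⟩
      2 * (length pts * (k * (star e * k))) ≡⟨ cong (λ z → 2 * (z * (k * (star e * k)))) (length-allFin n) ⟩
      2 * (n * (k * (star e * k)))   ≡⟨ l₂ n k (star e) ⟩
      2 * (k * k) * star e * n       ∎)
      where
      open ≤-Reasoning
      m : ℕ
      m = ∑ 𝓤 (λ B → ⟦ e ∈? E B ⟧ * conflicts B)
      related? : ∀ y x → Dec (y ∉ˢ T e × x ≢ y × x ∈ˢ lookup A y)
      related? y x = ¬? (y ∈? T e) ×-dec (¬? (x ≟ y) ×-dec (x ∈? lookup A y))
      w : Fin n → Fin n → ℕ
      w y x = ⟦ related? y x ⟧
      φ : Fin n → Fin n → Partition n → ℕ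
      φ y x B = ⟦ e ∈? E B ⟧ * ⟦ x ∈? lookup B y ⟧
      l₁ : ∀ m a → m * (2 * a) ≡ 2 * (m * a)
      l₁ = solve-∀
      l₂ : ∀ n k s → 2 * (n * (k * (s * k))) ≡ 2 * (k * k) * s * n
      l₂ = solve-∀
      pointwise : ∀ B y → ⟦ e ∈? E B ⟧ * ⟦ conflict? B y ⟧ ≤ ∑ pts (λ x → w y x * φ y x B)
      pointwise B y = ⟦⟧-*-≤ (e ∈? E B) λ e∈ → ⟦⟧-≤ (conflict? B y) λ (y∉ , x , x≢y , x∈B , x∈A) →
        ℕₚ.≤-trans (ℕₚ.*-mono-≤ (⟦⟧-1≤ (related? y x) (y∉ , x≢y , x∈A))
          (ℕₚ.*-mono-≤ (⟦⟧-1≤ (e ∈? E B) e∈) (⟦⟧-1≤ (x ∈? lookup B y) x∈B)))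
          (∑-term (λ x → w y x * φ y x B) (∈-allFin x))
      expand : m ≤ ∑ pts (λ y → ∑ pts (λ x → ∑ 𝓤 (λ B → w y x * φ y x B)))
      expand = begin
        m
          ≡⟨ ∑-cong 𝓤 (λ {B} _ → ∑-*ˡ pts _ ⟦ e ∈? E B ⟧) ⟨
        ∑ 𝓤 (λ B → ∑ pts (λ y → ⟦ e ∈? E B ⟧ * ⟦ conflict? B y ⟧))
          ≤⟨ ∑-mono 𝓤 (λ {B} _ → ∑-mono pts λ {y} _ → pointwise B y) ⟩
        ∑ 𝓤 (λ B → ∑ pts (λ y → ∑ pts (λ x → w y x * φ y x B)))
          ≡⟨ ∑-swap 𝓤 pts _ ⟩
        ∑ pts (λ y → ∑ 𝓤 (λ B → ∑ pts (λ x → w y x * φ y x B)))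
          ≡⟨ ∑-cong pts (λ {y} _ → ∑-swap 𝓤 pts _) ⟩
        ∑ pts (λ y → ∑ pts (λ x → ∑ 𝓤 (λ B → w y x * φ y x B))) ∎
      pair : ∀ y x → ∑ 𝓤 (λ B → w y x * φ y x B) * a ≤ ⟦ x ∈? lookup A y ⟧ * (star e * k)
      pair y x = begin
        ∑ 𝓤 (λ B → w y x * φ y x B) * a
          ≡⟨ trans (cong (_* a) (∑-*ˡ 𝓤 (φ y x) (w y x))) (ℕₚ.*-assoc (w y x) _ a) ⟩
        w y x * (∑ 𝓤 (φ y x) * a)
          ≤⟨ ⟦⟧-*-≤ (related? y x) (λ (y∉ , x≢y , x∈A) → ℕₚ.≤-trans
               (swap-count (λ B → e ∈? E B) (x ∷ elements (T e)) (here refl) (x≢y ∘ sym)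
                 (subst (λ s → a + suc s ≤ n) (sym (trans (length-elements (T e)) (∣T∣ e))) le)
                 (λ {B} _ y′∉ → E-transpose {B} y∉ (λ y′∈ → y′∉ (there (∈-elements y′∈)))))
               (ℕₚ.≤-reflexive (sym (trans (cong (_* (star e * k)) (⟦⟧-yes (x ∈? lookup A y) x∈A)) (ℕₚ.*-identityˡ _))))) ⟩
        ⟦ x ∈? lookup A y ⟧ * (star e * k) ∎

    level : ℕ → ℕ
    level j = ∑ 𝓤 (λ B → ⟦ e ∈? E B ⟧ * ⟦ conflicts B ≤? j ⟧)

    -- Markov's inequality at twice the average: at least half of the star has at most `4 * (k * k)`
    -- conflicts.
    star≤level : ∀ {a} → a + suc t ≤ n → n ≤ 2 * a → star e ≤ 2 * level (4 * (k * k))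
    star≤level le n≤2a = ℕₚ.*-cancelʳ-≤ _ _ (suc K) (ℕₚ.+-cancelʳ-≤ (K * star e) _ _ (begin
      star e * suc K + K * star e       ≡⟨ l₁ (star e) (k * k) ⟩
      star e * suc top                    ≡⟨ ∑-*ʳ 𝓤 _ (suc top) ⟨
      ∑ 𝓤 (λ B → ⟦ e ∈? E B ⟧ * suc top)  ≤⟨ ∑-mono 𝓤 (λ {B} _ → pointwise B) ⟩
      ∑ 𝓤 (λ B → ⟦ e ∈? E B ⟧ * ⟦ conflicts B ≤? top ⟧ * suc top + ⟦ e ∈? E B ⟧ * conflicts B)
                                        ≡⟨ trans (∑-+ 𝓤 _ _) (cong (_+ m) (∑-*ʳ 𝓤 _ (suc top))) ⟩
      level top * suc top + m               ≤⟨ ℕₚ.+-mono-≤ (ℕₚ.≤-trans (ℕₚ.m≤m+n _ (level top)) (ℕₚ.≤-reflexive (l₂ (level top) (k * k)))) (conflict-average le n≤2a) ⟩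
      2 * level top * suc K + K * star e  ∎))
      where
      open ≤-Reasoning
      top K m : ℕ
      top = 4 * (k * k)
      K = 2 * (k * k)
      m = ∑ 𝓤 (λ B → ⟦ e ∈? E B ⟧ * conflicts B)
      l₁ : ∀ s q → s * suc (2 * q) + 2 * q * s ≡ s * suc (4 * q)
      l₁ = solve-∀
      l₂ : ∀ s q → s * suc (4 * q) + s ≡ 2 * s * suc (2 * q)
      l₂ = solve-∀
      aux : ∀ c (d : Dec (c ≤ top)) → suc top ≤ ⟦ d ⟧ * suc top + c
      aux c (yes _) = ℕₚ.≤-trans (ℕₚ.≤-reflexive (sym (ℕₚ.*-identityˡ (suc top)))) (ℕₚ.m≤m+n _ c)
      aux c (no c≰) = ℕₚ.≰⇒> c≰
      pointwise : ∀ B → ⟦ e ∈? E B ⟧ * suc top ≤ ⟦ e ∈? E B ⟧ * ⟦ conflicts B ≤? top ⟧ * suc top + ⟦ e ∈? E B ⟧ * conflicts B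
      pointwise B = begin
        d * suc top                        ≤⟨ ℕₚ.*-monoʳ-≤ d (aux (conflicts B) (conflicts B ≤? top)) ⟩
        d * (c * suc top + conflicts B)    ≡⟨ l₃ d c (suc top) (conflicts B) ⟩
        d * c * suc top + d * conflicts B  ∎
        where
        d c : ℕ
        d = ⟦ e ∈? E B ⟧
        c = ⟦ conflicts B ≤? top ⟧
        l₃ : ∀ d c j x → d * (c * j + x) ≡ d * c * j + d * x
        l₃ = solve-∀

    module _ (room : t + (k + (k * k + k * k)) < n) where

      -- The point `z` is chosen outside `T e`, outside the part of `y` in `B`, outside the
      -- `A`-parts of the `B`-mates of `y`, and outside the `B`-parts of the `A`-mates of `y`. After
      -- the exchange neither `y` nor `z` shares its new part with an `A`-mate, so the conflict at
      -- `y` disappears and none is created.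
      switch : ∀ {B y} → B ∈ 𝓤 → e ∈ˢ E B → Conflict B y →
        ∃[ z ] (e ∈ˢ E (act (transpose y z) B) × conflicts (act (transpose y z) B) < conflicts B)
      switch {B} {y} B∈ e∈ conf@(y∉ , _) = z , E-transpose {B} y∉ z∉T e∈
        , ∑-strict pts (λ {w} _ → ⟦⟧-mono (conflict? B′ w) (conflict? B w) (decreasing w)) (∈-allFin y)
            (subst₂ _<_ (sym (⟦⟧-no (conflict? B′ y) resolved)) (sym (⟦⟧-yes (conflict? B y) conf)) (s≤s z≤n))
        where
        open ≤-Reasoning
        B∈U : InU P B
        B∈U = ∈-partitions⁻ B∈
        b₁ b₂ b₃ b₄ : Fin n → ℕ
        b₁ z = ⟦ z ∈? T e ⟧
        b₂ z = ⟦ z ∈? lookup B y ⟧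
        b₃ z = ∑ pts (λ x → ⟦ x ∈? lookup B y ⟧ * ⟦ z ∈? lookup A x ⟧)
        b₄ z = ∑ pts (λ x → ⟦ x ∈? lookup A y ⟧ * ⟦ z ∈? lookup B x ⟧)
        second : ∀ {C D} → InU P C → InU P D →
          ∑ pts (λ z → ∑ pts (λ x → ⟦ x ∈? lookup C y ⟧ * ⟦ z ∈? lookup D x ⟧)) ≤ k * k
        second {C} {D} C∈ D∈ = begin
          ∑ pts (λ z → ∑ pts (λ x → ⟦ x ∈? lookup C y ⟧ * ⟦ z ∈? lookup D x ⟧))
            ≡⟨ ∑-swap-*ˡ pts pts (λ x → ⟦ x ∈? lookup C y ⟧) (λ x z → ⟦ z ∈? lookup D x ⟧) ⟩
          ∑ pts (λ x → ⟦ x ∈? lookup C y ⟧ * ∑ pts (λ z → ⟦ z ∈? lookup D x ⟧))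
            ≤⟨ ∑-mono pts (λ {x} _ → ℕₚ.*-monoʳ-≤ ⟦ x ∈? lookup C y ⟧
                 (subst (_≤ k) (∣∣-∑ (lookup D x)) (row-size D∈ P≤k x))) ⟩
          ∑ pts (λ x → ⟦ x ∈? lookup C y ⟧ * k)
            ≡⟨ trans (∑-*ʳ pts _ k) (cong (_* k) (sym (∣∣-∑ (lookup C y)))) ⟩
          ∣ lookup C y ∣ * k
            ≤⟨ ℕₚ.*-monoˡ-≤ k (row-size C∈ P≤k y) ⟩
          k * k ∎
        -- The four counts total less than `n`, so all of them vanish at some point; `room` is the
        -- sum of the four bounds.
        few : ∑ pts (λ z → b₁ z + (b₂ z + (b₃ z + b₄ z))) < length pts
        few = begin-strict
          ∑ pts (λ z → b₁ z + (b₂ z + (b₃ z + b₄ z)))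
            ≡⟨ trans (∑-+ pts b₁ _) (cong (∑ pts b₁ +_) (trans (∑-+ pts b₂ _) (cong (∑ pts b₂ +_) (∑-+ pts b₃ b₄)))) ⟩
          ∑ pts b₁ + (∑ pts b₂ + (∑ pts b₃ + ∑ pts b₄))
            ≤⟨ ℕₚ.+-mono-≤ (ℕₚ.≤-reflexive (trans (sym (∣∣-∑ (T e))) (∣T∣ e)))
                 (ℕₚ.+-mono-≤ (subst (_≤ k) (∣∣-∑ (lookup B y)) (row-size B∈U P≤k y))
                   (ℕₚ.+-mono-≤ (second B∈U A∈U) (second A∈U B∈U))) ⟩
          t + (k + (k * k + k * k))
            <⟨ room ⟩
          n
            ≡⟨ length-allFin n ⟨
          length pts ∎
        witness : ∃[ z ] (z ∈ pts × b₁ z + (b₂ z + (b₃ z + b₄ z)) ≡ 0)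
        witness = ∑-vanishes pts _ few
        z : Fin n
        z = proj₁ witness
        zero₁ : b₁ z ≡ 0
        zero₁ = ℕₚ.m+n≡0⇒m≡0 _ (proj₂ (proj₂ witness))
        rest₁ : b₂ z + (b₃ z + b₄ z) ≡ 0
        rest₁ = ℕₚ.m+n≡0⇒n≡0 (b₁ z) (proj₂ (proj₂ witness))
        rest₂ : b₃ z + b₄ z ≡ 0
        rest₂ = ℕₚ.m+n≡0⇒n≡0 (b₂ z) rest₁
        z∉T : z ∉ˢ T e
        z∉T = ⟦⟧-zero (z ∈? T e) zero₁
        z∉By : z ∉ˢ lookup B y
        z∉By = ⟦⟧-zero (z ∈? lookup B y) (ℕₚ.m+n≡0⇒m≡0 _ rest₁)
        vanish : ∀ {C D} → ∑ pts (λ x → ⟦ x ∈? lookup C y ⟧ * ⟦ z ∈? lookup D x ⟧) ≡ 0 →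
          ∀ {x} → x ∈ˢ lookup C y → z ∉ˢ lookup D x
        vanish {C} {D} eq {x} x∈ z∈ = case ℕₚ.≤-trans
          (ℕₚ.≤-trans (ℕₚ.*-mono-≤ (⟦⟧-1≤ (x ∈? lookup C y) x∈) (⟦⟧-1≤ (z ∈? lookup D x) z∈))
            (∑-term (λ x → ⟦ x ∈? lookup C y ⟧ * ⟦ z ∈? lookup D x ⟧) (∈-allFin x)))
          (ℕₚ.≤-reflexive eq) of λ ()
        z-new : ∀ {x} → x ∈ˢ lookup B y → z ∉ˢ lookup A x
        z-new = vanish {B} {A} (ℕₚ.m+n≡0⇒m≡0 _ rest₂)
        y-new : ∀ {x} → x ∈ˢ lookup A y → z ∉ˢ lookup B x
        y-new = vanish {A} {B} (ℕₚ.m+n≡0⇒n≡0 (b₃ z) rest₂)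
        τ : Fin n → Fin n
        τ = transpose y z
        B′ : Partition n
        B′ = act τ B
        z≢y : z ≢ y
        z≢y eq = z∉By (subst (_∈ˢ lookup B y) (sym eq) (∼-refl B∈U y))
        τy : τ y ≡ z
        τy = transpose-left y z
        τz : τ z ≡ y
        τz = transpose-right y z
        τfix : ∀ {x} → x ≢ y → x ≢ z → τ x ≡ x
        τfix = transpose-fixed y z
        B-row : ∀ {x w} → x ∈ˢ lookup B′ w → τ x ∈ˢ lookup B (τ w)
        B-row = act⁻ τ B
        resolved : ¬ Conflict B′ y
        resolved (_ , x , x≢y , x∈B′ , x∈A) = go (x ≟ z)
          where
          go : ¬ Dec (x ≡ z)
          go (yes x≡z) = z∉By (∼-sym B∈U (subst₂ (λ a b → b ∈ˢ lookup B a) τy (trans (cong τ x≡z) τz) (B-row x∈B′)))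
          go (no x≢z)  = y-new x∈A (∼-sym B∈U (subst₂ (λ a b → b ∈ˢ lookup B a) τy (τfix x≢y x≢z) (B-row x∈B′)))
        decreasing : ∀ w → Conflict B′ w → Conflict B w
        decreasing w conf′@(w∉ , x , x≢w , x∈B′ , x∈A) = go (w ≟ y) (w ≟ z) (x ≟ y) (x ≟ z)
          where
          moved : ∀ {a b} → τ w ≡ a → τ x ≡ b → b ∈ˢ lookup B a
          moved p q = subst₂ (λ a b → b ∈ˢ lookup B a) p q (B-row x∈B′)
          go : Dec (w ≡ y) → Dec (w ≡ z) → Dec (x ≡ y) → Dec (x ≡ z) → Conflict B w
          go (yes refl) _ _ _ = ⊥-elim (resolved conf′)
          go (no _) (yes refl) (yes refl) _ = ⊥-elim (z∉By (moved τz τy))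
          go (no _) (yes refl) (no _) (yes x≡z) = ⊥-elim (x≢w x≡z)
          go (no _) (yes refl) (no x≢y) (no x≢z) = ⊥-elim (z-new (moved τz (τfix x≢y x≢z)) (∼-sym A∈U x∈A))
          go (no w≢y) (no w≢z) (yes refl) _ = ⊥-elim (y-new (∼-sym A∈U x∈A) (moved (τfix w≢y w≢z) τy))
          go (no w≢y) (no w≢z) (no _) (yes refl) = ⊥-elim (z-new (∼-sym B∈U (moved (τfix w≢y w≢z) τz)) x∈A)
          go (no w≢y) (no w≢z) (no x≢y) (no x≢z) = w∉ , x , x≢w , moved (τfix w≢y w≢z) (τfix x≢y x≢z) , x∈A

      -- A partition with j + 1 conflicts is brought to level j by one of n * n transpositions, each
      -- an involution of the set of partitions. The summand 1 counts those already at level j.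
      level-suc : ∀ j → level (suc j) ≤ (1 + n * n) * level j
      level-suc j = begin
        level (suc j)
          ≤⟨ ∑-mono 𝓤 (λ {B} B∈ → ⟦⟧-*-≤ (e ∈? E B) λ e∈ → ⟦⟧-≤ (conflicts B ≤? suc j) λ le → pointwise B∈ e∈ le) ⟩
        ∑ 𝓤 (λ B → h B + ∑ pts (λ y → ∑ pts (λ z → h (act (transpose y z) B))))
          ≡⟨ ∑-+ 𝓤 h _ ⟩
        level j + ∑ 𝓤 (λ B → ∑ pts (λ y → ∑ pts (λ z → h (act (transpose y z) B))))
          ≡⟨ cong (level j +_) (trans (∑-swap 𝓤 pts _) (∑-cong pts λ {y} _ → trans (∑-swap 𝓤 pts _)
               (∑-cong pts λ {z} _ → ∑-act (transpose-involutive y z) h))) ⟩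
        level j + ∑ pts (λ y → ∑ pts (λ z → level j))
          ≡⟨ cong (level j +_) (trans (∑-cong pts λ _ → ∑-const pts (level j)) (∑-const pts _)) ⟩
        level j + length pts * (length pts * level j)
          ≡⟨ cong (λ s → level j + s * (s * level j)) (length-allFin n) ⟩
        level j + n * (n * level j)
          ≡⟨ cong (level j +_) (ℕₚ.*-assoc n n (level j)) ⟨
        (1 + n * n) * level j ∎
        where
        open ≤-Reasoning
        h : Partition n → ℕ
        h B = ⟦ e ∈? E B ⟧ * ⟦ conflicts B ≤? j ⟧
        1≤h : ∀ {B} → e ∈ˢ E B → conflicts B ≤ j → 1 ≤ h B
        1≤h {B} e∈ le = ℕₚ.*-mono-≤ (⟦⟧-1≤ (e ∈? E B) e∈) (⟦⟧-1≤ (conflicts B ≤? j) le)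
        pointwise : ∀ {B} → B ∈ 𝓤 → e ∈ˢ E B → conflicts B ≤ suc j →
          1 ≤ h B + ∑ pts (λ y → ∑ pts (λ z → h (act (transpose y z) B)))
        pointwise {B} B∈ e∈ le = go (conflicts B ≤? j)
          where
          go : Dec (conflicts B ≤ j) → 1 ≤ h B + ∑ pts (λ y → ∑ pts (λ z → h (act (transpose y z) B)))
          go (yes le′) = ℕₚ.≤-trans (1≤h {B} e∈ le′) (ℕₚ.m≤m+n _ _)
          go (no ¬le) =
            let y , _ , 0<y = ∑-exceeds pts (λ y → ⟦ conflict? B y ⟧) 0
                  (subst (_< conflicts B) (sym (ℕₚ.*-zeroʳ (length pts))) (ℕₚ.≤-<-trans z≤n (ℕₚ.≰⇒> ¬le)))
                z , e∈′ , lt = switch B∈ e∈ (⟦⟧-pos (conflict? B y) 0<y)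
            in ℕₚ.≤-trans (1≤h {act (transpose y z) B} e∈′ (s≤s⁻¹ (ℕₚ.≤-trans lt le))) (ℕₚ.≤-trans
                 (ℕₚ.≤-trans (∑-term (λ z → h (act (transpose y z) B)) (∈-allFin z))
                   (∑-term (λ y → ∑ pts (λ z → h (act (transpose y z) B))) (∈-allFin y)))
                 (ℕₚ.m≤n+m _ (h B)))

      level≤ : ∀ j → level j ≤ (1 + n * n) ^ j * level 0
      level≤ zero    = ℕₚ.≤-reflexive (sym (ℕₚ.*-identityˡ (level 0)))
      level≤ (suc j) = ℕₚ.≤-trans (level-suc j) (ℕₚ.≤-trans (ℕₚ.*-monoʳ-≤ (1 + n * n) (level≤ j))
        (ℕₚ.≤-reflexive (sym (ℕₚ.*-assoc (1 + n * n) ((1 + n * n) ^ j) (level 0)))))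

    -- Members of `F` in the star share a t-set with `A`, hence have a conflict. They are therefore
    -- disjoint from the conflict-free part of the star, counted by `level 0`; beyond the star `F`
    -- has only the members that miss `e`.
    family+level : ∀ F → Unique F → (∀ {B} → B ∈ F → B ∈ 𝓤) → e ∉ˢ E A →
      (∀ {B} → B ∈ F → Nonempty (E A ∩ E B)) →
      length F + level 0 ≤ star e + length (filter (λ B → ¬? (e ∈? E B)) F)
    family+level F u F⊆ e∉ int = begin
      length F + level 0
        ≡⟨ cong (_+ level 0) (length-filter-split (λ B → e ∈? E B) (λ B → ¬? (e ∈? E B)) F) ⟨
      length (filter (λ B → e ∈? E B) F) + miss + level 0
        ≤⟨ ℕₚ.+-monoˡ-≤ (level 0) (ℕₚ.+-monoˡ-≤ miss inside) ⟩
      ∑ 𝓤 (λ B → ⟦ e ∈? E B ⟧ * ⟦ 1 ≤? conflicts B ⟧) + miss + level 0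
        ≡⟨ l (∑ 𝓤 (λ B → ⟦ e ∈? E B ⟧ * ⟦ 1 ≤? conflicts B ⟧)) miss (level 0) ⟩
      ∑ 𝓤 (λ B → ⟦ e ∈? E B ⟧ * ⟦ 1 ≤? conflicts B ⟧) + level 0 + miss
        ≤⟨ ℕₚ.+-monoˡ-≤ miss (ℕₚ.≤-trans (ℕₚ.≤-reflexive (sym (∑-+ 𝓤 _ _))) (∑-mono 𝓤 λ {B} _ → split B)) ⟩
      star e + miss ∎
      where
      open ≤-Reasoning
      miss : ℕ
      miss = length (filter (λ B → ¬? (e ∈? E B)) F)
      l : ∀ a b c → a + b + c ≡ a + c + b
      l = solve-∀
      inside : length (filter (λ B → e ∈? E B) F) ≤ ∑ 𝓤 (λ B → ⟦ e ∈? E B ⟧ * ⟦ 1 ≤? conflicts B ⟧)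
      inside = begin
        length (filter (λ B → e ∈? E B) F)  ≡⟨ length-filter (λ B → e ∈? E B) F ⟩
        ∑ F (λ B → ⟦ e ∈? E B ⟧)            ≤⟨ ∑-mono F (λ {B} B∈ → ⟦⟧-≤ (e ∈? E B) λ e∈ →
          ℕₚ.*-mono-≤ (⟦⟧-1≤ (e ∈? E B) e∈) (⟦⟧-1≤ (1 ≤? conflicts B) (common⇒conflict e∉ (F⊆ B∈) (int B∈)))) ⟩
        ∑ F (λ B → ⟦ e ∈? E B ⟧ * ⟦ 1 ≤? conflicts B ⟧) ≤⟨ ∑-⊆ _ u F⊆ ⟩
        ∑ 𝓤 (λ B → ⟦ e ∈? E B ⟧ * ⟦ 1 ≤? conflicts B ⟧) ∎
      exclusive : ∀ c → ⟦ 1 ≤? c ⟧ + ⟦ c ≤? 0 ⟧ ≤ 1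
      exclusive zero    = ℕₚ.≤-refl
      exclusive (suc c) = ℕₚ.≤-refl
      split : ∀ B → ⟦ e ∈? E B ⟧ * ⟦ 1 ≤? conflicts B ⟧ + ⟦ e ∈? E B ⟧ * ⟦ conflicts B ≤? 0 ⟧ ≤ ⟦ e ∈? E B ⟧
      split B = begin
        d * ⟦ 1 ≤? conflicts B ⟧ + d * ⟦ conflicts B ≤? 0 ⟧   ≡⟨ ℕₚ.*-distribˡ-+ d _ _ ⟨
        d * (⟦ 1 ≤? conflicts B ⟧ + ⟦ conflicts B ≤? 0 ⟧)     ≤⟨ ℕₚ.*-monoʳ-≤ d (exclusive (conflicts B)) ⟩
        d * 1                                                 ≡⟨ ℕₚ.*-identityʳ d ⟩
        d                                                     ∎
        where
        d : ℕ
        d = ⟦ e ∈? E B ⟧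

-- Maximal families inside a star

∃-subset : ∀ {n} t (p : Subset n) → t ≤ ∣ p ∣ → ∃[ q ] (q ⊆ˢ p × ∣ q ∣ ≡ t)
∃-subset {n} zero p _ = ∅ˢ , Subsetₚ.⊥⊆ , Subsetₚ.∣⊥∣≡0 n
∃-subset (suc t) (true ∷ p) (s≤s le) with ∃-subset t p le
... | q , q⊆ , eq = true ∷ q , Subsetₚ.s⊆s q⊆ , cong suc eq
∃-subset (suc t) (false ∷ p) le with ∃-subset (suc t) p le
... | q , q⊆ , eq = false ∷ q , Subsetₚ.s⊆s q⊆ , eq

module Stars {ℓ : ℕ} (P : Vec ℕ ℓ) (t : ℕ) where

  open Profile P

  inStar? : ∀ (T : Subset n) (B : Partition n) → Dec (∃[ x ] (T ⊆ˢ lookup B x))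
  inStar? T B = any? λ x → T ⊆? lookup B x

  starFamily : Subset n → List (Partition n)
  starFamily T = filter (inStar? T) partitions

  ∈-star⁺ : ∀ {T B} → InC P T B → B ∈ starFamily T
  ∈-star⁺ {T} (B∈ , T⊆) = ∈-filter⁺ (inStar? T) (∈-partitions⁺ B∈) T⊆

  star-PI : ∀ {T} → ∣ T ∣ ≡ t → PIFamily P t (starFamily T)
  star-PI {T} eq = Unique.filter⁺ (inStar? T) partitions-unique
    , All.tabulate (λ B∈ → ∈-partitions⁻ (proj₁ (∈-filter⁻ (inStar? T) {xs = partitions} B∈)))
    , λ A B A∈ B∈ →
        let _ , x , T⊆A = ∈-filter⁻ (inStar? T) {xs = partitions} A∈
            _ , y , T⊆B = ∈-filter⁻ (inStar? T) {xs = partitions} B∈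
        in x , y , subst (_≤ ∣ lookup A x ∩ lookup B y ∣) eq (Subsetₚ.p⊆q⇒∣p∣≤∣q∣ {p = T} (λ i∈ → x∈p∩q⁺ (T⊆A i∈ , T⊆B i∈)))

  -- If some `R` of the star were missing, `R ∷ F` would fit without repetition into the star, which
  -- is itself an admissible family and so no longer than `F`.
  largest-in-star : ∀ {F T} → Largest P t F → ∣ T ∣ ≡ t → (∀ {A} → A ∈ F → InC P T A) →
    ∀ R → (R ∈ F) ⇔ InC P T R
  largest-in-star {F} {T} ((u , _ , _) , largest) eq F⊆ R = mk⇔ F⊆ from
    where
    from : InC P T R → R ∈ F
    from R∈ with Any.any? (R ≟ᴾ_) F
    ... | yes R∈F = R∈F
    ... | no R∉F = ⊥-elim (ℕₚ.<-irrefl refl (ℕₚ.≤-trans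
      (length-⊆ {xs = R ∷ F} (All.tabulate (λ { y∈ refl → R∉F y∈ }) ∷ u)
        λ { (here refl) → ∈-star⁺ R∈ ; (there A∈) → ∈-star⁺ (F⊆ A∈) })
      (largest (starFamily T) (star-PI eq))))

-- The theorem for t ≥ 2, given numerical inequalities

module LargeCase {ℓ : ℕ} (P : Vec ℕ ℓ) (k t : ℕ) (P≤k : ∀ i → lookup P i ≤ k) (1≤k : 1 ≤ k) (2≤t : 2 ≤ t)
  (i : Fin ℓ) (t≤Pᵢ : t ≤ lookup P i) where

  open Switching P k t P≤k 1≤k 2≤t public
  open Stars P t

  private
    𝓤 : List (Partition n)
    𝓤 = partitions

  star≤largest : ∀ {F} → Largest P t F → ∀ e → star e ≤ length F
  star≤largest (_ , largest) e = ℕₚ.≤-trans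
    (∑-mono 𝓤 (λ {B} _ → ⟦⟧-mono (e ∈? E B) (inStar? (T e) B) (E⁻ B)))
    (ℕₚ.≤-trans (ℕₚ.≤-reflexive (sym (length-filter (inStar? (T e)) 𝓤))) (largest (starFamily (T e)) (star-PI (∣T∣ e))))

  -- A part of size at least `t` puts every partition into one of the `v` stars, and no star exceeds
  -- a largest family.
  dense : ∀ {F} → Largest P t F → length 𝓤 ≤ v * length F
  dense {F} lar = begin
    length 𝓤                                              ≡⟨ ∑-1 𝓤 ⟨
    ∑ 𝓤 (λ _ → 1)                                         ≤⟨ ∑-mono 𝓤 (λ {B} B∈ → hit B∈) ⟩
    ∑ 𝓤 (λ B → ∑ (allFin v) (λ e → ⟦ e ∈? E B ⟧))         ≡⟨ ∑-swap 𝓤 (allFin v) _ ⟩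
    ∑ (allFin v) star                                     ≤⟨ ∑-bound (allFin v) (λ {e} _ → star≤largest lar e) ⟩
    length (allFin v) * length F                          ≡⟨ cong (_* length F) (length-allFin v) ⟩
    v * length F                                          ∎
    where
    open ≤-Reasoning
    hit : ∀ {B} → B ∈ 𝓤 → 1 ≤ ∑ (allFin v) (λ e → ⟦ e ∈? E B ⟧)
    hit {B} B∈ =
      let x , size = large-row (∈-partitions⁻ B∈) i (ℕₚ.≤-trans (ℕₚ.≤-trans (s≤s z≤n) 2≤t) t≤Pᵢ)
          p , p⊆ , ∣p∣ = ∃-subset t (lookup B x) (subst (t ≤_) (sym size) t≤Pᵢ)
          e , Te≡p = T-surjective p ∣p∣
      in ℕₚ.≤-trans (⟦⟧-1≤ (e ∈? E B) (E⁺ B (x , subst (_⊆ˢ lookup B x) (sym Te≡p) p⊆)))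
           (∑-term (λ e → ⟦ e ∈? E B ⟧) (∈-allFin e))

  PInt⇒common : ∀ A B → PInt t A B → Nonempty (E A ∩ E B)
  PInt⇒common A B (x , y , le) =
    let p , p⊆ , ∣p∣ = ∃-subset t (lookup A x ∩ lookup B y) le
        e , Te≡p = T-surjective p ∣p∣
        T⊆ = λ {i} i∈ → x∈p∩q⁻ (lookup A x) (lookup B y) (p⊆ (subst (i ∈ˢ_) Te≡p i∈))
    in e , x∈p∩q⁺ (E⁺ A (x , λ i∈ → proj₁ (T⊆ i∈)) , E⁺ B (y , λ i∈ → proj₂ (T⊆ i∈)))

  -- `R` counts the rounds of the spread lemma, `q` bounds the kernels and `ρ` is the spreadness
  -- left after halving. `a₁` and `a₂` are the numbers of points free for swaps in the pair count
  -- and in the conflict average.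
  module _ (R q ρ a₁ a₂ : ℕ) (1≤R : 1 ≤ R) (n<2^R : n * 2 ^ k < 2 ^ R) (R²≤ρ : (4 * R) * (4 * R) ≤ ρ)
    (2q≤r : 2 * q ≤ 2 * ρ)
    (spread-room : 2 * (k * (2 * ρ * (2 * ρ)) ^ (4 * 2 ^ k)) + 2 ≤ n)
    (pair-room : a₁ + suc t ≤ n) (pair-small : k * (4 * (q * q)) ≤ a₁)
    (switch-room : t + (k + (k * k + k * k)) < n)
    (average-room : a₂ + suc t ≤ n) (n≤2a₂ : n ≤ 2 * a₂)
    (r^q-large : 4 * v * (1 + n * n) ^ (4 * (k * k)) < (2 * ρ) ^ q)
    where

    private
      C : ℕ
      C = (1 + n * n) ^ (4 * (k * k))
      r^q : ℕ
      r^q = (2 * ρ) ^ q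
      1≤ρ : 1 ≤ ρ
      1≤ρ = ℕₚ.≤-trans (ℕₚ.*-mono-≤ (ℕₚ.≤-trans 1≤R (ℕₚ.m≤n*m R 4)) (ℕₚ.≤-trans 1≤R (ℕₚ.m≤n*m R 4))) R²≤ρ
      1≤r² : 1 ≤ 2 * ρ * (2 * ρ)
      1≤r² = ℕₚ.*-mono-≤ (ℕₚ.≤-trans 1≤ρ (ℕₚ.m≤n*m ρ 2)) (ℕₚ.≤-trans 1≤ρ (ℕₚ.m≤n*m ρ 2))
      4v≤r^q : 4 * v ≤ r^q
      4v≤r^q = ℕₚ.≤-trans (ℕₚ.m≤m*n (4 * v) C {{ℕₚ.m^n≢0 (1 + n * n) (4 * (k * k))}}) (ℕₚ.<⇒≤ r^q-large)

      module Approx = Approximation E _≟ᴾ_ 𝓤 (n * 2 ^ k) R q ρ 1≤R n<2^R R²≤ρ 2q≤r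
        (λ {B} B∈ → E-size B∈ (E B) (λ e∈ → e∈))
        (partitions-spread (2 * ρ * (2 * ρ)) 1≤r² spread-room) 4v≤r^q

    -- Suppose `A` misses `e`. Since `star e` is at most `length F`, the conflict-free part of the
    -- star is at most `miss`, so the star is at most `2 * (C * miss)`. By density `length 𝓤` is
    -- then at most `4 * v * C * miss`. As `miss * r^q` is at most `length 𝓤` and `r^q` exceeds
    -- `4 * v * C`, `miss` is 0; so 𝓤 would be empty, yet it contains `A`.
    near-star⇒star : ∀ F → Largest P t F → ∀ e →
      length (filter (λ A → ¬? (e ∈? E A)) F) * r^q ≤ length 𝓤 → ∀ {A} → A ∈ F → e ∈ˢ E A
    near-star⇒star F lar@((u , inU , int) , _) e near {A} A∈ with e ∈? E A
    ... | yes e∈ = e∈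
    ... | no e∉  = ⊥-elim (impossible e∉)
      where
      open ≤-Reasoning
      F⊆ : ∀ {B} → B ∈ F → B ∈ 𝓤
      F⊆ B∈ = ∈-partitions⁺ (All.lookup inU B∈)
      miss : ℕ
      miss = length (filter (λ B → ¬? (e ∈? E B)) F)
      impossible : ¬ (e ∉ˢ E A)
      impossible e∉ = ℕₚ.<-irrefl refl (ℕₚ.≤-trans (∈ₚ.∈-length (F⊆ A∈)) 𝓤≤0)
        where
        loss : length F + level (F⊆ A∈) e 0 ≤ star e + miss
        loss = family+level (F⊆ A∈) e F u F⊆ e∉ (λ {B} B∈ → PInt⇒common A B (int _ _ A∈ B∈))
        level≤miss : level (F⊆ A∈) e 0 ≤ miss
        level≤miss = ℕₚ.+-cancelˡ-≤ (length F) _ _ (ℕₚ.≤-trans loss (ℕₚ.+-monoˡ-≤ miss (star≤largest lar e)))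
        F≤ : length F ≤ star e + miss
        F≤ = ℕₚ.≤-trans (ℕₚ.m≤m+n _ _) loss
        star≤ : star e ≤ 2 * (C * miss)
        star≤ = begin
          star e                                         ≤⟨ star≤level (F⊆ A∈) e average-room n≤2a₂ ⟩
          2 * level (F⊆ A∈) e (4 * (k * k))              ≤⟨ ℕₚ.*-monoʳ-≤ 2 (level≤ (F⊆ A∈) e switch-room (4 * (k * k))) ⟩
          2 * (C * level (F⊆ A∈) e 0)                    ≤⟨ ℕₚ.*-monoʳ-≤ 2 (ℕₚ.*-monoʳ-≤ C level≤miss) ⟩
          2 * (C * miss)                                 ∎
        4v-miss : 4 * (v * miss) ≤ length 𝓤
        4v-miss = begin
          4 * (v * miss)   ≡⟨ l v miss ⟩
          miss * (4 * v)   ≤⟨ ℕₚ.*-monoʳ-≤ miss 4v≤r^q ⟩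
          miss * r^q       ≤⟨ near ⟩
          length 𝓤         ∎
          where
          l : ∀ v m → 4 * (v * m) ≡ m * (4 * v)
          l = solve-∀
        𝓤≤ : length 𝓤 ≤ 4 * v * C * miss
        𝓤≤ = ℕₚ.*-cancelˡ-≤ 2 (ℕₚ.+-cancelʳ-≤ (length 𝓤 + length 𝓤) _ _ (begin
          2 * length 𝓤 + (length 𝓤 + length 𝓤)         ≡⟨ l₁ (length 𝓤) ⟩
          4 * length 𝓤                                 ≤⟨ ℕₚ.*-monoʳ-≤ 4 (ℕₚ.≤-trans (dense lar) (ℕₚ.*-monoʳ-≤ v F≤)) ⟩
          4 * (v * (star e + miss))                    ≡⟨ l₂ v (star e) miss ⟩
          4 * (v * star e) + 4 * (v * miss)            ≤⟨ ℕₚ.+-mono-≤ (ℕₚ.*-monoʳ-≤ 4 (ℕₚ.*-monoʳ-≤ v star≤)) (ℕₚ.≤-trans 4v-miss (ℕₚ.m≤m+n _ (length 𝓤))) ⟩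
          4 * (v * (2 * (C * miss))) + (length 𝓤 + length 𝓤) ≡⟨ cong (_+ (length 𝓤 + length 𝓤)) (l₃ v C miss) ⟩
          2 * (4 * v * C * miss) + (length 𝓤 + length 𝓤) ∎))
          where
          l₁ : ∀ u → 2 * u + (u + u) ≡ 4 * u
          l₁ = solve-∀
          l₂ : ∀ v s m → 4 * (v * (s + m)) ≡ 4 * (v * s) + 4 * (v * m)
          l₂ = solve-∀
          l₃ : ∀ v C m → 4 * (v * (2 * (C * m))) ≡ 2 * (4 * v * C * m)
          l₃ = solve-∀
        small : ∀ c r m → c < r → m * r ≤ c * m → m ≡ 0
        small c r zero    lt le = refl
        small c r (suc m) lt le = ⊥-elim (ℕₚ.<⇒≱ (ℕₚ.*-monoˡ-< (suc m) lt) (subst (_≤ c * suc m) (ℕₚ.*-comm (suc m) r) le))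
        miss≡0 : miss ≡ 0
        miss≡0 = small (4 * v * C) r^q miss r^q-large (ℕₚ.≤-trans (near) 𝓤≤)
        𝓤≤0 : length 𝓤 ≤ 0
        𝓤≤0 = subst (length 𝓤 ≤_) (trans (cong (4 * v * C *_) miss≡0) (ℕₚ.*-zeroʳ (4 * v * C))) 𝓤≤

    largest⊆star : ∀ F → Largest P t F → 1 ≤ length F → ∃[ e ] (∀ {A} → A ∈ F → e ∈ˢ E A)
    largest⊆star F lar@((u , inU , int) , _) 1≤F =
      let e , near = Approx.approximate-star F u (λ A∈ → ∈-partitions⁺ (All.lookup inU A∈))
            (λ {A} {B} A∈ B∈ → PInt⇒common A B (int _ _ A∈ B∈)) (dense lar) pairs 1≤F
      in e , near-star⇒star F lar e near
      where
      open ≤-Reasoning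
      pairs : ∀ e e′ → e ≢ e′ → Approx.pairDegree e e′ * (4 * (q * q)) ≤ length F
      pairs e e′ e≢ = ℕₚ.*-cancelʳ-≤ _ _ k {{>-nonZero 1≤k}} (begin
        d * (4 * (q * q)) * k     ≡⟨ trans (ℕₚ.*-assoc d _ k) (cong (d *_) (ℕₚ.*-comm _ k)) ⟩
        d * (k * (4 * (q * q)))   ≤⟨ ℕₚ.*-monoʳ-≤ d pair-small ⟩
        d * a₁                    ≤⟨ pair≤star e e′ e≢ pair-room ⟩
        star e * k                ≤⟨ ℕₚ.*-monoˡ-≤ k (star≤largest lar e) ⟩
        length F * k              ∎)
        where
        d : ℕ
        d = Approx.pairDegree e e′

    largest-is-star : ∀ F → Largest P t F → ∃[ S ] ((∣ S ∣ ≡ t) × (∀ B → (B ∈ F) ⇔ InC P S B))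
    largest-is-star F lar with 1 ≤? length F
    ... | yes 1≤F =
      let e , inside = largest⊆star F lar 1≤F
      in T e , ∣T∣ e , largest-in-star lar (∣T∣ e) λ {A} A∈ → All.lookup (proj₁ (proj₂ (proj₁ lar))) A∈ , E⁻ A (inside A∈)
    -- If a largest family is empty, `dense` leaves no partitions at all, and any t-set will do.
    ... | no F-empty =
      let S , _ , ∣S∣ = ∃-subset t Subset.⊤ (subst (t ≤_) (sym (Subsetₚ.∣⊤∣≡n n)) (ℕₚ.≤-trans (ℕₚ.m≤m+n t _) (ℕₚ.<⇒≤ switch-room)))
      in S , ∣S∣ , λ B → mk⇔
           (λ B∈ → ⊥-elim (F-empty (∈ₚ.∈-length B∈)))
           (λ (B∈ , _) → ⊥-elim (F-empty (ℕₚ.n≢0⇒n>0 λ eq → ℕₚ.<-irrefl refl (ℕₚ.≤-trans (∈ₚ.∈-length (∈-partitions⁺ B∈))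
             (ℕₚ.≤-trans (dense lar) (ℕₚ.≤-reflexive (trans (cong (v *_) eq) (ℕₚ.*-zeroʳ v))))))))

≤last : ∀ {ℓ} (P : Vec ℕ ℓ) {k} → NonDecreasing P → LastIs P k → ∀ i → lookup P i ≤ k
≤last (x ∷ [])     _           refl zero    = ℕₚ.≤-refl
≤last (x ∷ y ∷ xs) (x≤y , mono) last zero    = ℕₚ.≤-trans x≤y (≤last (y ∷ xs) mono last zero)
≤last (x ∷ y ∷ xs) (x≤y , mono) last (suc i) = ≤last (y ∷ xs) mono last i

last-index : ∀ {ℓ} (P : Vec ℕ ℓ) {k} → LastIs P k → ∃[ i ] (lookup P i ≡ k)
last-index (x ∷ [])     eq   = zero , eq
last-index (x ∷ y ∷ xs) last with last-index (y ∷ xs) last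
... | i , eq = suc i , eq

length≤sum : ∀ {ℓ} (P : Vec ℕ ℓ) → AllPositive P → ℓ ≤ sum P
length≤sum []       _           = z≤n
length≤sum (x ∷ xs) (1≤x , pos) = ℕₚ.+-mono-≤ 1≤x (length≤sum xs pos)

-- Choice of the constants

-- Pascal's rule. With base n + 1 the induction closes: (n+1)^t + (n+1)^(t+1) = (n+2)(n+1)^t, at
-- most (n+2)^(t+1).
tSets-bound : ∀ n t → ∑ (subsets n) (λ p → ⟦ ∣ p ∣ ℕₚ.≟ t ⟧) ≤ suc n ^ t
tSets-bound zero t = ℕₚ.≤-trans (ℕₚ.+-mono-≤ (⟦⟧-≤1 (0 ℕₚ.≟ t)) z≤n) (ℕₚ.m^n>0 1 t)
tSets-bound (suc n) zero = begin
  ∑ (subsets (suc n)) (λ p → ⟦ ∣ p ∣ ℕₚ.≟ 0 ⟧)  ≡⟨ ∑-subsets-suc n _ ⟩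
  ∑ (subsets n) (λ p → 0) + ∑ (subsets n) (λ p → ⟦ ∣ p ∣ ℕₚ.≟ 0 ⟧) ≡⟨ cong (_+ ∑ (subsets n) (λ p → ⟦ ∣ p ∣ ℕₚ.≟ 0 ⟧)) (∑-0 (subsets n)) ⟩
  ∑ (subsets n) (λ p → ⟦ ∣ p ∣ ℕₚ.≟ 0 ⟧)        ≤⟨ tSets-bound n zero ⟩
  1 ∎
  where open ≤-Reasoning
tSets-bound (suc n) (suc t) = begin
  ∑ (subsets (suc n)) (λ p → ⟦ ∣ p ∣ ℕₚ.≟ suc t ⟧)  ≡⟨ ∑-subsets-suc n _ ⟩
  ∑ (subsets n) (λ p → ⟦ suc ∣ p ∣ ℕₚ.≟ suc t ⟧) + ∑ (subsets n) (λ p → ⟦ ∣ p ∣ ℕₚ.≟ suc t ⟧)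
    ≤⟨ ℕₚ.+-mono-≤ (∑-mono (subsets n) λ {p} _ → ⟦⟧-mono (suc ∣ p ∣ ℕₚ.≟ suc t) (∣ p ∣ ℕₚ.≟ t) ℕₚ.suc-injective) ℕₚ.≤-refl ⟩
  ∑ (subsets n) (λ p → ⟦ ∣ p ∣ ℕₚ.≟ t ⟧) + ∑ (subsets n) (λ p → ⟦ ∣ p ∣ ℕₚ.≟ suc t ⟧)
    ≤⟨ ℕₚ.+-mono-≤ (tSets-bound n t) (tSets-bound n (suc t)) ⟩
  suc n ^ t + suc n * suc n ^ t                     ≤⟨ ℕₚ.*-monoʳ-≤ (2 + n) (ℕₚ.^-monoˡ-≤ t (ℕₚ.n≤1+n (suc n))) ⟩
  suc (suc n) * suc (suc n) ^ t                     ∎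
  where open ≤-Reasoning

n<2^n : ∀ n → n < 2 ^ n
n<2^n zero    = s≤s z≤n
n<2^n (suc n) = begin-strict
  suc n          ≤⟨ n<2^n n ⟩
  2 ^ n          <⟨ ℕₚ.m<m*n (2 ^ n) 2 {{ℕₚ.m^n≢0 2 n}} (s≤s (s≤s z≤n)) ⟩
  2 ^ n * 2      ≡⟨ ℕₚ.*-comm (2 ^ n) 2 ⟩
  2 ^ suc n      ∎
  where open ≤-Reasoning

-- Halving R turns a · R^(b+1) into the product of a degree b polynomial in ⌊R/2⌋ and ⌊R/2⌋ < 2^⌊R/2⌋.
polynomial≤exponential : ∀ b a → ∃[ R₀ ] (∀ R → R₀ ≤ R → a * R ^ b ≤ 2 ^ R)
polynomial≤exponential zero a = a , λ R a≤R → begin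
  a * 1    ≡⟨ ℕₚ.*-identityʳ a ⟩
  a        ≤⟨ a≤R ⟩
  R        ≤⟨ ℕₚ.<⇒≤ (n<2^n R) ⟩
  2 ^ R    ∎
  where open ≤-Reasoning
polynomial≤exponential (suc b) a with polynomial≤exponential b (a * 3 ^ suc b)
... | R₁ , bound = 2 * suc R₁ , λ R big → let h = ⌊ R /2⌋ in begin
  a * R ^ suc b                         ≤⟨ ℕₚ.*-monoʳ-≤ a (ℕₚ.^-monoˡ-≤ (suc b) (R≤3h R big)) ⟩
  a * (3 * h) ^ suc b                   ≡⟨ cong (a *_) (^-distribʳ-* 3 h (suc b)) ⟩
  a * (3 ^ suc b * (h * h ^ b))         ≡⟨ l a (3 ^ suc b) h (h ^ b) ⟩
  a * 3 ^ suc b * h ^ b * h             ≤⟨ ℕₚ.*-mono-≤ (bound h (ℕₚ.≤-trans (ℕₚ.n≤1+n R₁) (h≥ R big))) (ℕₚ.<⇒≤ (n<2^n h)) ⟩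
  2 ^ h * 2 ^ h                         ≡⟨ ℕₚ.^-distribˡ-+-* 2 h h ⟨
  2 ^ (h + h)                           ≤⟨ ℕₚ.^-monoʳ-≤ 2 (2h≤ R) ⟩
  2 ^ R                                 ∎
  where
  open ≤-Reasoning
  l : ∀ a c h x → a * (c * (h * x)) ≡ a * c * x * h
  l = solve-∀
  2h≤ : ∀ R → ⌊ R /2⌋ + ⌊ R /2⌋ ≤ R
  2h≤ zero          = z≤n
  2h≤ (suc zero)    = z≤n
  2h≤ (suc (suc R)) = s≤s (subst (_≤ suc R) (sym (ℕₚ.+-suc ⌊ R /2⌋ ⌊ R /2⌋)) (s≤s (2h≤ R)))
  R≤2h+1 : ∀ R → R ≤ 1 + 2 * ⌊ R /2⌋
  R≤2h+1 zero          = z≤n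
  R≤2h+1 (suc zero)    = s≤s z≤n
  R≤2h+1 (suc (suc R)) = s≤s (ℕₚ.≤-trans (s≤s (R≤2h+1 R)) (ℕₚ.≤-reflexive (sym (ℕₚ.*-suc 2 ⌊ R /2⌋))))
  h≥ : ∀ R → 2 * suc R₁ ≤ R → suc R₁ ≤ ⌊ R /2⌋
  h≥ R big = subst (_≤ ⌊ R /2⌋) (trans (cong ⌊_/2⌋ (cong (suc R₁ +_) (ℕₚ.+-identityʳ (suc R₁)))) (sym (ℕₚ.n≡⌊n+n/2⌋ (suc R₁)))) (ℕₚ.⌊n/2⌋-mono big)
  R≤3h : ∀ R → 2 * suc R₁ ≤ R → R ≤ 3 * ⌊ R /2⌋
  R≤3h R big = ℕₚ.≤-trans (R≤2h+1 R) (ℕₚ.+-monoˡ-≤ (2 * ⌊ R /2⌋) (ℕₚ.≤-trans (s≤s z≤n) (h≥ R big)))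

binary-length : ∀ n → 1 ≤ n → ∃[ L ] (2 ^ L ≤ n × n < 2 ^ suc L)
binary-length (suc zero)    _ = 0 , s≤s z≤n , s≤s (s≤s z≤n)
binary-length (suc (suc n)) _ with binary-length (suc n) (s≤s z≤n)
... | L , lo , hi with suc (suc n) <? 2 ^ suc L
... | yes lt = L , ℕₚ.≤-trans lo (ℕₚ.n≤1+n _) , lt
... | no ≮  = suc L , ℕₚ.≮⇒≥ ≮ , ℕₚ.≤-<-trans hi (ℕₚ.^-monoʳ-< 2 (s≤s (s≤s z≤n)) (ℕₚ.n<1+n (suc L)))

module Constants (k t : ℕ) (2≤t : 2 ≤ t) (t≤k : t ≤ k) where

  -- `M` is the exponent in `partitions-spread`, and `b` is the coefficient in r * r = b * R^4. For
  -- `c`: when n + 1 is at most 2^R, the quantity that `r ^ q` must exceed is at most 2 to the power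
  -- 2 + tR + 8k²R, which is below `c * R`.
  M c b : ℕ
  M = 4 * 2 ^ k
  c = t + 8 * (k * k) + 3
  b = 2 * 2 * (4 * 4) * (4 * 4)

  module _ (R : ℕ) (1≤R : 1 ≤ R) where

    ρ r q : ℕ
    ρ = (4 * R) * (4 * R)
    r = 2 * ρ
    q = c * R

    1≤R^ : ∀ d → 1 ≤ R ^ d
    1≤R^ d = ℕₚ.m^n>0 R {{>-nonZero 1≤R}} d

    spread-bound : 2 * (k * (r * r) ^ M) + 2 ≤ (2 * (k * b ^ M) + 2) * R ^ (4 * M)
    spread-bound = begin
      2 * (k * (r * r) ^ M) + 2                     ≡⟨ cong (λ z → 2 * (k * z) + 2) power ⟩
      2 * (k * (b ^ M * R ^ (4 * M))) + 2           ≤⟨ ℕₚ.+-monoʳ-≤ _ (ℕₚ.*-monoʳ-≤ 2 (1≤R^ (4 * M))) ⟩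
      2 * (k * (b ^ M * R ^ (4 * M))) + 2 * R ^ (4 * M) ≡⟨ l k (b ^ M) (R ^ (4 * M)) ⟩
      (2 * (k * b ^ M) + 2) * R ^ (4 * M)           ∎
      where
      open ≤-Reasoning
      l : ∀ k x y → 2 * (k * (x * y)) + 2 * y ≡ (2 * (k * x) + 2) * y
      l = solve-∀
      square : ∀ u w R → u * ((w * R) * (w * R)) * (u * ((w * R) * (w * R))) ≡ u * u * (w * w) * (w * w) * (R * (R * (R * (R * 1))))
      square = solve-∀
      power : (r * r) ^ M ≡ b ^ M * R ^ (4 * M)
      power = trans (cong (_^ M) (square 2 4 R)) (trans (^-distribʳ-* b (R ^ 4) M) (cong (b ^ M *_) (ℕₚ.^-*-assoc R 4 M)))

    pair-bound : k * (4 * (q * q)) + suc t ≤ (k * (4 * (c * c)) + suc t) * R ^ 2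
    pair-bound = begin
      k * (4 * (q * q)) + suc t                       ≡⟨ cong (_+ suc t) (l₁ k c R) ⟩
      k * (4 * (c * c)) * R ^ 2 + suc t               ≡⟨ cong (k * (4 * (c * c)) * R ^ 2 +_) (ℕₚ.*-identityʳ (suc t)) ⟨
      k * (4 * (c * c)) * R ^ 2 + suc t * 1           ≤⟨ ℕₚ.+-monoʳ-≤ _ (ℕₚ.*-monoʳ-≤ (suc t) (1≤R^ 2)) ⟩
      k * (4 * (c * c)) * R ^ 2 + suc t * R ^ 2       ≡⟨ ℕₚ.*-distribʳ-+ (R ^ 2) (k * (4 * (c * c))) (suc t) ⟨
      (k * (4 * (c * c)) + suc t) * R ^ 2             ∎
      where
      open ≤-Reasoning
      l₁ : ∀ k c R → k * (4 * ((c * R) * (c * R))) ≡ k * (4 * (c * c)) * (R * (R * 1))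
      l₁ = solve-∀

    q-bound : c ≤ R → 2 * q ≤ 2 * ρ
    q-bound c≤R = ℕₚ.*-monoʳ-≤ 2 (ℕₚ.*-mono-≤ (ℕₚ.≤-trans c≤R (ℕₚ.m≤n*m R 4)) (ℕₚ.m≤n*m R 4))

    -- Everything is turned into a power of 2 through `suc n ≤ 2 ^ R`. On the right the crude bound
    -- `2 ≤ r` suffices, as `c` was chosen for the exponent alone.
    exponential-bound : ∀ n v → suc n ≤ 2 ^ R → v ≤ suc n ^ t → 4 * v * (1 + n * n) ^ (4 * (k * k)) < r ^ q
    exponential-bound n v n<2^R v≤ = begin-strict
      4 * v * (1 + n * n) ^ top
        ≤⟨ ℕₚ.*-mono-≤ (ℕₚ.*-monoʳ-≤ 4 (ℕₚ.≤-trans v≤ (ℕₚ.^-monoˡ-≤ t n<2^R)))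
             (ℕₚ.^-monoˡ-≤ top (ℕₚ.≤-trans (s≤s (ℕₚ.≤-trans (ℕₚ.*-monoʳ-≤ n (ℕₚ.n≤1+n n)) (ℕₚ.m≤n+m _ n)))
               (ℕₚ.*-mono-≤ n<2^R n<2^R))) ⟩
      4 * (2 ^ R) ^ t * (2 ^ R * 2 ^ R) ^ top
        ≡⟨ cong₂ (λ x y → 4 * x * y) (ℕₚ.^-*-assoc 2 R t)
             (trans (cong (_^ top) (sym (ℕₚ.^-distribˡ-+-* 2 R R))) (ℕₚ.^-*-assoc 2 (R + R) top)) ⟩
      2 ^ 2 * 2 ^ (R * t) * 2 ^ ((R + R) * top)
        ≡⟨ trans (ℕₚ.^-distribˡ-+-* 2 (2 + R * t) ((R + R) * top)) (cong (_* 2 ^ ((R + R) * top)) (ℕₚ.^-distribˡ-+-* 2 2 (R * t))) ⟨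
      2 ^ (2 + R * t + (R + R) * top)
        <⟨ ℕₚ.^-monoʳ-< 2 (s≤s (s≤s z≤n)) exponents ⟩
      2 ^ q
        ≤⟨ ℕₚ.^-monoˡ-≤ q (ℕₚ.*-monoʳ-≤ 2 {1} {ρ} (ℕₚ.*-mono-≤ (ℕₚ.≤-trans 1≤R (ℕₚ.m≤n*m R 4)) (ℕₚ.≤-trans 1≤R (ℕₚ.m≤n*m R 4)))) ⟩
      r ^ q ∎
      where
      open ≤-Reasoning
      top : ℕ
      top = 4 * (k * k)
      exponents : 2 + R * t + (R + R) * (4 * (k * k)) < c * R
      exponents = begin-strict
        2 + R * t + (R + R) * (4 * (k * k))    ≡⟨ l₁ R t (k * k) ⟩
        (t + 8 * (k * k)) * R + 2              <⟨ ℕₚ.+-monoʳ-< _ (ℕₚ.*-monoʳ-≤ 3 1≤R) ⟩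
        (t + 8 * (k * k)) * R + 3 * R          ≡⟨ ℕₚ.*-distribʳ-+ R (t + 8 * (k * k)) 3 ⟨
        c * R                                  ∎
        where
        l₁ : ∀ R t x → 2 + R * t + (R + R) * (4 * x) ≡ (t + 8 * x) * R + 2
        l₁ = solve-∀

  private
    -- Coefficients of the three demands on n: spreadness, pairs, and constant room for switches and
    -- for `half`. The factor `2 ^ suc k` in the thresholds below makes up for 2^R being as large as
    -- `2 ^ suc k * n`.
    p₁ p₂ p₃ : ℕ
    p₁ = 2 * (k * b ^ M) + 2
    p₂ = k * (4 * (c * c)) + suc t
    p₃ = suc (t + (k + (k * k + k * k))) + (suc t + suc t)
    big₁ = polynomial≤exponential (4 * M) (2 ^ suc k * p₁)
    big₂ = polynomial≤exponential 2 (2 ^ suc k * p₂)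
    big₃ = polynomial≤exponential 0 (2 ^ suc k * p₃)

  R₀ : ℕ
  R₀ = c + (proj₁ big₁ + (proj₁ big₂ + proj₁ big₃))

  theorem-large : ∀ {ℓ} → 2 ^ R₀ ≤ ℓ → (P : Vec ℕ ℓ) → IsProfile P → LastIs P k → ∀ F → Largest P t F →
    ∃[ T ] ((∣ T ∣ ≡ t) × (∀ B → (B ∈ F) ⇔ InC P T B))
  theorem-large {ℓ} ℓ-large P (positive , mono) last = LC.largest-is-star
    R (q R 1≤R) (ρ R 1≤R) (n ∸ suc t) (n ∸ suc t) 1≤R size-room ℕₚ.≤-refl (q-bound R 1≤R c≤R)
    (ℕₚ.≤-trans (spread-bound R 1≤R) (scale p₁ (4 * M) (proj₂ big₁ R R₀₁≤R)))
    (ℕₚ.≤-reflexive (ℕₚ.m∸n+n≡m t<n))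
    (ℕₚ.m+n≤o⇒m≤o∸n _ (ℕₚ.≤-trans (pair-bound R 1≤R) (scale p₂ 2 (proj₂ big₂ R R₀₂≤R))))
    (ℕₚ.≤-trans (ℕₚ.m≤m+n _ _) p₃≤n)
    (ℕₚ.≤-reflexive (ℕₚ.m∸n+n≡m t<n)) half
    (exponential-bound R 1≤R n LC.v n<2^R v≤)
    where
    open ≤-Reasoning
    n : ℕ
    n = sum P
    2≤k : 2 ≤ k
    2≤k = ℕₚ.≤-trans 2≤t t≤k
    index : ∃[ i ] (lookup P i ≡ k)
    index = last-index P last
    module LC = LargeCase P k t (≤last P mono last) (ℕₚ.≤-trans (s≤s z≤n) 2≤k) 2≤t (proj₁ index)
      (subst (t ≤_) (sym (proj₂ index)) t≤k)
    2^R₀≤n : 2 ^ R₀ ≤ n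
    2^R₀≤n = ℕₚ.≤-trans ℓ-large (length≤sum P positive)
    log : ∃[ L ] (2 ^ L ≤ n × n < 2 ^ suc L)
    log = binary-length n (ℕₚ.≤-trans (ℕₚ.m^n>0 2 R₀) 2^R₀≤n)
    L R : ℕ
    L = proj₁ log
    -- `L` is the integer part of the binary logarithm of n. Adding `suc k` ensures
    -- `n * 2 ^ k < 2 ^ R`, the size bound for `E B`, while 2^R remains at most a constant times n.
    R = suc k + L
    1≤R : 1 ≤ R
    1≤R = s≤s z≤n
    R₀≤L : R₀ ≤ L
    R₀≤L = ℕₚ.≮⇒≥ λ lt → ℕₚ.<⇒≱ (proj₂ (proj₂ log)) (ℕₚ.≤-trans (ℕₚ.^-monoʳ-≤ 2 lt) 2^R₀≤n)
    R₀≤R : R₀ ≤ R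
    R₀≤R = ℕₚ.≤-trans R₀≤L (ℕₚ.m≤n+m L (suc k))
    c≤R : c ≤ R
    c≤R = ℕₚ.≤-trans (ℕₚ.m≤m+n c _) R₀≤R
    R₀₁≤R : proj₁ big₁ ≤ R
    R₀₁≤R = ℕₚ.≤-trans (ℕₚ.m≤m+n _ _) (ℕₚ.≤-trans (ℕₚ.m≤n+m _ c) R₀≤R)
    R₀₂≤R : proj₁ big₂ ≤ R
    R₀₂≤R = ℕₚ.≤-trans (ℕₚ.m≤m+n _ _) (ℕₚ.≤-trans (ℕₚ.m≤n+m _ (proj₁ big₁)) (ℕₚ.≤-trans (ℕₚ.m≤n+m _ c) R₀≤R))
    R₀₃≤R : proj₁ big₃ ≤ R
    R₀₃≤R = ℕₚ.≤-trans (ℕₚ.m≤n+m _ (proj₁ big₂)) (ℕₚ.≤-trans (ℕₚ.m≤n+m _ (proj₁ big₁)) (ℕₚ.≤-trans (ℕₚ.m≤n+m _ c) R₀≤R))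
    scale : ∀ p d → 2 ^ suc k * p * R ^ d ≤ 2 ^ R → p * R ^ d ≤ n
    scale p d le = ℕₚ.≤-trans (ℕₚ.*-cancelˡ-≤ (2 ^ suc k) {{ℕₚ.m^n≢0 2 (suc k)}} (begin
      2 ^ suc k * (p * R ^ d)   ≡⟨ ℕₚ.*-assoc (2 ^ suc k) p (R ^ d) ⟨
      2 ^ suc k * p * R ^ d     ≤⟨ le ⟩
      2 ^ R                     ≡⟨ ℕₚ.^-distribˡ-+-* 2 (suc k) L ⟩
      2 ^ suc k * 2 ^ L         ∎)) (proj₁ (proj₂ log))
    p₃≤n : p₃ ≤ n
    p₃≤n = subst (_≤ n) (ℕₚ.*-identityʳ p₃) (scale p₃ 0 (proj₂ big₃ R R₀₃≤R))
    2t≤n : suc t + suc t ≤ n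
    2t≤n = ℕₚ.≤-trans (ℕₚ.m≤n+m (suc t + suc t) (suc (t + (k + (k * k + k * k))))) p₃≤n
    t<n : suc t ≤ n
    t<n = ℕₚ.≤-trans (ℕₚ.m≤m+n _ _) 2t≤n
    half : n ≤ 2 * (n ∸ suc t)
    half = begin
      n                                ≡⟨ ℕₚ.m∸n+n≡m t<n ⟨
      n ∸ suc t + suc t                ≤⟨ ℕₚ.+-monoʳ-≤ (n ∸ suc t) (ℕₚ.m+n≤o⇒m≤o∸n (suc t) 2t≤n) ⟩
      n ∸ suc t + (n ∸ suc t)          ≡⟨ cong (n ∸ suc t +_) (ℕₚ.+-identityʳ _) ⟨
      2 * (n ∸ suc t)                  ∎
    n<2^R : suc n ≤ 2 ^ R
    n<2^R = ℕₚ.≤-trans (proj₂ (proj₂ log)) (ℕₚ.^-monoʳ-≤ 2 (s≤s (ℕₚ.m≤n+m L k)))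
    size-room : n * 2 ^ k < 2 ^ R
    size-room = begin-strict
      n * 2 ^ k              <⟨ ℕₚ.*-monoˡ-< (2 ^ k) {{ℕₚ.m^n≢0 2 k}} (proj₂ (proj₂ log)) ⟩
      2 ^ suc L * 2 ^ k      ≡⟨ ℕₚ.^-distribˡ-+-* 2 (suc L) k ⟨
      2 ^ (suc L + k)        ≡⟨ cong (λ z → 2 ^ suc z) (ℕₚ.+-comm L k) ⟩
      2 ^ R                  ∎
    v≤ : LC.v ≤ suc n ^ t
    v≤ = ℕₚ.≤-trans (ℕₚ.≤-reflexive (length-filter (λ p → ∣ p ∣ ℕₚ.≟ t) (subsets n))) (tSets-bound n t)

-- For a single point `x` the star is all of 𝓤, as every partition has a part containing `x`. So
-- every family lies inside it; `1 ≤ ℓ` supplies the point.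
theorem-1 : ∀ {ℓ} → 1 ≤ ℓ → (P : Vec ℕ ℓ) → IsProfile P → ∀ F → Largest P 1 F →
  ∃[ T ] ((∣ T ∣ ≡ 1) × (∀ B → (B ∈ F) ⇔ InC P T B))
theorem-1 1≤ℓ P (positive , _) F lar@((_ , inU , _) , _) =
  ⁅ x ⁆ , Subsetₚ.∣⁅x⁆∣≡1 x , Stars.largest-in-star P 1 lar (Subsetₚ.∣⁅x⁆∣≡1 x) λ {A} A∈ →
    let A∈U = All.lookup inU A∈ in
    A∈U , x , λ y∈ → subst (_∈ˢ lookup A x) (sym (Subsetₚ.x∈⁅y⁆⇒x≡y x y∈)) (Profile.∼-refl P A∈U x)
  where
  x : Fin (sum P)
  x = Fin.fromℕ< (ℕₚ.≤-trans 1≤ℓ (length≤sum P positive))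

theorem9 : ∀ (k t : ℕ) → 1 ≤ t → t ≤ k →
    ∃[ ℓ₀ ] (∀ (ℓ : ℕ) → ℓ₀ ≤ ℓ → (P : Vec ℕ ℓ) → IsProfile P → LastIs P k →
    ∀ F → Largest P t F →
    ∃[ T ] ((∣ T ∣ ≡ t) × (∀ R → (R ∈ F) ⇔ InC P T R)))
theorem9 k (suc zero)    1≤t t≤k = 1 , λ ℓ 1≤ℓ P profile _ → theorem-1 1≤ℓ P profile
theorem9 k (suc (suc t)) 1≤t t≤k = 2 ^ C.R₀ , λ ℓ → C.theorem-large
  where module C = Constants k (suc (suc t)) (s≤s (s≤s z≤n)) t≤k
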